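{- For every $\epsilon>0$ there exists $\delta>0$ such that the following holds. Let $G$ be a $5$-partite graph on vertex sets $V_1,\dots,V_5$ with $|V_1|=\cdots=|V_5|=n$, such that every edge of $G$ lies between $V_i$ and $V_{i+1}$ for some $i$ (indices taken mod $5$). Suppose that (a) $G$ has at most $\delta n^2$ copies of $C_4$ whose vertices lie in two different parts $V_i$ (i.e., all vertices of the $4$-cycle lie in $V_i\cup V_j$ for some $i\neq j$), and (b) $G$ has at most $\delta n^{5/2}$ copies of $C_5$. Then $G$ can be made $C_5$-free by removing at most $\epsilon n^{3/2}$ edges.
   Context: A copy of $C_k$ is a subgraph isomorphic to the cycle of length $k$. -}

module Defs where

open import Data.Bool using (Bool; true; false; _∧_; _∨_; not; T)
open import Data.Nat using (ℕ; zero; suc; _*_; _^_)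
open import Data.Nat.DivMod using (_/_)
open import Data.Fin using (Fin) renaming (_≟_ to _≟F_)
import Data.Fin as Fin
open import Data.List using (List; []; _∷_; [_]; map; concatMap; filterᵇ; length; cartesianProduct; allFin)
open import Data.Product using (_×_; _,_; proj₁)
open import Data.Product.Properties using (≡-dec)
open import Data.Bool.ListAction using (all; any)
open import Data.Sum using (_⊎_)
open import Relation.Nullary.Decidable using (⌊_⌋)
open import Relation.Binary.PropositionalEquality using (_≡_)
open import Data.Integer using (+_)
import Data.Rational as ℚ
open ℚ using (ℚ)

Vtx : ℕ → Set
Vtx n = Fin 5 × Fin n

part : ∀ {n} → Vtx n → Fin 5
part = proj₁

suc5 : Fin 5 → Fin 5
suc5 i = Fin.fromℕ< {suc (Fin.toℕ i) Data.Nat.% 5} (Data.Nat.DivMod.m%n<n (suc (Fin.toℕ i)) 5)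

_==V_ : ∀ {n} → Vtx n → Vtx n → Bool
x ==V y = ⌊ ≡-dec _≟F_ _≟F_ x y ⌋

_==F_ : Fin 5 → Fin 5 → Bool
i ==F j = ⌊ i ≟F j ⌋

verts : (n : ℕ) → List (Vtx n)
verts n = cartesianProduct (allFin 5) (allFin n)

Adj : ℕ → Set
Adj n = Vtx n → Vtx n → Bool

record CycGraph (n : ℕ) : Set where
  field
    adj    : Adj n
    sym    : ∀ x y → adj x y ≡ adj y x
    irrefl : ∀ x → adj x x ≡ false
    cyc    : ∀ x y → adj x y ≡ true →
             (part y ≡ suc5 (part x)) ⊎ (part x ≡ suc5 (part y))
open CycGraph public

tuples : ∀ {A : Set} → ℕ → List A → List (List A)
tuples zero    xs = [ [] ]
tuples (suc k) xs = concatMap (λ x → map (x ∷_) (tuples k xs)) xs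

allDistinct : ∀ {n} → List (Vtx n) → Bool
allDistinct []       = true
allDistinct (x ∷ xs) = all (λ y → not (x ==V y)) xs ∧ allDistinct xs

pathTo : ∀ {n} → Adj n → Vtx n → List (Vtx n) → Bool
pathTo a first []           = true
pathTo a first (x ∷ [])     = a x first
pathTo a first (x ∷ y ∷ ys) = a x y ∧ pathTo a first (y ∷ ys)

isCycle : ∀ {n} → Adj n → List (Vtx n) → Bool
isCycle a []       = false
isCycle a (x ∷ xs) = allDistinct (x ∷ xs) ∧ pathTo a x (x ∷ xs)

inTwoParts : ∀ {n} → List (Vtx n) → Bool
inTwoParts vs = any (λ i → any (λ j → not (i ==F j) ∧
                  all (λ v → (part v ==F i) ∨ (part v ==F j)) vs) (allFin 5)) (allFin 5)

-- Number of copies (subgraphs isomorphic to C_4 / C_5).  Each copy of C_k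
-- (k ≥ 3) corresponds to exactly 2k labelled cyclic tuples, so the number of
-- copies is the number of such tuples divided by 2k (exact division).
copiesC4in2parts : ∀ {n} → Adj n → ℕ
copiesC4in2parts {n} a =
  length (filterᵇ (λ vs → isCycle a vs ∧ inTwoParts vs) (tuples 4 (verts n))) / 8

copiesC5 : ∀ {n} → Adj n → ℕ
copiesC5 {n} a = length (filterᵇ (isCycle a) (tuples 5 (verts n))) / 10

record Subgraph {n : ℕ} (H : Adj n) (G : CycGraph n) : Set where
  field
    sub-sym  : ∀ x y → H x y ≡ H y x
    sub-edge : ∀ x y → H x y ≡ true → adj G x y ≡ true

-- number of edges of G not in H (ordered pairs / 2; exact by symmetry)
removedEdges : ∀ {n} → CycGraph n → Adj n → ℕ
removedEdges {n} G H =
  length (filterᵇ (λ p → adj G (proj₁ p) (Data.Product.proj₂ p) ∧ not (H (proj₁ p) (Data.Product.proj₂ p)))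
                  (cartesianProduct (verts n) (verts n))) / 2

ℕ→ℚ : ℕ → ℚ
ℕ→ℚ m = (+ m) ℚ./ 1

{-# OPTIONS --safe #-}
module Submission where

-- Write s ≈ √n, and split a pentagon v x w u y (one vertex in each part) into the two arms v–x–w and v–y–u and
-- the edge wu.
--
-- Sparse to dense.  Cover each bipartite graph f by a dense graph Γ, starting with the complete one: as long as
-- some X, Y span at least n²/a edges of Γ but fewer than ns/c edges of f, delete X × Y from Γ.  After at most a
-- steps Γ has boundedly many different columns, only few edges of f lie outside Γ, and every X, Y spanning n²/a
-- edges of Γ span at least ns/c edges of f ("Γ dominates f").  If Γ-pentagons are dense, one passes from Γ to f one
-- arm at a time: few 4-cycles and Cauchy–Schwarz show that the pairs joined by a 2-path of f₁, f₂ dominate the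
-- pairs joined by many 2-paths of Γ₁, Γ₂, and three rounds of averaging over triangles v, w, u give order n² s
-- pentagons in f.  The thresholds a are chosen successively, which makes all the dependencies consistent.
--
-- Dense removal.  So Γ has few pentagons.  Only the graph between the parts of w and u has to be regularised: refine
-- two partitions as long as many live pairs of cells contain large X, Y with almost no edges between them, and
-- declare such X × Y dead; the measure of the live zone is the potential.  Then delete the edges leading from
-- a vertex to a cell in which it has few neighbours, the edges from v to the middle vertices that reach a cell
-- that v rarely reaches, and the few vertices v that reach a live pair of cells.
--
-- Dense to sparse.  The deleted set of pairs has few different columns and small measure, so, by the bound on
-- 4-cycles, it contains few edges of f.

module PentagonRemoval where
  open import Algebra.Bundles using (CommutativeMonoid)
  import Algebra.Properties.CommutativeSemigroup
  import Algebra.Properties.Semiring.Sum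
  open import Data.Bool using (Bool; true; false; _∧_; _∨_; not)
  open import Data.Bool.ListAction using (any; all)
  open import Data.Bool.Properties using (∨-comm)
  open import Data.Empty using (⊥; ⊥-elim)
  open import Data.Fin using (Fin; zero; suc; combine; remQuot; funToFin; finToFun) renaming (_≟_ to _≟F_)
  open import Data.Fin.Properties using (all?; remQuot-combine; finToFun-funToFin)
  open import Data.Fin.Subset.Properties using (anySubset?)
  import Data.Integer as ℤ
  import Data.Integer.Properties as ℤₚ
  open import Data.List using (List; []; _∷_; _++_; map; concatMap; filterᵇ; length; cartesianProduct; allFin) renaming (tabulate to tabulateᴸ)
  open import Data.Nat
  open import Data.Nat.Coprimality using (1-coprimeTo) renaming (sym to coprime-sym)
  open import Data.Nat.DivMod using (m≡m%n+[m/n]*n; m%n<n; m/n*n≤m)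
  open import Data.Nat.Properties
  open import Data.Nat.Tactic.RingSolver using (solve-∀)
  open import Data.Product using (Σ; _×_; _,_; proj₁; proj₂; ∃; ∃₂)
  open import Data.Product.Properties using (≡-dec)
  import Data.Rational as ℚ
  import Data.Rational.Properties as ℚₚ
  import Data.Rational.Unnormalised as ℚᵘ
  import Data.Rational.Unnormalised.Properties as ℚᵘₚ
  open import Data.Sum using (_⊎_; inj₁; inj₂; [_,_]′)
  open import Data.Unit using (tt)
  open import Data.Vec using (lookup; tabulate)
  open import Data.Vec.Properties using (lookup∘tabulate)
  open import Function using (_∘_; flip; const)
  open import Relation.Binary.PropositionalEquality using (_≡_; _≢_; refl; sym; trans; cong; cong₂; subst; subst₂; module ≡-Reasoning)
  open import Relation.Nullary using (¬_; Dec; yes; no; does; contradiction; ¬?)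
  open import Relation.Nullary.Decidable using (toWitness; _×-dec_; _⊎-dec_; _→-dec_)
  open import Defs hiding (sym)
  import Defs
  open ℚ using (ℚ; mkℚ; Positive)
  module Sum = Algebra.Properties.Semiring.Sum +-*-semiring
  open Algebra.Properties.CommutativeSemigroup (CommutativeMonoid.commutativeSemigroup ℚₚ.*-1-commutativeMonoid) using (interchange)

  -- Sums and indicators

  variable
    n m : ℕ

  ⟦_⟧ : Bool → ℕ
  ⟦ true ⟧  = 1
  ⟦ false ⟧ = 0

  -- Opaque, so that unification may solve ∑ f = ∑ g by f = g.
  opaque
    ∑ : (Fin n → ℕ) → ℕ
    ∑ = Sum.sum

    ∑-empty : (f : Fin 0 → ℕ) → ∑ f ≡ 0
    ∑-empty f = refl

    ∑-suc : (f : Fin (suc n) → ℕ) → ∑ f ≡ f zero + ∑ (f ∘ suc)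
    ∑-suc f = refl

    ∑-cong : {f g : Fin n → ℕ} → (∀ i → f i ≡ g i) → ∑ f ≡ ∑ g
    ∑-cong = Sum.sum-cong-≗

    ∑-comm : (f : Fin n → Fin m → ℕ) → ∑ (λ i → ∑ (f i)) ≡ ∑ (λ j → ∑ (λ i → f i j))
    ∑-comm = Sum.∑-comm

    ∑-mono : {f g : Fin n → ℕ} → (∀ i → f i ≤ g i) → ∑ f ≤ ∑ g
    ∑-mono {zero}  f≤g = z≤n
    ∑-mono {suc n} f≤g = +-mono-≤ (f≤g zero) (∑-mono (λ i → f≤g (suc i)))

    ∑-const : ∀ n c → ∑ {n} (λ _ → c) ≡ n * c
    ∑-const zero    c = refl
    ∑-const (suc n) c = cong (c +_) (∑-const n c)

    term≤∑ : (f : Fin n → ℕ) (i : Fin n) → f i ≤ ∑ f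
    term≤∑ f zero    = m≤m+n (f zero) _
    term≤∑ f (suc i) = ≤-trans (term≤∑ (f ∘ suc) i) (m≤n+m _ (f zero))

    *-∑ : (c : ℕ) (f : Fin n → ℕ) → c * ∑ f ≡ ∑ (λ i → c * f i)
    *-∑ = Sum.*-distribˡ-sum

    ∑-* : (f : Fin n → ℕ) (c : ℕ) → ∑ f * c ≡ ∑ (λ i → f i * c)
    ∑-* f c = Sum.*-distribʳ-sum c f

    ∑-+ : (f g : Fin n → ℕ) → ∑ (λ i → f i + g i) ≡ ∑ f + ∑ g
    ∑-+ = Sum.∑-distrib-+

  ∑-bound : {f : Fin n → ℕ} (c : ℕ) → (∀ i → f i ≤ c) → ∑ f ≤ n * c
  ∑-bound {n} c f≤c = ≤-trans (∑-mono f≤c) (≤-reflexive (∑-const n c))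

  ∑-mono₂ : {f g : Fin n → Fin m → ℕ} → (∀ i j → f i j ≤ g i j) →
            ∑ (λ i → ∑ (f i)) ≤ ∑ (λ i → ∑ (g i))
  ∑-mono₂ f≤g = ∑-mono (λ i → ∑-mono (f≤g i))

  ∑-cong₂ : {f g : Fin n → Fin m → ℕ} → (∀ i j → f i j ≡ g i j) →
            ∑ (λ i → ∑ (f i)) ≡ ∑ (λ i → ∑ (g i))
  ∑-cong₂ f≡g = ∑-cong (λ i → ∑-cong (f≡g i))

  _==_ : Fin n → Fin n → Bool
  i == j = does (i ≟F j)

  ==-refl : (i : Fin n) → (i == i) ≡ true
  ==-refl i with i ≟F i
  ... | yes _  = refl
  ... | no i≢i = contradiction refl i≢i

  ==⇒≡ : (i j : Fin n) → (i == j) ≡ true → i ≡ j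
  ==⇒≡ i j eq with i ≟F j
  ... | yes i≡j = i≡j

  ∑-point : (i : Fin n) (g : Fin n → ℕ) → ∑ (λ j → ⟦ i == j ⟧ * g j) ≡ g i
  ∑-point {suc n} zero    g = begin
    ∑ (λ j → ⟦ zero == j ⟧ * g j)        ≡⟨ ∑-suc _ ⟩
    1 * g zero + ∑ {n} (λ j → 0)         ≡⟨ cong₂ _+_ (*-identityˡ (g zero)) (∑-const n 0) ⟩
    g zero + n * 0                       ≡⟨ cong (g zero +_) (*-zeroʳ n) ⟩
    g zero + 0                           ≡⟨ +-identityʳ _ ⟩
    g zero                               ∎
    where open ≡-Reasoning
  ∑-point {suc n} (suc i) g = trans (∑-suc _) (∑-point i (g ∘ suc))

  ∑-fibres : (t : Fin n → Fin m) (g : Fin n → ℕ) →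
             ∑ g ≡ ∑ (λ p → ∑ (λ x → ⟦ t x == p ⟧ * g x))
  ∑-fibres t g = trans (∑-cong (λ x → sym (∑-point (t x) (λ _ → g x))))
                       (∑-comm (λ x p → ⟦ t x == p ⟧ * g x))

  ⟦⟧≤1 : ∀ b → ⟦ b ⟧ ≤ 1
  ⟦⟧≤1 true  = ≤-refl
  ⟦⟧≤1 false = z≤n

  ⟦⟧*-≤ : ∀ b {x y} → (b ≡ true → x ≤ y) → ⟦ b ⟧ * x ≤ y
  ⟦⟧*-≤ true  {x} x≤y = ≤-trans (≤-reflexive (*-identityˡ x)) (x≤y refl)
  ⟦⟧*-≤ false     x≤y = z≤n

  ⟦⟧*≤ : ∀ b x → ⟦ b ⟧ * x ≤ x
  ⟦⟧*≤ b x = ⟦⟧*-≤ b (λ _ → ≤-refl)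

  ⟦⟧*-mono : ∀ b {x y} → (b ≡ true → x ≤ y) → ⟦ b ⟧ * x ≤ ⟦ b ⟧ * y
  ⟦⟧*-mono true  x≤y = *-monoʳ-≤ 1 (x≤y refl)
  ⟦⟧*-mono false x≤y = z≤n

  ⟦∧⟧ : ∀ a b → ⟦ a ∧ b ⟧ ≡ ⟦ a ⟧ * ⟦ b ⟧
  ⟦∧⟧ true  b = sym (*-identityˡ ⟦ b ⟧)
  ⟦∧⟧ false b = refl

  ⟦⟧-mono : ∀ {a b} → (a ≡ true → b ≡ true) → ⟦ a ⟧ ≤ ⟦ b ⟧
  ⟦⟧-mono {true}  a⇒b rewrite a⇒b refl = ≤-refl
  ⟦⟧-mono {false} a⇒b = z≤n

  does⇒ : {P : Set} (d : Dec P) → does d ≡ true → P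
  does⇒ (yes p) _ = p

  does-false⇒ : {P : Set} (d : Dec P) → does d ≡ false → ¬ P
  does-false⇒ (no ¬p) _ = ¬p

  ⇒does : {P : Set} (d : Dec P) → P → does d ≡ true
  ⇒does (yes _) _ = refl
  ⇒does (no ¬p) p = contradiction p ¬p

  ∧-true : ∀ {a b} → a ∧ b ≡ true → a ≡ true × b ≡ true
  ∧-true {true} eq = refl , eq

  ∧-intro : ∀ {a b} → a ≡ true → b ≡ true → a ∧ b ≡ true
  ∧-intro refl refl = refl

  not-true : ∀ {b} → not b ≡ true → b ≡ false
  not-true {false} _ = refl

  not-false : ∀ {b} → not b ≡ false → b ≡ true
  not-false {true} _ = refl

  ∨-false : ∀ {a b} → a ∨ b ≡ false → a ≡ false × b ≡ false
  ∨-false {false} eq = refl , eq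

  ∧-falseʳ : ∀ {a b} → a ≡ true → a ∧ b ≡ false → b ≡ false
  ∧-falseʳ refl eq = eq

  -- Dense sets of edges

  Sub : ℕ → Set
  Sub n = Fin n → Bool

  Rel : ℕ → Set
  Rel n = Fin n → Fin n → Bool

  size : Sub n → ℕ
  size X = ∑ λ x → ⟦ X x ⟧

  deg : Rel n → Sub n → Fin n → ℕ
  deg B Y x = ∑ λ y → ⟦ Y y ⟧ * ⟦ B x y ⟧

  edges : Rel n → Sub n → Sub n → ℕ
  edges B X Y = ∑ λ x → ⟦ X x ⟧ * deg B Y x

  record Dominates {n} (Γ f : Rel n) (a c S : ℕ) : Set where
    constructor dominating
    field
      dominate : ∀ X Y → n * n ≤ a * edges Γ X Y → S ≤ c * edges f X Y

  open Dominates

  size-≤ : (X : Sub n) → size X ≤ n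
  size-≤ {n} X = ≤-trans (∑-bound 1 (λ x → ⟦⟧≤1 (X x))) (≤-reflexive (*-identityʳ n))

  deg-≤-size : (B : Rel n) (Y : Sub n) (x : Fin n) → deg B Y x ≤ size Y
  deg-≤-size B Y x = ∑-mono λ y →
    ≤-trans (*-monoʳ-≤ ⟦ Y y ⟧ (⟦⟧≤1 (B x y))) (≤-reflexive (*-identityʳ _))

  deg-≤ : (B : Rel n) (Y : Sub n) (x : Fin n) → deg B Y x ≤ n
  deg-≤ B Y x = ≤-trans (deg-≤-size B Y x) (size-≤ Y)

  edges-≤ : (B : Rel n) (X Y : Sub n) → edges B X Y ≤ n * n
  edges-≤ {n} B X Y = ∑-bound n λ x → ≤-trans (⟦⟧*≤ (X x) _) (deg-≤ B Y x)

  edges-flip : (B : Rel n) (X Y : Sub n) → edges B X Y ≡ edges (flip B) Y X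
  edges-flip B X Y = begin
    ∑ (λ x → ⟦ X x ⟧ * ∑ (λ y → ⟦ Y y ⟧ * ⟦ B x y ⟧))
      ≡⟨ ∑-cong (λ x → *-∑ ⟦ X x ⟧ _) ⟩
    ∑ (λ x → ∑ (λ y → ⟦ X x ⟧ * (⟦ Y y ⟧ * ⟦ B x y ⟧)))
      ≡⟨ ∑-comm _ ⟩
    ∑ (λ y → ∑ (λ x → ⟦ X x ⟧ * (⟦ Y y ⟧ * ⟦ B x y ⟧)))
      ≡⟨ ∑-cong₂ (λ y x → swap ⟦ X x ⟧ ⟦ Y y ⟧ ⟦ B x y ⟧) ⟩
    ∑ (λ y → ∑ (λ x → ⟦ Y y ⟧ * (⟦ X x ⟧ * ⟦ B x y ⟧)))
      ≡⟨ ∑-cong (λ y → *-∑ ⟦ Y y ⟧ _) ⟨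
    ∑ (λ y → ⟦ Y y ⟧ * ∑ (λ x → ⟦ X x ⟧ * ⟦ B x y ⟧)) ∎
    where
    open ≡-Reasoning
    swap : ∀ a b c → a * (b * c) ≡ b * (a * c)
    swap = solve-∀

  popular : (B κ : ℕ) (g : Fin n → ℕ) → 0 < B → (∀ u → g u ≤ B) → n * B ≤ κ * ∑ g →
            n ≤ 2 * κ * size (λ u → does (B ≤? 2 * κ * g u))
  popular {n} B κ g 0<B g≤B nB≤κ∑g = *-cancelʳ-≤ n (2 * κ * size rich) B {{>-nonZero 0<B}}
    (+-cancelʳ-≤ (n * B) _ _ (begin
      n * B + n * B                              ≤⟨ +-mono-≤ nB≤κ∑g nB≤κ∑g ⟩
      κ * ∑ g + κ * ∑ g                          ≡⟨ double κ (∑ g) ⟩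
      2 * κ * ∑ g                                ≡⟨ *-∑ (2 * κ) g ⟩
      ∑ (λ u → 2 * κ * g u)                      ≤⟨ ∑-mono pointwise ⟩
      ∑ (λ u → ⟦ rich u ⟧ * (2 * κ * B) + B)     ≡⟨ ∑-+ (λ u → ⟦ rich u ⟧ * (2 * κ * B)) (λ _ → B) ⟩
      ∑ (λ u → ⟦ rich u ⟧ * (2 * κ * B)) + ∑ {n} (λ _ → B)
        ≡⟨ cong₂ _+_ (sym (∑-* (λ u → ⟦ rich u ⟧) _)) (∑-const n B) ⟩
      size rich * (2 * κ * B) + n * B            ≡⟨ cong (_+ n * B) (rotate (size rich) (2 * κ) B) ⟩
      2 * κ * size rich * B + n * B              ∎))
    where
    open ≤-Reasoning
    rich : Sub n
    rich u = does (B ≤? 2 * κ * g u)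
    double : ∀ a b → a * b + a * b ≡ 2 * a * b
    double = solve-∀
    rotate : ∀ a b c → a * (b * c) ≡ b * a * c
    rotate = solve-∀
    case : ∀ b u → (b ≡ false → 2 * κ * g u ≤ B) → 2 * κ * g u ≤ ⟦ b ⟧ * (2 * κ * B) + B
    case true  u _ = ≤-trans (*-monoʳ-≤ (2 * κ) (g≤B u))
                       (≤-trans (≤-reflexive (sym (*-identityˡ _))) (m≤m+n _ B))
    case false u h = h refl
    pointwise : ∀ u → 2 * κ * g u ≤ ⟦ rich u ⟧ * (2 * κ * B) + B
    pointwise u = case (rich u) u λ eq → <⇒≤ (≰⇒> (does-false⇒ (B ≤? 2 * κ * g u) eq))

  dominates-sum : {D F : Rel n} {a c S : ℕ} (κ : ℕ) → 0 < n → Dominates D F a c S → 2 * κ ≤ a →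
                  (𝒱 𝒲 : Fin n → Sub n) →
                  n * (n * n) ≤ κ * ∑ (λ u → edges D (𝒱 u) (𝒲 u)) →
                  n * S ≤ 2 * κ * (c * ∑ (λ u → edges F (𝒱 u) (𝒲 u)))
  dominates-sum {n} {D} {F} {a} {c} {S} κ 0<n dom 2κ≤a 𝒱 𝒲 h = begin
    n * S                                          ≤⟨ *-monoˡ-≤ S many ⟩
    2 * κ * size rich * S                          ≡⟨ *-assoc (2 * κ) (size rich) S ⟩
    2 * κ * (size rich * S)                        ≡⟨ cong (2 * κ *_) (∑-* (λ u → ⟦ rich u ⟧) S) ⟩
    2 * κ * ∑ (λ u → ⟦ rich u ⟧ * S)               ≤⟨ *-monoʳ-≤ (2 * κ) (∑-mono pointwise) ⟩
    2 * κ * ∑ (λ u → c * edges F (𝒱 u) (𝒲 u))      ≡⟨ cong (2 * κ *_) (sym (*-∑ c _)) ⟩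
    2 * κ * (c * ∑ (λ u → edges F (𝒱 u) (𝒲 u)))    ∎
    where
    open ≤-Reasoning
    g : Fin n → ℕ
    g u = edges D (𝒱 u) (𝒲 u)
    rich : Sub n
    rich u = does (n * n ≤? 2 * κ * g u)
    many : n ≤ 2 * κ * size rich
    many = popular (n * n) κ g (*-mono-≤ 0<n 0<n) (λ u → edges-≤ D (𝒱 u) (𝒲 u)) h
    pointwise : ∀ u → ⟦ rich u ⟧ * S ≤ c * edges F (𝒱 u) (𝒲 u)
    pointwise u = ⟦⟧*-≤ (rich u) λ eq → dominate dom (𝒱 u) (𝒲 u)
      (≤-trans (does⇒ (n * n ≤? 2 * κ * g u) eq) (*-monoˡ-≤ (g u) 2κ≤a))

  -- Dense covers of sparse graphs

  edges-cong : (B : Rel n) {X X′ Y Y′ : Sub n} → (∀ x → X x ≡ X′ x) → (∀ y → Y y ≡ Y′ y) →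
               edges B X Y ≡ edges B X′ Y′
  edges-cong B X≗X′ Y≗Y′ = ∑-cong λ x → cong₂ _*_ (cong ⟦_⟧ (X≗X′ x))
    (∑-cong λ y → cong (_* ⟦ B x y ⟧) (cong ⟦_⟧ (Y≗Y′ y)))

  searchPair : (P : Sub n → Sub n → Set) → (∀ X Y → Dec (P X Y)) →
               (∀ {X X′ Y Y′} → (∀ i → X i ≡ X′ i) → (∀ i → Y i ≡ Y′ i) → P X Y → P X′ Y′) →
               ∃₂ P ⊎ (∀ X Y → ¬ P X Y)
  searchPair P P? resp with anySubset? (λ v → anySubset? (λ w → P? (lookup v) (lookup w)))
  ... | yes (v , w , p) = inj₁ (lookup v , lookup w , p)
  ... | no ¬p = inj₂ λ X Y p → ¬p (tabulate X , tabulate Y ,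
          resp (λ i → sym (lookup∘tabulate X i)) (λ i → sym (lookup∘tabulate Y i)) p)

  count : Rel n → ℕ
  count B = ∑ λ x → ∑ λ y → ⟦ B x y ⟧

  _∖_ : Rel n → Rel n → Rel n
  (B ∖ D) x y = B x y ∧ not (D x y)

  _⊓ᵣ_ : Rel n → Rel n → Rel n
  (B ⊓ᵣ D) x y = B x y ∧ D x y

  _⊗_ : Sub n → Sub n → Rel n
  (X ⊗ Y) x y = X x ∧ Y y

  record ColumnTypes (m : ℕ) (D : Rel n) : Set where
    field
      type      : Fin n → Fin m
      column    : Fin m → Sub n
      column-eq : ∀ v x → D v x ≡ column (type x) v

  open ColumnTypes

  count-mono : {B D : Rel n} → (∀ x y → B x y ≡ true → D x y ≡ true) → count B ≤ count D
  count-mono B⇒D = ∑-mono₂ λ x y → ⟦⟧-mono (B⇒D x y)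

  count-≤ : (B : Rel n) → count B ≤ n * n
  count-≤ {n} B = ∑-bound n λ x → ≤-trans (∑-bound 1 (λ y → ⟦⟧≤1 (B x y))) (≤-reflexive (*-identityʳ n))

  count-+ : {B D E : Rel n} → (∀ x y → ⟦ B x y ⟧ ≤ ⟦ D x y ⟧ + ⟦ E x y ⟧) → count B ≤ count D + count E
  count-+ {D = D} {E} h = ≤-trans (∑-mono₂ h)
    (≤-reflexive (trans (∑-cong (λ x → ∑-+ (λ y → ⟦ D x y ⟧) (λ y → ⟦ E x y ⟧))) (∑-+ _ _)))

  edges≡count : (B : Rel n) (X Y : Sub n) → edges B X Y ≡ count (B ⊓ᵣ (X ⊗ Y))
  edges≡count B X Y = ∑-cong λ x → trans (*-∑ ⟦ X x ⟧ _) (∑-cong λ y → shuffle (X x) (Y y) (B x y))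
    where
    shuffle : ∀ a b c → ⟦ a ⟧ * (⟦ b ⟧ * ⟦ c ⟧) ≡ ⟦ c ∧ (a ∧ b) ⟧
    shuffle false b     true  = refl
    shuffle false b     false = refl
    shuffle true  false true  = refl
    shuffle true  false false = refl
    shuffle true  true  true  = refl
    shuffle true  true  false = refl

  ⟦⟧-part : ∀ b d → ⟦ b ⟧ ≡ ⟦ b ∧ not d ⟧ + ⟦ b ∧ d ⟧
  ⟦⟧-part true  true  = refl
  ⟦⟧-part true  false = refl
  ⟦⟧-part false d     = refl

  count-split : (B D : Rel n) → count B ≡ count (B ∖ D) + count (B ⊓ᵣ D)
  count-split B D = trans (∑-cong₂ λ x y → ⟦⟧-part (B x y) (D x y))
    (trans (∑-cong λ x → ∑-+ _ _) (∑-+ _ _))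

  bit : Bool → Fin 2
  bit true  = suc zero
  bit false = zero

  isOne : Fin 2 → Bool
  isOne zero    = false
  isOne (suc _) = true

  isOne-bit : ∀ b → isOne (bit b) ≡ b
  isOne-bit true  = refl
  isOne-bit false = refl

  combineColumns : {l : ℕ} {D E : Rel n} (_∙_ : Bool → Bool → Bool) → ColumnTypes m D → ColumnTypes l E →
                   ColumnTypes (m * l) (λ x y → D x y ∙ E x y)
  combineColumns {l = l} _∙_ d e .type x = combine (type d x) (type e x)
  combineColumns {m = m} {l} _∙_ d e .column p v =
    column d (proj₁ (remQuot {m} l p)) v ∙ column e (proj₂ (remQuot {m} l p)) v
  combineColumns {m = m} {l} _∙_ d e .column-eq v x = trans
    (cong₂ _∙_ (column-eq d v x) (column-eq e v x))
    (cong (λ pq → column d (proj₁ pq) v ∙ column e (proj₂ pq) v)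
          (sym (remQuot-combine {m} (type d x) (type e x))))

  ⊗-columns : (X Y : Sub n) → ColumnTypes 2 (X ⊗ Y)
  ⊗-columns X Y .type y = bit (Y y)
  ⊗-columns X Y .column b x = X x ∧ isOne b
  ⊗-columns X Y .column-eq x y = cong (X x ∧_) (sym (isOne-bit (Y y)))

  record Container (f : Rel n) (a c S m j k : ℕ) : Set where
    field
      Γ         : Rel n
      types     : ℕ
      columns   : ColumnTypes types Γ
      types≤    : types ≤ m * 2 ^ j
      dominates : Dominates Γ f a c S
      lost      : c * count (f ∖ Γ) ≤ k + j * S

  open Container

  shrink : (f : Rel n) (a c S : ℕ) → 0 < n → ∀ j (Γ₀ : Rel n) → a * count Γ₀ ≤ j * (n * n) →
           ColumnTypes m Γ₀ → Container f a c S m j (c * count (f ∖ Γ₀))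
  shrink {n} {m} f a c S 0<n j Γ₀ small cols
    with searchPair (λ X Y → n * n ≤ a * edges Γ₀ X Y × c * edges f X Y < S)
           (λ X Y → (n * n ≤? a * edges Γ₀ X Y) ×-dec (c * edges f X Y <? S))
           (λ X≗ Y≗ (p , q) → subst (λ z → n * n ≤ a * z) (edges-cong Γ₀ X≗ Y≗) p ,
                              subst (λ z → c * z < S) (edges-cong f X≗ Y≗) q)
  ... | inj₂ none = record
    { Γ = Γ₀ ; types = m ; columns = cols
    ; types≤ = m≤m*n m (2 ^ j) {{>-nonZero (m^n>0 2 j)}}
    ; dominates = dominating λ X Y big → ≮⇒≥ λ few → none X Y (big , few)
    ; lost = m≤m+n _ _ }
  shrink {n} f a c S 0<n zero Γ₀ small cols | inj₁ (X , Y , big , few) =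
    contradiction (≤-trans big (≤-trans (*-monoʳ-≤ a edges≤count) small)) (<⇒≱ (*-mono-≤ 0<n 0<n))
    where
    edges≤count : edges Γ₀ X Y ≤ count Γ₀
    edges≤count = ≤-trans (≤-reflexive (edges≡count Γ₀ X Y)) (count-mono λ x y eq → proj₁ (∧-true eq))
  shrink {n} {m} f a c S 0<n (suc j) Γ₀ small cols | inj₁ (X , Y , big , few) = record
    { Γ = Γ rest ; types = types rest ; columns = columns rest
    ; types≤ = subst (types rest ≤_) (*-assoc m 2 (2 ^ j)) (types≤ rest)
    ; dominates = dominates rest
    ; lost = begin
        c * count (f ∖ Γ rest)                                ≤⟨ lost rest ⟩
        c * count (f ∖ Γ₁) + j * S                            ≤⟨ +-monoˡ-≤ (j * S) (*-monoʳ-≤ c lost₁) ⟩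
        c * (count (f ∖ Γ₀) + edges f X Y) + j * S            ≡⟨ cong (_+ j * S) (*-distribˡ-+ c _ _) ⟩
        c * count (f ∖ Γ₀) + c * edges f X Y + j * S          ≤⟨ +-monoˡ-≤ (j * S) (+-monoʳ-≤ (c * count (f ∖ Γ₀)) (<⇒≤ few)) ⟩
        c * count (f ∖ Γ₀) + S + j * S                        ≡⟨ +-assoc (c * count (f ∖ Γ₀)) S (j * S) ⟩
        c * count (f ∖ Γ₀) + suc j * S                        ∎ }
    where
    open ≤-Reasoning
    Γ₁ : Rel n
    Γ₁ = Γ₀ ∖ (X ⊗ Y)
    small₁ : a * count Γ₁ ≤ j * (n * n)
    small₁ = +-cancelˡ-≤ (n * n) _ _ (begin
      n * n + a * count Γ₁                   ≤⟨ +-monoˡ-≤ (a * count Γ₁) big ⟩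
      a * edges Γ₀ X Y + a * count Γ₁        ≡⟨ cong (λ z → a * z + a * count Γ₁) (edges≡count Γ₀ X Y) ⟩
      a * count (Γ₀ ⊓ᵣ (X ⊗ Y)) + a * count Γ₁ ≡⟨ +-comm (a * count (Γ₀ ⊓ᵣ (X ⊗ Y))) _ ⟩
      a * count Γ₁ + a * count (Γ₀ ⊓ᵣ (X ⊗ Y)) ≡⟨ *-distribˡ-+ a _ _ ⟨
      a * (count Γ₁ + count (Γ₀ ⊓ᵣ (X ⊗ Y)))   ≡⟨ cong (a *_) (count-split Γ₀ (X ⊗ Y)) ⟨
      a * count Γ₀                           ≤⟨ small ⟩
      suc j * (n * n)                        ∎)
    lost₁ : count (f ∖ Γ₁) ≤ count (f ∖ Γ₀) + edges f X Y
    lost₁ = ≤-trans (count-+ λ x y → cases (f x y) (Γ₀ x y) (X x ∧ Y y))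
                    (≤-reflexive (cong (count (f ∖ Γ₀) +_) (sym (edges≡count f X Y))))
      where
      cases : ∀ a b r → ⟦ a ∧ not (b ∧ not r) ⟧ ≤ ⟦ a ∧ not b ⟧ + ⟦ a ∧ r ⟧
      cases false b     r     = z≤n
      cases true  false r     = s≤s z≤n
      cases true  true  true  = s≤s z≤n
      cases true  true  false = z≤n
    rest : Container f a c S (m * 2) j (c * count (f ∖ Γ₁))
    rest = shrink f a c S 0<n j Γ₁ small₁ (combineColumns (λ b r → b ∧ not r) cols (⊗-columns X Y))

  opaque
    container : (f : Rel n) (a c S : ℕ) → 0 < n → Container f a c S 1 a 0
    container {n} f a c S 0<n = record
      { Γ = Γ C ; types = types C ; columns = columns C ; types≤ = types≤ C ; dominates = dominates C
      ; lost = subst (λ z → c * count (f ∖ Γ C) ≤ z + a * S) none (lost C) }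
      where
      full : ColumnTypes {n} 1 (λ _ _ → true)
      full = record { type = λ _ → zero ; column = λ _ _ → true ; column-eq = λ _ _ → refl }
      C : Container f a c S 1 a (c * count (f ∖ λ _ _ → true))
      C = shrink f a c S 0<n a (λ _ _ → true) (*-monoʳ-≤ a (count-≤ _)) full
      none : c * count (f ∖ λ _ _ → true) ≡ 0
      none = n≤0⇒n≡0 (≤-trans (*-monoʳ-≤ c (∑-bound 0 λ x → ≤-trans (∑-bound 0 λ y → gone (f x y)) (≤-reflexive (*-zeroʳ n))))
               (≤-reflexive (trans (cong (c *_) (*-zeroʳ n)) (*-zeroʳ c))))
        where
        gone : ∀ b → ⟦ b ∧ false ⟧ ≤ 0
        gone true  = z≤n
        gone false = z≤n

  -- Paths of length two

  walks : Rel n → Rel n → Fin n → Fin n → ℕ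
  walks B C v w = ∑ λ x → ⟦ B v x ⟧ * ⟦ C x w ⟧

  paths : Rel n → Rel n → Sub n → Sub n → ℕ
  paths B C V W = ∑ λ x → deg (flip B) V x * deg C W x

  ∑*∑ : (f : Fin n → ℕ) (g : Fin m → ℕ) → ∑ f * ∑ g ≡ ∑ (λ i → ∑ (λ j → f i * g j))
  ∑*∑ f g = trans (∑-* f (∑ g)) (∑-cong λ i → *-∑ (f i) g)

  paths≡walks : (B C : Rel n) (V W : Sub n) →
                paths B C V W ≡ ∑ λ v → ∑ λ w → ⟦ V v ⟧ * (⟦ W w ⟧ * walks B C v w)
  paths≡walks B C V W = begin
    ∑ (λ x → deg (flip B) V x * deg C W x)
      ≡⟨ ∑-cong (λ x → ∑*∑ _ _) ⟩
    ∑ (λ x → ∑ λ v → ∑ λ w → (⟦ V v ⟧ * ⟦ B v x ⟧) * (⟦ W w ⟧ * ⟦ C x w ⟧))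
      ≡⟨ ∑-comm _ ⟩
    ∑ (λ v → ∑ λ x → ∑ λ w → (⟦ V v ⟧ * ⟦ B v x ⟧) * (⟦ W w ⟧ * ⟦ C x w ⟧))
      ≡⟨ ∑-cong (λ v → ∑-comm _) ⟩
    ∑ (λ v → ∑ λ w → ∑ λ x → (⟦ V v ⟧ * ⟦ B v x ⟧) * (⟦ W w ⟧ * ⟦ C x w ⟧))
      ≡⟨ ∑-cong₂ (λ v w → ∑-cong λ x → shuffle ⟦ V v ⟧ ⟦ B v x ⟧ ⟦ W w ⟧ ⟦ C x w ⟧) ⟩
    ∑ (λ v → ∑ λ w → ∑ λ x → ⟦ V v ⟧ * (⟦ W w ⟧ * (⟦ B v x ⟧ * ⟦ C x w ⟧)))
      ≡⟨ ∑-cong₂ (λ v w → trans (cong (⟦ V v ⟧ *_) (*-∑ ⟦ W w ⟧ _)) (*-∑ ⟦ V v ⟧ _)) ⟨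
    ∑ (λ v → ∑ λ w → ⟦ V v ⟧ * (⟦ W w ⟧ * walks B C v w)) ∎
    where
    open ≡-Reasoning
    shuffle : ∀ a b c d → (a * b) * (c * d) ≡ a * (c * (b * d))
    shuffle = solve-∀

  edges≡∑∑ : (B : Rel n) (X Y : Sub n) →
             edges B X Y ≡ ∑ λ x → ∑ λ y → ⟦ X x ⟧ * (⟦ Y y ⟧ * ⟦ B x y ⟧)
  edges≡∑∑ B X Y = ∑-cong λ x → *-∑ ⟦ X x ⟧ _

  size-split : (X P : Sub n) → size X ≡ size (λ x → X x ∧ not (P x)) + size (λ x → X x ∧ P x)
  size-split X P = trans (∑-cong λ x → ⟦⟧-part (X x) (P x)) (∑-+ _ _)

  rich-edges : {a : ℕ} (κ : ℕ) (B : Rel n) (X Y : Sub n) → 8 * (κ * κ) ≤ a →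
               (∀ x → X x ≡ true → n ≤ 2 * κ * deg B Y x) → n ≤ 4 * κ * size X →
               n * n ≤ a * edges B X Y
  rich-edges {n} {a} κ B X Y κ≤a rich large = begin
    n * n                                          ≤⟨ *-monoˡ-≤ n large ⟩
    4 * κ * size X * n                             ≡⟨ *-assoc (4 * κ) (size X) n ⟩
    4 * κ * (size X * n)                           ≡⟨ cong (4 * κ *_) (∑-* _ n) ⟩
    4 * κ * ∑ (λ x → ⟦ X x ⟧ * n)                  ≤⟨ *-monoʳ-≤ (4 * κ) (∑-mono λ x → ⟦⟧*-mono (X x) (rich x)) ⟩
    4 * κ * ∑ (λ x → ⟦ X x ⟧ * (2 * κ * deg B Y x)) ≡⟨ cong (4 * κ *_) (∑-cong λ x → pull ⟦ X x ⟧ (2 * κ) _) ⟩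
    4 * κ * ∑ (λ x → 2 * κ * (⟦ X x ⟧ * deg B Y x)) ≡⟨ cong (4 * κ *_) (sym (*-∑ (2 * κ) _)) ⟩
    4 * κ * (2 * κ * edges B X Y)                  ≡⟨ eight κ (edges B X Y) ⟩
    8 * (κ * κ) * edges B X Y                      ≤⟨ *-monoˡ-≤ (edges B X Y) κ≤a ⟩
    a * edges B X Y                                ∎
    where
    open ≤-Reasoning
    pull : ∀ a b c → a * (b * c) ≡ b * (a * c)
    pull = solve-∀
    eight : ∀ κ e → 4 * κ * (2 * κ * e) ≡ 8 * (κ * κ) * e
    eight = solve-∀

  paths-dominated : {Γ₁ Γ₂ f₁ f₂ : Rel n} {a c s : ℕ} (κ : ℕ) → 0 < n → 0 < s →
    Dominates Γ₁ f₁ a c (n * s) → Dominates Γ₂ f₂ a c (n * s) → 8 * (κ * κ) ≤ a →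
    (V W : Sub n) → n * (n * n) ≤ κ * paths Γ₁ Γ₂ V W →
    n * (s * s) ≤ 2 * (c * c) * paths f₁ f₂ V W
  paths-dominated {n} {Γ₁} {Γ₂} {f₁} {f₂} {a} {c} {s} κ 0<n 0<s dom₁ dom₂ κ≤a V W h = begin
    n * (s * s)                                      ≡⟨ *-assoc n s s ⟨
    n * s * s                                        ≤⟨ *-monoˡ-≤ s (dominate dom₂ X₂ W X₂-big) ⟩
    c * edges f₂ X₂ W * s                            ≡⟨ *-assoc c _ s ⟩
    c * (edges f₂ X₂ W * s)                          ≡⟨ cong (c *_) (∑-* _ s) ⟩
    c * ∑ (λ x → ⟦ X₂ x ⟧ * deg f₂ W x * s)          ≤⟨ *-monoʳ-≤ c (∑-mono lift) ⟩
    c * ∑ (λ x → 2 * c * (deg (flip f₁) V x * deg f₂ W x)) ≡⟨ cong (c *_) (sym (*-∑ (2 * c) _)) ⟩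
    c * (2 * c * paths f₁ f₂ V W)                    ≡⟨ regroup c (paths f₁ f₂ V W) ⟩
    2 * (c * c) * paths f₁ f₂ V W                    ∎
    where
    open ≤-Reasoning
    regroup : ∀ c p → c * (2 * c * p) ≡ 2 * (c * c) * p
    regroup = solve-∀
    d₁ d₂ g : Fin n → ℕ
    d₁ = deg (flip Γ₁) V
    d₂ = deg Γ₂ W
    g x = d₁ x * d₂ x
    X₀ low X₁ X₂ : Sub n
    X₀ x = does (n * n ≤? 2 * κ * g x)
    low x = does (2 * c * deg (flip f₁) V x <? s)
    X₁ x = X₀ x ∧ low x
    X₂ x = X₀ x ∧ not (low x)
    X₀-big : n ≤ 2 * κ * size X₀
    X₀-big = popular (n * n) κ g (*-mono-≤ 0<n 0<n) (λ x → *-mono-≤ (deg-≤ (flip Γ₁) V x) (deg-≤ Γ₂ W x)) h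
    reorder : ∀ κ a b → 2 * κ * (a * b) ≡ 2 * κ * b * a
    reorder = solve-∀
    rich₁ : ∀ x → X₀ x ≡ true → n ≤ 2 * κ * d₁ x
    rich₁ x eq = *-cancelʳ-≤ n _ n {{>-nonZero 0<n}} (begin
      n * n                 ≤⟨ does⇒ (n * n ≤? 2 * κ * g x) eq ⟩
      2 * κ * (d₁ x * d₂ x) ≡⟨ *-assoc (2 * κ) (d₁ x) (d₂ x) ⟨
      2 * κ * d₁ x * d₂ x   ≤⟨ *-monoʳ-≤ (2 * κ * d₁ x) (deg-≤ Γ₂ W x) ⟩
      2 * κ * d₁ x * n      ∎)
    rich₂ : ∀ x → X₀ x ≡ true → n ≤ 2 * κ * d₂ x
    rich₂ x eq = *-cancelʳ-≤ n _ n {{>-nonZero 0<n}} (begin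
      n * n                 ≤⟨ does⇒ (n * n ≤? 2 * κ * g x) eq ⟩
      2 * κ * (d₁ x * d₂ x) ≡⟨ reorder κ (d₁ x) (d₂ x) ⟩
      2 * κ * d₂ x * d₁ x   ≤⟨ *-monoʳ-≤ (2 * κ * d₂ x) (deg-≤ (flip Γ₁) V x) ⟩
      2 * κ * d₂ x * n      ∎)
    X₁-small : ¬ (n ≤ 4 * κ * size X₁)
    X₁-small large = <⇒≱ (*-mono-≤ 0<n 0<s) (+-cancelˡ-≤ (n * s) _ _ (begin
      n * s + n * s                                ≡⟨ cong (n * s +_) (+-identityʳ (n * s)) ⟨
      2 * (n * s)                                  ≤⟨ *-monoʳ-≤ 2 (dominate dom₁ V X₁ (subst (λ e → n * n ≤ a * e)
                                                        (sym (edges-flip Γ₁ V X₁))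
                                                        (rich-edges κ (flip Γ₁) X₁ V κ≤a (λ x eq → rich₁ x (proj₁ (∧-true eq))) large))) ⟩
      2 * (c * edges f₁ V X₁)                      ≡⟨ cong (λ e → 2 * (c * e)) (edges-flip f₁ V X₁) ⟩
      2 * (c * edges (flip f₁) X₁ V)               ≡⟨ *-assoc 2 c _ ⟨
      2 * c * edges (flip f₁) X₁ V                 ≡⟨ *-∑ (2 * c) _ ⟩
      ∑ (λ x → 2 * c * (⟦ X₁ x ⟧ * deg (flip f₁) V x)) ≤⟨ ∑-bound s few ⟩
      n * s                                        ≡⟨ +-identityʳ (n * s) ⟨
      n * s + 0                                    ∎))
      where
      pull : ∀ a b c → a * (b * c) ≡ b * (a * c)
      pull = solve-∀
      few : ∀ x → 2 * c * (⟦ X₁ x ⟧ * deg (flip f₁) V x) ≤ s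
      few x = ≤-trans (≤-reflexive (pull (2 * c) ⟦ X₁ x ⟧ _)) (⟦⟧*-≤ (X₁ x) λ eq →
        <⇒≤ (does⇒ (2 * c * deg (flip f₁) V x <? s) (proj₂ (∧-true eq))))
    X₂-large : n ≤ 4 * κ * size X₂
    X₂-large with n ≤? 4 * κ * size X₂ | n ≤? 4 * κ * size X₁
    ... | yes large | _         = large
    ... | no  _     | yes large = contradiction large X₁-small
    ... | no  few₂  | no  few₁  = contradiction (begin-strict
      n + n                                 ≤⟨ +-mono-≤ X₀-big X₀-big ⟩
      2 * κ * size X₀ + 2 * κ * size X₀     ≡⟨ double κ (size X₀) ⟩
      4 * κ * size X₀                       ≡⟨ cong (4 * κ *_) (size-split X₀ low) ⟩
      4 * κ * (size X₂ + size X₁)           ≡⟨ *-distribˡ-+ (4 * κ) (size X₂) (size X₁) ⟩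
      4 * κ * size X₂ + 4 * κ * size X₁     <⟨ +-mono-< (≰⇒> few₂) (≰⇒> few₁) ⟩
      n + n                                 ∎) (n≮n _)
      where
      double : ∀ κ x → 2 * κ * x + 2 * κ * x ≡ 4 * κ * x
      double = solve-∀
    X₂-big : n * n ≤ a * edges Γ₂ X₂ W
    X₂-big = rich-edges κ Γ₂ X₂ W κ≤a (λ x eq → rich₂ x (proj₁ (∧-true eq))) X₂-large
    not-low : ∀ x → X₂ x ≡ true → s ≤ 2 * c * deg (flip f₁) V x
    not-low x eq = ≮⇒≥ (does-false⇒ (2 * c * deg (flip f₁) V x <? s) (not-true (proj₂ (∧-true {X₀ x} eq))))
    lift : ∀ x → ⟦ X₂ x ⟧ * deg f₂ W x * s ≤ 2 * c * (deg (flip f₁) V x * deg f₂ W x)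
    lift x = ≤-trans (≤-reflexive (*-assoc ⟦ X₂ x ⟧ _ s)) (⟦⟧*-≤ (X₂ x) λ eq → begin
      deg f₂ W x * s                              ≤⟨ *-monoʳ-≤ (deg f₂ W x) (not-low x eq) ⟩
      deg f₂ W x * (2 * c * deg (flip f₁) V x)    ≡⟨ swap (deg f₂ W x) (2 * c) (deg (flip f₁) V x) ⟩
      2 * c * (deg (flip f₁) V x * deg f₂ W x)    ∎)
      where
      swap : ∀ a b d → a * (b * d) ≡ b * (d * a)
      swap = solve-∀

  -- Four-cycles

  isFourCycle : Rel n → Fin n → Fin n → Fin n → Fin n → Bool
  isFourCycle B x x′ v v′ =
    (not (x == x′) ∧ not (v == v′)) ∧ ((B v x ∧ B v x′) ∧ (B v′ x ∧ B v′ x′))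

  fourCycles : Rel n → ℕ
  fourCycles B = ∑ λ x → ∑ λ x′ → ∑ λ v → ∑ λ v′ → ⟦ isFourCycle B x x′ v v′ ⟧

  codeg : Rel n → Fin n → Fin n → ℕ
  codeg B x x′ = ∑ λ v → ⟦ B v x ∧ B v x′ ⟧

  fourCyclesOn : Rel n → Fin n → Fin n → ℕ
  fourCyclesOn B x x′ = ∑ λ v → ∑ λ v′ → ⟦ isFourCycle B x x′ v v′ ⟧

  ∑∑-+ : (f g : Fin n → Fin m → ℕ) →
         ∑ (λ i → ∑ (λ j → f i j + g i j)) ≡ ∑ (λ i → ∑ (f i)) + ∑ (λ i → ∑ (g i))
  ∑∑-+ f g = trans (∑-cong λ i → ∑-+ (f i) (g i)) (∑-+ _ _)

  codeg-square : (B : Rel n) (x x′ : Fin n) → (x == x′) ≡ false →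
                 codeg B x x′ * codeg B x x′ ≤ codeg B x x′ + fourCyclesOn B x x′
  codeg-square B x x′ x≢x′ = begin
    codeg B x x′ * codeg B x x′                          ≡⟨ ∑*∑ _ _ ⟩
    ∑ (λ v → ∑ λ v′ → b v * b v′)                        ≤⟨ ∑-mono₂ (λ v v′ → cases (v == v′) (x == x′) (B v x ∧ B v x′) (B v′ x ∧ B v′ x′) x≢x′) ⟩
    ∑ (λ v → ∑ λ v′ → ⟦ v == v′ ⟧ * b v′ + ⟦ isFourCycle B x x′ v v′ ⟧) ≡⟨ ∑∑-+ _ _ ⟩
    ∑ (λ v → ∑ λ v′ → ⟦ v == v′ ⟧ * b v′) + fourCyclesOn B x x′ ≡⟨ cong (_+ fourCyclesOn B x x′) (∑-cong λ v → ∑-point v b) ⟩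
    codeg B x x′ + fourCyclesOn B x x′                   ∎
    where
    open ≤-Reasoning
    b : _ → ℕ
    b v = ⟦ B v x ∧ B v x′ ⟧
    cases : ∀ e d p q → d ≡ false → ⟦ p ⟧ * ⟦ q ⟧ ≤ ⟦ e ⟧ * ⟦ q ⟧ + ⟦ (not d ∧ not e) ∧ (p ∧ q) ⟧
    cases e     d false q     _ = z≤n
    cases e     d true  false _ = z≤n
    cases true  d true  true  _ = s≤s z≤n
    cases false false true true _ = s≤s z≤n

  square≤⇒≤ : ∀ c q → c * c ≤ c + q → c ≤ 1 + q
  square≤⇒≤ zero                q h = z≤n
  square≤⇒≤ (suc zero)          q h = s≤s z≤n
  square≤⇒≤ c@(suc (suc c′))    q h = m≤n⇒m≤1+n (+-cancelˡ-≤ c c q (begin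
    c + c        ≡⟨ cong (c +_) (+-identityʳ c) ⟨
    2 * c        ≤⟨ *-monoˡ-≤ c {2} {c} (s≤s (s≤s z≤n)) ⟩
    c * c        ≤⟨ h ⟩
    c + q        ∎))
    where open ≤-Reasoning

  codeg-≤ : (B : Rel n) (x x′ : Fin n) → (x == x′) ≡ false → codeg B x x′ ≤ 1 + fourCyclesOn B x x′
  codeg-≤ B x x′ x≢x′ = square≤⇒≤ _ _ (codeg-square B x x′ x≢x′)

  fullDeg : Rel n → Fin n → ℕ
  fullDeg B x = ∑ λ v → ⟦ B v x ⟧

  codeg-diagonal : (B : Rel n) (x : Fin n) → codeg B x x ≡ fullDeg B x
  codeg-diagonal B x = ∑-cong λ v → idem (B v x)
    where
    idem : ∀ b → ⟦ b ∧ b ⟧ ≡ ⟦ b ⟧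
    idem true  = refl
    idem false = refl

  ∑fullDeg : (B : Rel n) → ∑ (fullDeg B) ≡ count B
  ∑fullDeg B = ∑-comm _

  ∑-diagonal : (F : Fin n → Fin n → ℕ) → ∑ (λ x → ∑ λ x′ → ⟦ x == x′ ⟧ * F x x′) ≡ ∑ λ x → F x x
  ∑-diagonal F = ∑-cong λ x → ∑-point x (F x)

  ∑deg² : (B : Rel n) (P : Sub n) →
          ∑ (λ v → deg B P v * deg B P v) ≤ count B + size P * size P + fourCycles B
  ∑deg² B P = begin
    ∑ (λ v → deg B P v * deg B P v)
      ≡⟨ ∑-cong (λ v → ∑*∑ _ _) ⟩
    ∑ (λ v → ∑ λ x → ∑ λ x′ → (⟦ P x ⟧ * ⟦ B v x ⟧) * (⟦ P x′ ⟧ * ⟦ B v x′ ⟧))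
      ≡⟨ trans (∑-comm _) (∑-cong λ x → ∑-comm _) ⟩
    ∑ (λ x → ∑ λ x′ → ∑ λ v → (⟦ P x ⟧ * ⟦ B v x ⟧) * (⟦ P x′ ⟧ * ⟦ B v x′ ⟧))
      ≡⟨ ∑-cong₂ (λ x x′ → trans (∑-cong λ v → shuffle (P x) (B v x) (P x′) (B v x′)) (sym (*-∑ (⟦ P x ⟧ * ⟦ P x′ ⟧) _))) ⟩
    ∑ (λ x → ∑ λ x′ → ⟦ P x ⟧ * ⟦ P x′ ⟧ * codeg B x x′)
      ≤⟨ ∑-mono₂ (λ x x′ → pointwise x x′ (x == x′) refl) ⟩
    ∑ (λ x → ∑ λ x′ → (⟦ x == x′ ⟧ * codeg B x x′ + ⟦ P x ⟧ * ⟦ P x′ ⟧) + fourCyclesOn B x x′)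
      ≡⟨ trans (∑∑-+ _ _) (cong (_+ fourCycles B) (∑∑-+ _ _)) ⟩
    ∑ (λ x → ∑ λ x′ → ⟦ x == x′ ⟧ * codeg B x x′) + ∑ (λ x → ∑ λ x′ → ⟦ P x ⟧ * ⟦ P x′ ⟧) + fourCycles B
      ≡⟨ cong (_+ fourCycles B) (cong₂ _+_ (trans (∑-diagonal (codeg B)) (trans (∑-cong (codeg-diagonal B)) (∑fullDeg B)))
                                           (sym (∑*∑ _ _))) ⟩
    count B + size P * size P + fourCycles B ∎
    where
    open ≤-Reasoning
    shuffle : ∀ p b p′ b′ → (⟦ p ⟧ * ⟦ b ⟧) * (⟦ p′ ⟧ * ⟦ b′ ⟧) ≡ ⟦ p ⟧ * ⟦ p′ ⟧ * ⟦ b ∧ b′ ⟧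
    shuffle p b p′ b′ = trans (ring ⟦ p ⟧ ⟦ b ⟧ ⟦ p′ ⟧ ⟦ b′ ⟧) (cong (⟦ p ⟧ * ⟦ p′ ⟧ *_) (sym (⟦∧⟧ b b′)))
      where
      ring : ∀ a b c d → (a * b) * (c * d) ≡ a * c * (b * d)
      ring = solve-∀
    pointwise : ∀ x x′ e → (x == x′) ≡ e → ⟦ P x ⟧ * ⟦ P x′ ⟧ * codeg B x x′ ≤
                (⟦ e ⟧ * codeg B x x′ + ⟦ P x ⟧ * ⟦ P x′ ⟧) + fourCyclesOn B x x′
    pointwise x x′ true  eq = ≤-trans (*-monoˡ-≤ (codeg B x x′) (*-mono-≤ (⟦⟧≤1 (P x)) (⟦⟧≤1 (P x′))))
      (≤-trans (m≤m+n _ _) (m≤m+n _ _))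
    pointwise x x′ false eq = begin
      ⟦ P x ⟧ * ⟦ P x′ ⟧ * codeg B x x′                  ≤⟨ *-monoʳ-≤ (⟦ P x ⟧ * ⟦ P x′ ⟧) (codeg-≤ B x x′ eq) ⟩
      ⟦ P x ⟧ * ⟦ P x′ ⟧ * (1 + fourCyclesOn B x x′)     ≡⟨ trans (*-distribˡ-+ (⟦ P x ⟧ * ⟦ P x′ ⟧) 1 (fourCyclesOn B x x′)) (cong (_+ ⟦ P x ⟧ * ⟦ P x′ ⟧ * fourCyclesOn B x x′) (*-identityʳ (⟦ P x ⟧ * ⟦ P x′ ⟧))) ⟩
      ⟦ P x ⟧ * ⟦ P x′ ⟧ + ⟦ P x ⟧ * ⟦ P x′ ⟧ * fourCyclesOn B x x′
        ≤⟨ +-monoʳ-≤ (⟦ P x ⟧ * ⟦ P x′ ⟧) (≤-trans (*-monoˡ-≤ (fourCyclesOn B x x′) (*-mono-≤ (⟦⟧≤1 (P x)) (⟦⟧≤1 (P x′))))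
                                                   (≤-reflexive (*-identityˡ _))) ⟩
      ⟦ P x ⟧ * ⟦ P x′ ⟧ + fourCyclesOn B x x′           ∎

  record FewFourCycles (B : Rel n) (q : ℕ) : Set where
    field
      rows : fourCycles B ≤ q
      cols : fourCycles (flip B) ≤ q

  open FewFourCycles

  deg-all : (B : Rel n) (x : Fin n) → deg B (const true) x ≡ ∑ λ y → ⟦ B x y ⟧
  deg-all B x = ∑-cong λ y → *-identityˡ _

  size-all : ∀ n → size {n} (const true) ≡ n
  size-all n = trans (∑-const n 1) (*-identityʳ n)

  ∑fullDeg² : (B : Rel n) → ∑ (λ x → fullDeg B x * fullDeg B x) ≤ count B + n * n + fourCycles (flip B)
  ∑fullDeg² {n} B = begin
    ∑ (λ x → fullDeg B x * fullDeg B x)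
      ≡⟨ ∑-cong (λ x → cong₂ _*_ (sym (deg-all (flip B) x)) (sym (deg-all (flip B) x))) ⟩
    ∑ (λ x → deg (flip B) (const true) x * deg (flip B) (const true) x)
      ≤⟨ ∑deg² (flip B) (const true) ⟩
    count (flip B) + size {n} (const true) * size {n} (const true) + fourCycles (flip B)
      ≡⟨ cong (_+ fourCycles (flip B)) (cong₂ _+_ (∑-comm _) (cong₂ _*_ (size-all n) (size-all n))) ⟩
    count B + n * n + fourCycles (flip B) ∎
    where open ≤-Reasoning

  ∑codeg² : (B : Rel n) → FewFourCycles B (n * n) →
            ∑ (λ x → ∑ λ x′ → codeg B x x′ * codeg B x x′) ≤ 6 * (n * n)
  ∑codeg² {n} B few = begin
    ∑ (λ x → ∑ λ x′ → codeg B x x′ * codeg B x x′)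
      ≤⟨ ∑-mono₂ (λ x x′ → pointwise x x′ (x == x′) refl) ⟩
    ∑ (λ x → ∑ λ x′ → (⟦ x == x′ ⟧ * (codeg B x x′ * codeg B x x′) + 1) + 2 * fourCyclesOn B x x′)
      ≡⟨ trans (∑∑-+ _ _) (cong (_+ ∑ (λ x → ∑ λ x′ → 2 * fourCyclesOn B x x′)) (∑∑-+ _ _)) ⟩
    ∑ (λ x → ∑ λ x′ → ⟦ x == x′ ⟧ * (codeg B x x′ * codeg B x x′)) + ∑ {n} (λ x → ∑ {n} λ x′ → 1)
      + ∑ (λ x → ∑ λ x′ → 2 * fourCyclesOn B x x′)
      ≡⟨ cong₂ _+_ (cong₂ _+_ (trans (∑-diagonal _) (∑-cong λ x → cong₂ _*_ (codeg-diagonal B x) (codeg-diagonal B x)))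
                              (trans (∑-const n _) (cong (n *_) (size-all n))))
                   (trans (∑-cong λ x → sym (*-∑ 2 _)) (sym (*-∑ 2 _))) ⟩
    ∑ (λ x → fullDeg B x * fullDeg B x) + n * n + 2 * fourCycles B
      ≤⟨ +-mono-≤ (+-monoˡ-≤ (n * n) (≤-trans (∑fullDeg² B) (+-mono-≤ (+-monoˡ-≤ (n * n) (count-≤ B)) (cols few))))
                  (*-monoʳ-≤ 2 (rows few)) ⟩
    (n * n + n * n + n * n) + n * n + 2 * (n * n)
      ≡⟨ six (n * n) ⟩
    6 * (n * n) ∎
    where
    open ≤-Reasoning
    six : ∀ z → (z + z + z) + z + 2 * z ≡ 6 * z
    six = solve-∀
    twice : ∀ q → (1 + q) + q ≡ 1 + 2 * q
    twice = solve-∀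
    pointwise : ∀ x x′ e → (x == x′) ≡ e → codeg B x x′ * codeg B x x′ ≤
                (⟦ e ⟧ * (codeg B x x′ * codeg B x x′) + 1) + 2 * fourCyclesOn B x x′
    pointwise x x′ true  eq = ≤-trans (≤-reflexive (sym (*-identityˡ _))) (≤-trans (m≤m+n _ 1) (m≤m+n _ _))
    pointwise x x′ false eq = begin
      codeg B x x′ * codeg B x x′                            ≤⟨ codeg-square B x x′ eq ⟩
      codeg B x x′ + fourCyclesOn B x x′                     ≤⟨ +-monoˡ-≤ _ (codeg-≤ B x x′ eq) ⟩
      (1 + fourCyclesOn B x x′) + fourCyclesOn B x x′        ≡⟨ twice (fourCyclesOn B x x′) ⟩
      1 + 2 * fourCyclesOn B x x′                            ∎

  2ab≤a²+b² : ∀ a b → 2 * (a * b) ≤ a * a + b * b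
  2ab≤a²+b² a b with ≤-total a b
  ... | inj₁ a≤b = subst (λ b → 2 * (a * b) ≤ a * a + b * b) (m+[n∸m]≡n a≤b) (ordered a (b ∸ a))
    where
    ordered : ∀ a d → 2 * (a * (a + d)) ≤ a * a + (a + d) * (a + d)
    ordered a d = ≤-trans (m≤m+n _ (d * d)) (≤-reflexive (ring a d))
      where
      ring : ∀ a d → 2 * (a * (a + d)) + d * d ≡ a * a + (a + d) * (a + d)
      ring = solve-∀
  ... | inj₂ b≤a = subst (λ a → 2 * (a * b) ≤ a * a + b * b) (m+[n∸m]≡n b≤a) (ordered b (a ∸ b))
    where
    ordered : ∀ b d → 2 * ((b + d) * b) ≤ (b + d) * (b + d) + b * b
    ordered b d = ≤-trans (m≤m+n _ (d * d)) (≤-reflexive (ring b d))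
      where
      ring : ∀ b d → 2 * ((b + d) * b) + d * d ≡ (b + d) * (b + d) + b * b
      ring = solve-∀

  ∑walks² : (B C : Rel n) → FewFourCycles B (n * n) → FewFourCycles (flip C) (n * n) →
            ∑ (λ v → ∑ λ w → walks B C v w * walks B C v w) ≤ 6 * (n * n)
  ∑walks² {n} B C fewB fewC = *-cancelˡ-≤ 2 (begin
    2 * ∑ (λ v → ∑ λ w → walks B C v w * walks B C v w)
      ≡⟨ cong (2 *_) (∑-cong₂ λ v w → ∑*∑ _ _) ⟩
    2 * ∑ (λ v → ∑ λ w → ∑ λ x → ∑ λ x′ → (⟦ B v x ⟧ * ⟦ C x w ⟧) * (⟦ B v x′ ⟧ * ⟦ C x′ w ⟧))
      ≡⟨ cong (2 *_) (∑-cong λ v → trans (∑-comm _) (∑-cong λ x → ∑-comm _)) ⟩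
    2 * ∑ (λ v → ∑ λ x → ∑ λ x′ → ∑ λ w → (⟦ B v x ⟧ * ⟦ C x w ⟧) * (⟦ B v x′ ⟧ * ⟦ C x′ w ⟧))
      ≡⟨ cong (2 *_) (trans (∑-comm _) (∑-cong λ x → ∑-comm _)) ⟩
    2 * ∑ (λ x → ∑ λ x′ → ∑ λ v → ∑ λ w → (⟦ B v x ⟧ * ⟦ C x w ⟧) * (⟦ B v x′ ⟧ * ⟦ C x′ w ⟧))
      ≡⟨ cong (2 *_) (∑-cong₂ λ x x′ → trans (∑-cong₂ λ v w → shuffle (B v x) (C x w) (B v x′) (C x′ w)) (sym (∑*∑ _ _))) ⟩
    2 * ∑ (λ x → ∑ λ x′ → codeg B x x′ * codeg (flip C) x x′)
      ≡⟨ trans (*-∑ 2 _) (∑-cong λ x → *-∑ 2 _) ⟩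
    ∑ (λ x → ∑ λ x′ → 2 * (codeg B x x′ * codeg (flip C) x x′))
      ≤⟨ ∑-mono₂ (λ x x′ → 2ab≤a²+b² (codeg B x x′) (codeg (flip C) x x′)) ⟩
    ∑ (λ x → ∑ λ x′ → codeg B x x′ * codeg B x x′ + codeg (flip C) x x′ * codeg (flip C) x x′)
      ≡⟨ ∑∑-+ _ _ ⟩
    ∑ (λ x → ∑ λ x′ → codeg B x x′ * codeg B x x′) + ∑ (λ x → ∑ λ x′ → codeg (flip C) x x′ * codeg (flip C) x x′)
      ≤⟨ +-mono-≤ (∑codeg² B fewB) (∑codeg² (flip C) fewC) ⟩
    6 * (n * n) + 6 * (n * n)
      ≡⟨ cong (6 * (n * n) +_) (+-identityʳ _) ⟨
    2 * (6 * (n * n)) ∎)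
    where
    open ≤-Reasoning
    ring : ∀ a b c d → (a * b) * (c * d) ≡ (a * c) * (b * d)
    ring = solve-∀
    shuffle : ∀ b c b′ c′ → (⟦ b ⟧ * ⟦ c ⟧) * (⟦ b′ ⟧ * ⟦ c′ ⟧) ≡ ⟦ b ∧ b′ ⟧ * ⟦ c ∧ c′ ⟧
    shuffle b c b′ c′ = trans (ring ⟦ b ⟧ ⟦ c ⟧ ⟦ b′ ⟧ ⟦ c′ ⟧) (sym (cong₂ _*_ (⟦∧⟧ b b′) (⟦∧⟧ c c′)))

  -- Transfer of pentagons

  walks-≤ : (B C : Rel n) (v w : Fin n) → walks B C v w ≤ n
  walks-≤ {n} B C v w = ≤-trans (∑-bound 1 (λ x → *-mono-≤ (⟦⟧≤1 (B v x)) (⟦⟧≤1 (C x w)))) (≤-reflexive (*-identityʳ n))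

  reach : ℕ → ℕ → Rel n → Rel n → Rel n
  reach l κ B C v w = does (l ≤? κ * walks B C v w)

  dense : ℕ → Rel n → Rel n → Rel n
  dense {n} κ = reach n κ

  joined : Rel n → Rel n → Rel n
  joined = reach 1 1

  joined-dominates : (B C : Rel n) (V W : Sub n) (t : ℕ) → FewFourCycles B (n * n) → FewFourCycles (flip C) (n * n) →
                     6 * (n * n) ≤ t * paths B C V W → n * n ≤ t * t * edges (joined B C) V W
  joined-dominates {n} B C V W t fewB fewC h = ≤-trans (m≤n*m (n * n) 6) (+-cancelˡ-≤ (6 * (n * n)) _ _ (begin
    6 * (n * n) + 6 * (n * n)
      ≤⟨ +-mono-≤ h h ⟩
    t * paths B C V W + t * paths B C V W
      ≡⟨ double t (paths B C V W) ⟩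
    2 * t * paths B C V W
      ≡⟨ cong (2 * t *_) (paths≡walks B C V W) ⟩
    2 * t * ∑ (λ v → ∑ λ w → ⟦ V v ⟧ * (⟦ W w ⟧ * walks B C v w))
      ≡⟨ trans (*-∑ (2 * t) _) (∑-cong λ v → *-∑ (2 * t) _) ⟩
    ∑ (λ v → ∑ λ w → 2 * t * (⟦ V v ⟧ * (⟦ W w ⟧ * walks B C v w)))
      ≤⟨ ∑-mono₂ (λ v w → pointwise (V v) (W w) v w) ⟩
    ∑ (λ v → ∑ λ w → walks B C v w * walks B C v w + t * t * (⟦ V v ⟧ * (⟦ W w ⟧ * ⟦ joined B C v w ⟧)))
      ≡⟨ ∑∑-+ _ _ ⟩
    ∑ (λ v → ∑ λ w → walks B C v w * walks B C v w) +
    ∑ (λ v → ∑ λ w → t * t * (⟦ V v ⟧ * (⟦ W w ⟧ * ⟦ joined B C v w ⟧)))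
      ≤⟨ +-mono-≤ (∑walks² B C fewB fewC)
                  (≤-reflexive (sym (trans (cong (t * t *_) (edges≡∑∑ (joined B C) V W)) (trans (*-∑ (t * t) _) (∑-cong λ v → *-∑ (t * t) _))))) ⟩
    6 * (n * n) + t * t * edges (joined B C) V W ∎))
    where
    open ≤-Reasoning
    double : ∀ t p → t * p + t * p ≡ 2 * t * p
    double = solve-∀
    pull : ∀ t a b W → 2 * t * (a * (b * W)) ≡ a * (b * (2 * (W * t)))
    pull = solve-∀
    square : ∀ W → 2 * (W * t) ≤ W * W + t * t * ⟦ does (1 ≤? 1 * W) ⟧
    square zero    = z≤n
    square (suc W) = ≤-trans (2ab≤a²+b² (suc W) t) (≤-reflexive (cong (suc W * suc W +_) (sym (*-identityʳ (t * t)))))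
    pointwise : ∀ a b v w → 2 * t * (⟦ a ⟧ * (⟦ b ⟧ * walks B C v w)) ≤
                walks B C v w * walks B C v w + t * t * (⟦ a ⟧ * (⟦ b ⟧ * ⟦ joined B C v w ⟧))
    pointwise false b     v w = ≤-trans (≤-reflexive (*-zeroʳ (2 * t))) z≤n
    pointwise true  false v w = ≤-trans (≤-reflexive (*-zeroʳ (2 * t))) z≤n
    pointwise true  true  v w = ≤-trans (≤-reflexive (trans (pull t 1 1 (walks B C v w)) (ones _)))
      (≤-trans (square (walks B C v w)) (≤-reflexive (cong (λ z → walks B C v w * walks B C v w + t * t * z) (sym (ones _)))))
      where
      ones : ∀ z → 1 * (1 * z) ≡ z
      ones = solve-∀

  arm-dominates : {Γ₁ Γ₂ f₁ f₂ : Rel n} {a c c′ s : ℕ} (κ b : ℕ) → c′ ≡ 48 * (c * c) * (48 * (c * c)) → 0 < n → 0 < s → n ≤ 4 * (s * s) →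
    FewFourCycles f₁ (n * n) → FewFourCycles (flip f₂) (n * n) →
    Dominates Γ₁ f₁ a c (n * s) → Dominates Γ₂ f₂ a c (n * s) → 8 * ((b * κ) * (b * κ)) ≤ a →
    Dominates (dense κ Γ₁ Γ₂) (joined f₁ f₂) b c′ (n * n)
  arm-dominates {n} {Γ₁} {Γ₂} {f₁} {f₂} {a} {c} {_} {s} κ b refl 0<n 0<s n≤4s² few₁ few₂ dom₁ dom₂ bκ≤a = dominating λ V W h →
    joined-dominates f₁ f₂ V W (48 * (c * c)) few₁ few₂ (begin
      6 * (n * n)                           ≤⟨ *-monoʳ-≤ 6 (*-monoʳ-≤ n n≤4s²) ⟩
      6 * (n * (4 * (s * s)))               ≡⟨ ring₁ n (s * s) ⟩
      24 * (n * (s * s))                    ≤⟨ *-monoʳ-≤ 24 (paths-dominated (b * κ) 0<n 0<s dom₁ dom₂ bκ≤a V W (many V W h)) ⟩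
      24 * (2 * (c * c) * paths f₁ f₂ V W)  ≡⟨ ring₂ (c * c) (paths f₁ f₂ V W) ⟩
      48 * (c * c) * paths f₁ f₂ V W        ∎)
    where
    open ≤-Reasoning
    ring₁ : ∀ a b → 6 * (a * (4 * b)) ≡ 24 * (a * b)
    ring₁ = solve-∀
    ring₂ : ∀ a b → 24 * (2 * a * b) ≡ 48 * a * b
    ring₂ = solve-∀
    ring₃ : ∀ a b c d → a * (b * (c * d)) ≡ b * (c * (d * a))
    ring₃ = solve-∀
    ring₄ : ∀ a b c d → a * (b * (c * d)) ≡ c * (a * (b * d))
    ring₄ = solve-∀
    ring₅ : ∀ a b c → a * (b * c) ≡ b * (a * c)
    ring₅ = solve-∀
    D : Rel n
    D = dense κ Γ₁ Γ₂
    many : ∀ V W → n * n ≤ b * edges D V W → n * (n * n) ≤ b * κ * paths Γ₁ Γ₂ V W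
    many V W h = begin
      n * (n * n)                      ≤⟨ *-monoʳ-≤ n h ⟩
      n * (b * edges D V W)            ≡⟨ cong (λ z → n * (b * z)) (edges≡∑∑ D V W) ⟩
      n * (b * ∑ (λ v → ∑ λ w → ⟦ V v ⟧ * (⟦ W w ⟧ * ⟦ D v w ⟧)))
        ≡⟨ ring₅ n b _ ⟩
      b * (n * ∑ (λ v → ∑ λ w → ⟦ V v ⟧ * (⟦ W w ⟧ * ⟦ D v w ⟧)))
        ≡⟨ cong (b *_) (trans (*-∑ n _) (∑-cong λ v → *-∑ n _)) ⟩
      b * ∑ (λ v → ∑ λ w → n * (⟦ V v ⟧ * (⟦ W w ⟧ * ⟦ D v w ⟧)))
        ≤⟨ *-monoʳ-≤ b (∑-mono₂ λ v w → ≤-trans (≤-reflexive (ring₃ n ⟦ V v ⟧ ⟦ W w ⟧ ⟦ D v w ⟧))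
             (*-monoʳ-≤ ⟦ V v ⟧ (*-monoʳ-≤ ⟦ W w ⟧ (⟦⟧*-≤ (D v w) (does⇒ (n ≤? κ * walks Γ₁ Γ₂ v w)))))) ⟩
      b * ∑ (λ v → ∑ λ w → ⟦ V v ⟧ * (⟦ W w ⟧ * (κ * walks Γ₁ Γ₂ v w)))
        ≡⟨ cong (b *_) (∑-cong₂ λ v w → ring₄ ⟦ V v ⟧ ⟦ W w ⟧ κ (walks Γ₁ Γ₂ v w)) ⟩
      b * ∑ (λ v → ∑ λ w → κ * (⟦ V v ⟧ * (⟦ W w ⟧ * walks Γ₁ Γ₂ v w)))
        ≡⟨ cong (b *_) (sym (trans (*-∑ κ _) (∑-cong λ v → *-∑ κ _))) ⟩
      b * (κ * ∑ (λ v → ∑ λ w → ⟦ V v ⟧ * (⟦ W w ⟧ * walks Γ₁ Γ₂ v w)))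
        ≡⟨ *-assoc b κ _ ⟨
      b * κ * ∑ (λ v → ∑ λ w → ⟦ V v ⟧ * (⟦ W w ⟧ * walks Γ₁ Γ₂ v w))
        ≡⟨ cong (b * κ *_) (sym (paths≡walks Γ₁ Γ₂ V W)) ⟩
      b * κ * paths Γ₁ Γ₂ V W          ∎

  triangles : Rel n → Rel n → Rel n → ℕ
  triangles D B E = ∑ λ v → ∑ λ w → ∑ λ u → ⟦ D v w ⟧ * (⟦ B w u ⟧ * ⟦ E v u ⟧)

  module _ (D B E : Rel n) where
    private
      ring₁ : ∀ d b e → d * (b * e) ≡ e * (b * d)
      ring₁ = solve-∀
      ring₂ : ∀ d b e → d * (b * e) ≡ d * (e * b)
      ring₂ = solve-∀

    triangles-from-D : triangles D B E ≡ ∑ λ u → edges D (λ v → E v u) (λ w → B w u)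
    triangles-from-D = begin
      triangles D B E
        ≡⟨ trans (∑-cong λ v → ∑-comm _) (∑-comm _) ⟩
      ∑ (λ u → ∑ λ v → ∑ λ w → ⟦ D v w ⟧ * (⟦ B w u ⟧ * ⟦ E v u ⟧))
        ≡⟨ ∑-cong (λ u → trans (∑-cong₂ λ v w → ring₁ ⟦ D v w ⟧ ⟦ B w u ⟧ ⟦ E v u ⟧)
                               (sym (edges≡∑∑ D (λ v → E v u) (λ w → B w u)))) ⟩
      ∑ (λ u → edges D (λ v → E v u) (λ w → B w u)) ∎
      where open ≡-Reasoning

    triangles-from-E : triangles D B E ≡ ∑ λ w → edges E (λ v → D v w) (B w)
    triangles-from-E = trans (∑-comm _) (∑-cong λ w → sym (edges≡∑∑ E (λ v → D v w) (B w)))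

    triangles-from-B : triangles D B E ≡ ∑ λ v → edges B (D v) (E v)
    triangles-from-B = ∑-cong λ v → trans (∑-cong₂ λ w u → ring₂ ⟦ D v w ⟧ ⟦ B w u ⟧ ⟦ E v u ⟧)
                                          (sym (edges≡∑∑ B (D v) (E v)))

  pentagons : (f₁ f₂ e g₁ g₂ : Rel n) → ℕ
  pentagons f₁ f₂ e g₁ g₂ = ∑ λ v → ∑ λ w → ∑ λ u → walks f₁ f₂ v w * (⟦ e w u ⟧ * walks g₁ g₂ v u)

  dense-triangles : (Γ₁ Γ₂ E Λ₁ Λ₂ : Rel n) (κ : ℕ) → 0 < n →
    n * (n * (n * (n * n))) ≤ κ * pentagons Γ₁ Γ₂ E Λ₁ Λ₂ →
    n * (n * n) ≤ 2 * κ * triangles (dense (2 * κ) Γ₁ Γ₂) E (dense (2 * κ) Λ₁ Λ₂)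
  dense-triangles {n} Γ₁ Γ₂ E Λ₁ Λ₂ κ 0<n h =
    *-cancelˡ-≤ (n * n) {{>-nonZero (*-mono-≤ 0<n 0<n)}} (+-cancelˡ-≤ (n * (n * (n * (n * n)))) _ _ (begin
      n * (n * (n * (n * n))) + n * n * (n * (n * n))
        ≡⟨ cong (n * (n * (n * (n * n))) +_) (*-assoc n n _) ⟩
      n * (n * (n * (n * n))) + n * (n * (n * (n * n)))
        ≤⟨ +-mono-≤ h h ⟩
      κ * P + κ * P
        ≡⟨ double κ P ⟩
      2 * κ * P
        ≡⟨ trans (*-∑ (2 * κ) _) (∑-cong λ v → trans (*-∑ (2 * κ) _) (∑-cong λ w → *-∑ (2 * κ) _)) ⟩
      ∑ (λ v → ∑ λ w → ∑ λ u → 2 * κ * (W v w * (⟦ E w u ⟧ * W′ v u)))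
        ≤⟨ ∑-mono₂ (λ v w → ∑-mono λ u → pointwise v w u (D v w) (D′ v u) refl refl) ⟩
      ∑ (λ v → ∑ λ w → ∑ λ u → n * n + n * n * (2 * κ * (⟦ D v w ⟧ * (⟦ E w u ⟧ * ⟦ D′ v u ⟧))))
        ≡⟨ trans (∑-cong₂ λ v w → ∑-+ _ _) (∑∑-+ _ _) ⟩
      ∑ {n} (λ v → ∑ {n} λ w → ∑ {n} λ u → n * n) +
      ∑ (λ v → ∑ λ w → ∑ λ u → n * n * (2 * κ * (⟦ D v w ⟧ * (⟦ E w u ⟧ * ⟦ D′ v u ⟧))))
        ≡⟨ cong₂ _+_ (trans (∑-const n _) (cong (n *_) (trans (∑-const n _) (cong (n *_) (∑-const n _)))))
                     (sym (scale (n * n) (λ v w u → 2 * κ * (⟦ D v w ⟧ * (⟦ E w u ⟧ * ⟦ D′ v u ⟧))))) ⟩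
      n * (n * (n * (n * n))) + n * n * ∑ (λ v → ∑ λ w → ∑ λ u → 2 * κ * (⟦ D v w ⟧ * (⟦ E w u ⟧ * ⟦ D′ v u ⟧)))
        ≡⟨ cong (λ z → n * (n * (n * (n * n))) + n * n * z) (sym (scale (2 * κ) (λ v w u → ⟦ D v w ⟧ * (⟦ E w u ⟧ * ⟦ D′ v u ⟧)))) ⟩
      n * (n * (n * (n * n))) + n * n * (2 * κ * triangles D E D′) ∎))
    where
    open ≤-Reasoning
    P : ℕ
    P = pentagons Γ₁ Γ₂ E Λ₁ Λ₂
    W W′ : Fin n → Fin n → ℕ
    W = walks Γ₁ Γ₂
    W′ = walks Λ₁ Λ₂
    D D′ : Rel n
    D = dense (2 * κ) Γ₁ Γ₂
    D′ = dense (2 * κ) Λ₁ Λ₂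
    double : ∀ κ p → κ * p + κ * p ≡ 2 * κ * p
    double = solve-∀
    scale : ∀ c (F : Fin n → Fin n → Fin n → ℕ) → c * ∑ (λ v → ∑ λ w → ∑ λ u → F v w u) ≡
            ∑ (λ v → ∑ λ w → ∑ λ u → c * F v w u)
    scale c F = trans (*-∑ c _) (∑-cong λ v → trans (*-∑ c _) (∑-cong λ w → *-∑ c _))
    ring₁ : ∀ k a b c → k * (a * (b * c)) ≡ (k * a) * (b * c)
    ring₁ = solve-∀
    ring₂ : ∀ k a b c → k * (a * (b * c)) ≡ a * (b * (k * c))
    ring₂ = solve-∀
    ring₃ : ∀ k m e → k * (m * (e * m)) ≡ m * m * (k * (1 * (e * 1)))
    ring₃ = solve-∀
    pointwise : ∀ v w u d d′ → D v w ≡ d → D′ v u ≡ d′ →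
      2 * κ * (W v w * (⟦ E w u ⟧ * W′ v u)) ≤ n * n + n * n * (2 * κ * (⟦ d ⟧ * (⟦ E w u ⟧ * ⟦ d′ ⟧)))
    pointwise v w u false d′ eq eq′ = m≤n⇒m≤n+o _ (begin
      2 * κ * (W v w * (⟦ E w u ⟧ * W′ v u))   ≡⟨ ring₁ (2 * κ) (W v w) ⟦ E w u ⟧ (W′ v u) ⟩
      2 * κ * W v w * (⟦ E w u ⟧ * W′ v u)     ≤⟨ *-mono-≤ (<⇒≤ (≰⇒> (does-false⇒ (n ≤? 2 * κ * W v w) eq)))
                                                         (≤-trans (⟦⟧*≤ (E w u) _) (walks-≤ Λ₁ Λ₂ v u)) ⟩
      n * n                                    ∎)
    pointwise v w u true false eq eq′ = m≤n⇒m≤n+o _ (begin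
      2 * κ * (W v w * (⟦ E w u ⟧ * W′ v u))   ≡⟨ ring₂ (2 * κ) (W v w) ⟦ E w u ⟧ (W′ v u) ⟩
      W v w * (⟦ E w u ⟧ * (2 * κ * W′ v u))   ≤⟨ *-mono-≤ (walks-≤ Γ₁ Γ₂ v w) (≤-trans (⟦⟧*≤ (E w u) _)
                                                         (<⇒≤ (≰⇒> (does-false⇒ (n ≤? 2 * κ * W′ v u) eq′)))) ⟩
      n * n                                    ∎)
    pointwise v w u true true eq eq′ = m≤n⇒m≤o+n (n * n) (begin
      2 * κ * (W v w * (⟦ E w u ⟧ * W′ v u))   ≤⟨ *-monoʳ-≤ (2 * κ) (*-mono-≤ (walks-≤ Γ₁ Γ₂ v w) (*-monoʳ-≤ ⟦ E w u ⟧ (walks-≤ Λ₁ Λ₂ v u))) ⟩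
      2 * κ * (n * (⟦ E w u ⟧ * n))            ≡⟨ ring₃ (2 * κ) n ⟦ E w u ⟧ ⟩
      n * n * (2 * κ * (1 * (⟦ E w u ⟧ * 1)))  ∎)

  joined-triangles : (f₁ f₂ e g₁ g₂ : Rel n) →
                     triangles (joined f₁ f₂) e (joined g₁ g₂) ≤ pentagons f₁ f₂ e g₁ g₂
  joined-triangles f₁ f₂ e g₁ g₂ = ∑-mono₂ λ v w → ∑-mono λ u →
    *-mono-≤ (joined≤ (walks f₁ f₂ v w)) (*-monoʳ-≤ ⟦ e w u ⟧ (joined≤ (walks g₁ g₂ v u)))
    where
    joined≤ : ∀ W → ⟦ does (1 ≤? 1 * W) ⟧ ≤ W
    joined≤ zero    = z≤n
    joined≤ (suc W) = s≤s z≤n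

  pentagon-transfer : {Γ₁ Γ₂ E Λ₁ Λ₂ f₁ f₂ e g₁ g₂ : Rel n} {κ κ₁ κ₂ κ₃ a₁ c₁ a₂ c₂ a₃ c₃ s : ℕ} → 0 < n →
    κ₁ ≡ 2 * κ → κ₂ ≡ 2 * κ₁ * c₁ → κ₃ ≡ 2 * κ₂ * c₂ →
    Dominates (dense κ₁ Γ₁ Γ₂) (joined f₁ f₂) a₁ c₁ (n * n) → 2 * κ₁ ≤ a₁ →
    Dominates (dense κ₁ Λ₁ Λ₂) (joined g₁ g₂) a₂ c₂ (n * n) → 2 * κ₂ ≤ a₂ →
    Dominates E e a₃ c₃ (n * s) → 2 * κ₃ ≤ a₃ →
    n * (n * (n * (n * n))) ≤ κ * pentagons Γ₁ Γ₂ E Λ₁ Λ₂ →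
    n * (n * s) ≤ 2 * κ₃ * c₃ * pentagons f₁ f₂ e g₁ g₂
  pentagon-transfer {n} {Γ₁} {Γ₂} {E} {Λ₁} {Λ₂} {f₁} {f₂} {e} {g₁} {g₂} {κ} {κ₁} {κ₂} {κ₃} {a₁} {c₁} {a₂} {c₂} {a₃} {c₃} {s} 0<n
    refl refl refl dom₁ ≤a₁ dom₂ ≤a₂ dom₃ ≤a₃ h = begin
      n * (n * s)                              ≤⟨ step₃ ⟩
      2 * κ₃ * (c₃ * triangles F e G)          ≤⟨ *-monoʳ-≤ (2 * κ₃) (*-monoʳ-≤ c₃ (joined-triangles f₁ f₂ e g₁ g₂)) ⟩
      2 * κ₃ * (c₃ * pentagons f₁ f₂ e g₁ g₂)  ≡⟨ *-assoc (2 * κ₃) c₃ _ ⟨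
      2 * κ₃ * c₃ * pentagons f₁ f₂ e g₁ g₂    ∎
    where
    open ≤-Reasoning
    D D′ F G : Rel n
    D = dense κ₁ Γ₁ Γ₂
    D′ = dense κ₁ Λ₁ Λ₂
    F = joined f₁ f₂
    G = joined g₁ g₂
    step₁ : n * (n * n) ≤ κ₂ * triangles F E D′
    step₁ = begin
      n * (n * n)                         ≤⟨ dominates-sum κ₁ 0<n dom₁ ≤a₁ (λ u v → D′ v u) (λ u w → E w u)
                                               (subst (λ z → n * (n * n) ≤ κ₁ * z) (triangles-from-D D E D′)
                                                      (dense-triangles Γ₁ Γ₂ E Λ₁ Λ₂ κ 0<n h)) ⟩
      2 * κ₁ * (c₁ * ∑ (λ u → edges F (λ v → D′ v u) (λ w → E w u)))
                                          ≡⟨ cong (λ z → 2 * κ₁ * (c₁ * z)) (triangles-from-D F E D′) ⟨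
      2 * κ₁ * (c₁ * triangles F E D′)    ≡⟨ *-assoc (2 * κ₁) c₁ _ ⟨
      κ₂ * triangles F E D′               ∎
    step₂ : n * (n * n) ≤ κ₃ * triangles F E G
    step₂ = begin
      n * (n * n)                         ≤⟨ dominates-sum κ₂ 0<n dom₂ ≤a₂ (λ w v → F v w) E
                                               (subst (λ z → n * (n * n) ≤ κ₂ * z) (triangles-from-E F E D′) step₁) ⟩
      2 * κ₂ * (c₂ * ∑ (λ w → edges G (λ v → F v w) (E w)))
                                          ≡⟨ cong (λ z → 2 * κ₂ * (c₂ * z)) (triangles-from-E F E G) ⟨
      2 * κ₂ * (c₂ * triangles F E G)     ≡⟨ *-assoc (2 * κ₂) c₂ _ ⟨
      κ₃ * triangles F E G                ∎
    step₃ : n * (n * s) ≤ 2 * κ₃ * (c₃ * triangles F e G)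
    step₃ = subst (λ z → n * (n * s) ≤ 2 * κ₃ * (c₃ * z)) (sym (triangles-from-B F e G))
      (dominates-sum κ₃ 0<n dom₃ ≤a₃ F G (subst (λ z → n * (n * n) ≤ κ₃ * z) (triangles-from-B F E G) step₂))

  -- Sparse graphs on sets with few columns

  fibre : (Fin n → Fin m) → Fin m → Sub n
  fibre t p x = t x == p

  ∑-fibre-size : (t : Fin n → Fin m) → ∑ (λ p → size (fibre t p)) ≡ n
  ∑-fibre-size {n} t = begin
    ∑ (λ p → ∑ λ x → ⟦ t x == p ⟧)          ≡⟨ ∑-cong₂ (λ p x → *-identityʳ _) ⟨
    ∑ (λ p → ∑ λ x → ⟦ t x == p ⟧ * 1)      ≡⟨ ∑-fibres t (λ _ → 1) ⟨
    ∑ {n} (λ _ → 1)                         ≡⟨ size-all n ⟩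
    n                                       ∎
    where open ≡-Reasoning

  module _ {D : Rel n} (cols : ColumnTypes m D) where
    ⊓-by-columns : (f : Rel n) →
      count (f ⊓ᵣ D) ≡ ∑ λ p → ∑ λ v → ⟦ column cols p v ⟧ * deg f (fibre (type cols) p) v
    ⊓-by-columns f = begin
      ∑ (λ v → ∑ λ x → ⟦ f v x ∧ D v x ⟧)
        ≡⟨ ∑-cong (λ v → ∑-fibres (type cols) _) ⟩
      ∑ (λ v → ∑ λ p → ∑ λ x → ⟦ type cols x == p ⟧ * ⟦ f v x ∧ D v x ⟧)
        ≡⟨ ∑-comm _ ⟩
      ∑ (λ p → ∑ λ v → ∑ λ x → ⟦ type cols x == p ⟧ * ⟦ f v x ∧ D v x ⟧)
        ≡⟨ ∑-cong₂ (λ p v → trans (∑-cong λ x → pointwise p v x) (sym (*-∑ ⟦ column cols p v ⟧ _))) ⟩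
      ∑ (λ p → ∑ λ v → ⟦ column cols p v ⟧ * deg f (fibre (type cols) p) v) ∎
      where
      open ≡-Reasoning
      ring : ∀ a b c → a * (b * c) ≡ c * (a * b)
      ring = solve-∀
      pointwise : ∀ p v x → ⟦ type cols x == p ⟧ * ⟦ f v x ∧ D v x ⟧ ≡
                  ⟦ column cols p v ⟧ * (⟦ type cols x == p ⟧ * ⟦ f v x ⟧)
      pointwise p v x with type cols x == p in eq
      ... | false = sym (*-zeroʳ ⟦ column cols p v ⟧)
      ... | true  = trans (cong (1 *_) (trans (⟦∧⟧ (f v x) (D v x))
                      (cong (λ b → ⟦ f v x ⟧ * ⟦ b ⟧) (trans (column-eq cols v x) (cong (λ q → column cols q v) (==⇒≡ _ p eq))))))
                      (ring 1 ⟦ f v x ⟧ ⟦ column cols p v ⟧)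

    count-by-columns : count D ≡ ∑ λ p → size (column cols p) * size (fibre (type cols) p)
    count-by-columns = trans (⊓-by-columns (λ _ _ → true)) (∑-cong λ p →
      trans (∑-cong λ v → cong (⟦ column cols p v ⟧ *_) (∑-cong λ x → *-identityʳ _)) (sym (∑-* _ _)))

  few-edges : (f : Rel n) (t : ℕ) → 0 < t → t * t ≤ n → fourCycles f ≤ n * n → t * count f ≤ 3 * (n * n)
  few-edges {n} f t 0<t t²≤n few = +-cancelˡ-≤ (count f) _ _ (begin
    count f + t * count f
      ≤⟨ +-monoˡ-≤ (t * count f) (m≤n*m (count f) t {{>-nonZero 0<t}}) ⟩
    t * count f + t * count f
      ≡⟨ trans (double t (count f)) (trans (*-∑ (2 * t) _) (∑-cong λ v → trans (cong (2 * t *_) (sym (deg-all f v))) (ring t _))) ⟩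
    ∑ (λ v → 2 * (deg f (const true) v * t))
      ≤⟨ ∑-mono (λ v → 2ab≤a²+b² (deg f (const true) v) t) ⟩
    ∑ (λ v → deg f (const true) v * deg f (const true) v + t * t)
      ≡⟨ ∑-+ _ _ ⟩
    ∑ (λ v → deg f (const true) v * deg f (const true) v) + ∑ {n} (λ v → t * t)
      ≤⟨ +-mono-≤ (∑deg² f (const true)) (≤-trans (≤-reflexive (∑-const n _)) (*-monoʳ-≤ n t²≤n)) ⟩
    count f + size {n} (const true) * size {n} (const true) + fourCycles f + n * n
      ≤⟨ +-monoˡ-≤ (n * n) (+-mono-≤ (≤-reflexive (cong (λ z → count f + z * z) (size-all n))) few) ⟩
    count f + n * n + n * n + n * n
      ≡⟨ collect (count f) (n * n) ⟩
    count f + 3 * (n * n) ∎)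
    where
    open ≤-Reasoning
    double : ∀ t e → t * e + t * e ≡ 2 * t * e
    double = solve-∀
    ring : ∀ t d → 2 * t * d ≡ 2 * (d * t)
    ring = solve-∀
    collect : ∀ e z → e + z + z + z ≡ e + 3 * z
    collect = solve-∀

  -- The weights A |P| + n (instead of |P|) keep the lower-order terms under control on small fibres P.
  sparse-on : {f D : Rel n} {s : ℕ} (ρ : ℕ) (cols : ColumnTypes m D) (let A = m * (ρ * ρ)) →
    0 < n → 0 < s → 0 < ρ → n ≤ 4 * (s * s) → ρ * ρ * count D ≤ n * n →
    A * A * count f ≤ n * n → A * A * fourCycles f ≤ n * n →
    ρ * count (f ⊓ᵣ D) ≤ 7 * (n * s)
  sparse-on {n} {m} {f} {D} {s} ρ cols 0<n 0<s 0<ρ n≤4s² thin few-e few-Q =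
    *-cancelˡ-≤ (2 * (A * s)) {{>-nonZero (*-mono-≤ (s≤s (z≤n {1})) (*-mono-≤ 0<A 0<s))}} (begin
      2 * (A * s) * (ρ * count (f ⊓ᵣ D))
        ≡⟨ trans (cong (λ z → 2 * (A * s) * (ρ * z)) (⊓-by-columns cols f)) (trans (sym (*-assoc (2 * (A * s)) ρ (∑ E))) (*-∑ (2 * (A * s) * ρ) E)) ⟩
      ∑ (λ p → 2 * (A * s) * ρ * E p)
        ≤⟨ ∑-mono perFibre ⟩
      ∑ (λ p → (3 * (s * s) + ρ * ρ * Y p) * (A * k p + n))
        ≡⟨ ∑-cong (λ p → expand s ρ (Y p) A (k p) n) ⟩
      ∑ (λ p → 3 * (s * s) * A * k p + 3 * (s * s) * n + (ρ * ρ * A * (Y p * k p) + ρ * ρ * n * Y p))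
        ≡⟨ trans (∑-+ _ _) (cong₂ _+_ (∑-+ _ _) (∑-+ _ _)) ⟩
      ∑ (λ p → 3 * (s * s) * A * k p) + ∑ {m} (λ p → 3 * (s * s) * n)
        + (∑ (λ p → ρ * ρ * A * (Y p * k p)) + ∑ (λ p → ρ * ρ * n * Y p))
        ≡⟨ cong₂ _+_ (cong₂ _+_ (trans (sym (*-∑ (3 * (s * s) * A) k)) (cong (3 * (s * s) * A *_) (∑-fibre-size (type cols)))) (∑-const m _))
                     (cong₂ _+_ (trans (sym (*-∑ (ρ * ρ * A) (λ p → Y p * k p))) (cong (ρ * ρ * A *_) (sym (count-by-columns cols)))) (sym (*-∑ (ρ * ρ * n) Y))) ⟩
      3 * (s * s) * A * n + m * (3 * (s * s) * n) + (ρ * ρ * A * count D + ρ * ρ * n * ∑ Y)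
        ≤⟨ +-mono-≤ (+-monoʳ-≤ (3 * (s * s) * A * n) (*-monoˡ-≤ (3 * (s * s) * n) m≤A))
                    (+-monoʳ-≤ (ρ * ρ * A * count D) (*-monoʳ-≤ (ρ * ρ * n) (∑-bound n λ p → size-≤ (column cols p)))) ⟩
      3 * (s * s) * A * n + A * (3 * (s * s) * n) + (ρ * ρ * A * count D + ρ * ρ * n * (m * n))
        ≡⟨ collect (s * s) A n (ρ * ρ) (count D) m ⟩
      A * (6 * (n * (s * s))) + (A * (ρ * ρ * count D) + m * (ρ * ρ) * (n * n))
        ≤⟨ +-monoʳ-≤ (A * (6 * (n * (s * s)))) (+-mono-≤ (*-monoʳ-≤ A (≤-trans thin n²≤)) (*-monoʳ-≤ A n²≤)) ⟩
      A * (6 * (n * (s * s))) + (A * (n * (4 * (s * s))) + A * (n * (4 * (s * s))))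
        ≡⟨ final A n s ⟩
      2 * (A * s) * (7 * (n * s)) ∎)
    where
    open ≤-Reasoning
    A : ℕ
    A = m * (ρ * ρ)
    P : Fin m → Sub n
    P = fibre (type cols)
    E Y k : Fin m → ℕ
    E p = ∑ λ v → ⟦ column cols p v ⟧ * deg f (P p) v
    Y p = size (column cols p)
    k p = size (P p)
    0<m : 0 < m
    0<m = go (type cols) 0<n
      where
      go : ∀ {n m} → (Fin n → Fin m) → 0 < n → 0 < m
      go {suc n} {suc m} t _ = s≤s z≤n
      go {suc n} {zero}  t _ with () ← t zero
    0<A : 0 < A
    0<A = *-mono-≤ 0<m (*-mono-≤ 0<ρ 0<ρ)
    m≤A : m ≤ A
    m≤A = m≤m*n m (ρ * ρ) {{>-nonZero (*-mono-≤ 0<ρ 0<ρ)}}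
    n²≤ : n * n ≤ n * (4 * (s * s))
    n²≤ = *-monoʳ-≤ n n≤4s²
    expand : ∀ s ρ Y A k n → (3 * (s * s) + ρ * ρ * Y) * (A * k + n) ≡
             3 * (s * s) * A * k + 3 * (s * s) * n + (ρ * ρ * A * (Y * k) + ρ * ρ * n * Y)
    expand = solve-∀
    collect : ∀ ss A n ρρ c m → 3 * ss * A * n + A * (3 * ss * n) + (ρρ * A * c + ρρ * n * (m * n)) ≡
              A * (6 * (n * ss)) + (A * (ρρ * c) + m * ρρ * (n * n))
    collect = solve-∀
    final : ∀ A n s → A * (6 * (n * (s * s))) + (A * (n * (4 * (s * s))) + A * (n * (4 * (s * s)))) ≡
            2 * (A * s) * (7 * (n * s))
    final = solve-∀
    perFibre : ∀ p → 2 * (A * s) * ρ * E p ≤ (3 * (s * s) + ρ * ρ * Y p) * (A * k p + n)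
    perFibre p = *-cancelʳ-≤ _ _ b {{>-nonZero (≤-trans 0<n (m≤n+m n (A * k p)))}} (begin
      2 * (A * s) * ρ * E p * b
        ≡⟨ trans (rearrange A s ρ (E p) b) (trans (*-∑ (2 * (A * s * (ρ * b))) _) (∑-cong λ v → pull A s ρ b ⟦ column cols p v ⟧ (deg f (P p) v))) ⟩
      ∑ (λ v → ⟦ column cols p v ⟧ * (2 * (A * s * deg f (P p) v * (ρ * b))))
        ≤⟨ ∑-mono (λ v → *-monoʳ-≤ ⟦ column cols p v ⟧ (2ab≤a²+b² (A * s * deg f (P p) v) (ρ * b))) ⟩
      ∑ (λ v → ⟦ column cols p v ⟧ * (A * s * deg f (P p) v * (A * s * deg f (P p) v) + ρ * b * (ρ * b)))
        ≤⟨ ∑-mono (λ v → drop (column cols p v) (A * s * deg f (P p) v * (A * s * deg f (P p) v)) (ρ * b * (ρ * b))) ⟩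
      ∑ (λ v → A * s * deg f (P p) v * (A * s * deg f (P p) v) + ⟦ column cols p v ⟧ * (ρ * b * (ρ * b)))
        ≡⟨ trans (∑-+ _ _) (cong₂ _+_ (trans (∑-cong λ v → square A s (deg f (P p) v)) (sym (*-∑ (A * A * (s * s)) _))) (sym (∑-* _ _))) ⟩
      A * A * (s * s) * ∑ (λ v → deg f (P p) v * deg f (P p) v) + Y p * (ρ * b * (ρ * b))
        ≤⟨ +-monoˡ-≤ _ (*-monoʳ-≤ (A * A * (s * s)) (∑deg² f (P p))) ⟩
      A * A * (s * s) * (count f + k p * k p + fourCycles f) + Y p * (ρ * b * (ρ * b))
        ≡⟨ cong (_+ Y p * (ρ * b * (ρ * b))) (distribute A s (count f) (k p) (fourCycles f)) ⟩
      s * s * (A * A * count f + A * k p * (A * k p) + A * A * fourCycles f) + Y p * (ρ * b * (ρ * b))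
        ≤⟨ +-monoˡ-≤ _ (*-monoʳ-≤ (s * s) (+-mono-≤ (+-mono-≤ (≤-trans few-e n²≤b²) (*-mono-≤ (m≤m+n (A * k p) n) (m≤m+n (A * k p) n))) (≤-trans few-Q n²≤b²))) ⟩
      s * s * (b * b + b * b + b * b) + Y p * (ρ * b * (ρ * b))
        ≡⟨ gather s b (Y p) ρ ⟩
      (3 * (s * s) + ρ * ρ * Y p) * b * b ∎)
      where
      b : ℕ
      b = A * k p + n
      n²≤b² : n * n ≤ b * b
      n²≤b² = *-mono-≤ (m≤n+m n (A * k p)) (m≤n+m n (A * k p))
      rearrange : ∀ A s ρ E b → 2 * (A * s) * ρ * E * b ≡ 2 * (A * s * (ρ * b)) * E
      rearrange = solve-∀
      pull : ∀ A s ρ b c d → 2 * (A * s * (ρ * b)) * (c * d) ≡ c * (2 * (A * s * d * (ρ * b)))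
      pull = solve-∀
      square : ∀ A s d → A * s * d * (A * s * d) ≡ A * A * (s * s) * (d * d)
      square = solve-∀
      distribute : ∀ A s e k Q → A * A * (s * s) * (e + k * k + Q) ≡ s * s * (A * A * e + A * k * (A * k) + A * A * Q)
      distribute = solve-∀
      gather : ∀ s b Y ρ → s * s * (b * b + b * b + b * b) + Y * (ρ * b * (ρ * b)) ≡ (3 * (s * s) + ρ * ρ * Y) * b * b
      gather = solve-∀
      drop : ∀ c x y → ⟦ c ⟧ * (x + y) ≤ x + ⟦ c ⟧ * y
      drop true  x y = ≤-reflexive (trans (*-identityˡ _) (cong (x +_) (sym (*-identityˡ y))))
      drop false x y = z≤n

  -- A one-sided regularity partition

  _∩_ : Sub n → Sub n → Sub n
  (X ∩ Y) x = X x ∧ Y x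

  size-cong : {X Y : Sub n} → (∀ x → X x ≡ Y x) → size X ≡ size Y
  size-cong X≗Y = ∑-cong λ x → cong ⟦_⟧ (X≗Y x)

  ∑-along : (t : Fin n → Fin m) (g : Fin n → Fin m → ℕ) →
            ∑ (λ x → g x (t x)) ≡ ∑ λ p → ∑ λ x → ⟦ t x == p ⟧ * g x p
  ∑-along t g = trans (∑-cong λ x → sym (∑-point (t x) (g x))) (∑-comm _)

  count-by-cells : (t t′ : Fin n → Fin m) (B : Rel n) (F : Fin m → Fin m → Bool) (X Y : Fin m → Fin m → Sub n) →
    count (λ w u → B w u ∧ (F (t w) (t′ u) ∧ (X (t w) (t′ u) w ∧ Y (t w) (t′ u) u))) ≡
    ∑ λ p → ∑ λ q → ⟦ F p q ⟧ * edges B (X p q ∩ fibre t p) (Y p q ∩ fibre t′ q)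
  count-by-cells t t′ B F X Y = begin
    ∑ (λ w → ∑ λ u → G (t w) (t′ u) w u)
      ≡⟨ ∑-along t (λ w p → ∑ λ u → G p (t′ u) w u) ⟩
    ∑ (λ p → ∑ λ w → ⟦ t w == p ⟧ * ∑ λ u → G p (t′ u) w u)
      ≡⟨ ∑-cong₂ (λ p w → trans (cong (⟦ t w == p ⟧ *_) (∑-along t′ (λ u q → G p q w u))) (*-∑ ⟦ t w == p ⟧ _)) ⟩
    ∑ (λ p → ∑ λ w → ∑ λ q → ⟦ t w == p ⟧ * ∑ λ u → ⟦ t′ u == q ⟧ * G p q w u)
      ≡⟨ ∑-cong (λ p → ∑-comm _) ⟩
    ∑ (λ p → ∑ λ q → ∑ λ w → ⟦ t w == p ⟧ * ∑ λ u → ⟦ t′ u == q ⟧ * G p q w u)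
      ≡⟨ ∑-cong₂ (λ p q → ∑-cong λ w → trans (*-∑ ⟦ t w == p ⟧ _) (∑-cong λ u →
           pointwise (t w == p) (t′ u == q) (B w u) (F p q) (X p q w) (Y p q u))) ⟩
    ∑ (λ p → ∑ λ q → ∑ λ w → ∑ λ u → ⟦ F p q ⟧ * (⟦ X p q w ∧ (t w == p) ⟧ * (⟦ Y p q u ∧ (t′ u == q) ⟧ * ⟦ B w u ⟧)))
      ≡⟨ ∑-cong₂ (λ p q → sym (trans (cong (⟦ F p q ⟧ *_) (edges≡∑∑ B (X p q ∩ fibre t p) (Y p q ∩ fibre t′ q))) (trans (*-∑ ⟦ F p q ⟧ _) (∑-cong λ w → *-∑ ⟦ F p q ⟧ _)))) ⟩
    ∑ (λ p → ∑ λ q → ⟦ F p q ⟧ * edges B (X p q ∩ fibre t p) (Y p q ∩ fibre t′ q)) ∎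
    where
    open ≡-Reasoning
    G : _ → _ → _ → _ → ℕ
    G p q w u = ⟦ B w u ∧ (F p q ∧ (X p q w ∧ Y p q u)) ⟧
    ring : ∀ a b c d e f → a * (b * (c * (d * (e * f)))) ≡ d * ((e * a) * ((f * b) * c))
    ring = solve-∀
    pointwise : ∀ a b c d e f → ⟦ a ⟧ * (⟦ b ⟧ * ⟦ c ∧ (d ∧ (e ∧ f)) ⟧) ≡ ⟦ d ⟧ * (⟦ e ∧ a ⟧ * (⟦ f ∧ b ⟧ * ⟦ c ⟧))
    pointwise a b c d e f = trans
      (cong (λ z → ⟦ a ⟧ * (⟦ b ⟧ * z)) (trans (⟦∧⟧ c _) (cong (⟦ c ⟧ *_) (trans (⟦∧⟧ d _) (cong (⟦ d ⟧ *_) (⟦∧⟧ e f))))))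
      (trans (ring ⟦ a ⟧ ⟦ b ⟧ ⟦ c ⟧ ⟦ d ⟧ ⟦ e ⟧ ⟦ f ⟧)
             (sym (cong₂ (λ y z → ⟦ d ⟧ * (y * (z * ⟦ c ⟧))) (⟦∧⟧ e a) (⟦∧⟧ f b))))

  edges-full : (X Y : Sub n) → edges (λ _ _ → true) X Y ≡ size X * size Y
  edges-full X Y = trans (∑-cong λ x → cong (⟦ X x ⟧ *_) (∑-cong λ y → *-identityʳ _)) (sym (∑-* _ _))

  partBound : ℕ → ℕ → ℕ
  partBound zero    m = m
  partBound (suc j) m = partBound j (m * 2 ^ m)

  m≤partBound : ∀ j m → m ≤ partBound j m
  m≤partBound zero    m = ≤-refl
  m≤partBound (suc j) m = ≤-trans (m≤m*n m (2 ^ m) {{>-nonZero (m^n>0 2 m)}}) (m≤partBound j _)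

  zone : (Fin n → Fin m) → (Fin n → Fin m) → (Fin m → Fin m → Bool) → Rel n
  zone t t′ live w u = live (t w) (t′ u)

  record RegularPartition (B : Rel n) (r c M lost : ℕ) : Set where
    field
      parts   : ℕ
      parts≤  : parts ≤ M
      t t′    : Fin n → Fin parts
      live    : Fin parts → Fin parts → Bool
      regular : ∀ p q → live p q ≡ true → ∀ X Y →
                size (fibre t p) ≤ r * size (X ∩ fibre t p) → size (fibre t′ q) ≤ r * size (Y ∩ fibre t′ q) →
                n * n ≤ c * edges B (X ∩ fibre t p) (Y ∩ fibre t′ q)
      dead    : r * (c * count (B ∖ zone t t′ live)) ≤ r * lost + c * (n * n)

  module Refinement {n : ℕ} (B : Rel n) (r c M : ℕ) (0<n : 0 < n) (0<r : 0 < r) where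
    open RegularPartition

    module Step {m : ℕ} (t t′ : Fin n → Fin m) (live : Fin m → Fin m → Bool) where
      Bad : Fin m → Fin m → Sub n → Sub n → Set
      Bad p q X Y = size (fibre t p) ≤ r * size (X ∩ fibre t p) ×
                    size (fibre t′ q) ≤ r * size (Y ∩ fibre t′ q) ×
                    c * edges B (X ∩ fibre t p) (Y ∩ fibre t′ q) < n * n

      search : ∀ p q → ∃₂ (Bad p q) ⊎ (∀ X Y → ¬ Bad p q X Y)
      search p q = searchPair (Bad p q)
        (λ X Y → (size (fibre t p) ≤? r * size (X ∩ fibre t p)) ×-dec
                 ((size (fibre t′ q) ≤? r * size (Y ∩ fibre t′ q)) ×-dec
                  (c * edges B (X ∩ fibre t p) (Y ∩ fibre t′ q) <? n * n)))
        (λ X≗ Y≗ (a , b , d) →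
           subst (λ z → size (fibre t p) ≤ r * z) (size-cong λ i → cong (_∧ fibre t p i) (X≗ i)) a ,
           subst (λ z → size (fibre t′ q) ≤ r * z) (size-cong λ i → cong (_∧ fibre t′ q i) (Y≗ i)) b ,
           subst (λ z → c * z < n * n) (edges-cong B (λ i → cong (_∧ fibre t p i) (X≗ i))
                                                     (λ i → cong (_∧ fibre t′ q i) (Y≗ i))) d)

      bad : Fin m → Fin m → Bool
      bad p q with search p q
      ... | inj₁ _ = true
      ... | inj₂ _ = false

      X Y : Fin m → Fin m → Sub n
      X p q with search p q
      ... | inj₁ (X , _) = X
      ... | inj₂ _       = const false
      Y p q with search p q
      ... | inj₁ (_ , Y , _) = Y
      ... | inj₂ _           = const false

      bad⇒ : ∀ p q → bad p q ≡ true → Bad p q (X p q) (Y p q)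
      bad⇒ p q eq with search p q
      ... | inj₁ (_ , _ , b) = b

      good⇒ : ∀ p q → bad p q ≡ false → ∀ X Y → ¬ Bad p q X Y
      good⇒ p q eq with search p q
      ... | inj₂ none = none

      liveBad : Fin m → Fin m → Bool
      liveBad p q = live p q ∧ bad p q

      badZone hole : Rel n
      badZone = zone t t′ liveBad
      hole w u = liveBad (t w) (t′ u) ∧ (X (t w) (t′ u) w ∧ Y (t w) (t′ u) u)

      t₊ t′₊ : Fin n → Fin (m * 2 ^ m)
      t₊ w = combine (t w) (funToFin λ q → bit (X (t w) q w))
      t′₊ u = combine (t′ u) (funToFin λ p → bit (Y p (t′ u) u))

      decode : Fin (m * 2 ^ m) → Fin m × (Fin m → Bool)
      decode p = proj₁ (remQuot {m} (2 ^ m) p) , λ q → isOne (finToFun {2} {m} (proj₂ (remQuot {m} (2 ^ m) p)) q)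

      live₊ : Fin (m * 2 ^ m) → Fin (m * 2 ^ m) → Bool
      live₊ p q = live p₀ q₀ ∧ not (liveBad p₀ q₀ ∧ (proj₂ (decode p) q₀ ∧ proj₂ (decode q) p₀))
        where
        p₀ q₀ : Fin m
        p₀ = proj₁ (decode p)
        q₀ = proj₁ (decode q)

      decode₁ : ∀ p (f : Fin m → Bool) → proj₁ (decode (combine p (funToFin λ q → bit (f q)))) ≡ p
      decode₁ p f = cong proj₁ (remQuot-combine {m} {2 ^ m} p (funToFin λ q → bit (f q)))

      decode₂ : ∀ p (f : Fin m → Bool) q → proj₂ (decode (combine p (funToFin λ q → bit (f q)))) q ≡ f q
      decode₂ p f q = trans (cong (λ z → isOne (finToFun {2} {m} (proj₂ z) q)) (remQuot-combine {m} {2 ^ m} p (funToFin λ q → bit (f q))))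
        (trans (cong isOne (finToFun-funToFin (λ q → bit (f q)) q)) (isOne-bit (f q)))

      zone₊ : ∀ w u → zone t₊ t′₊ live₊ w u ≡ (zone t t′ live ∖ hole) w u
      zone₊ w u rewrite decode₁ (t w) (λ q → X (t w) q w) | decode₁ (t′ u) (λ p → Y p (t′ u) u)
                      | decode₂ (t w) (λ q → X (t w) q w) (t′ u) | decode₂ (t′ u) (λ p → Y p (t′ u) u) (t w) = refl

      badZone≤hole : count badZone ≤ r * r * count hole
      badZone≤hole = begin
        count badZone
          ≡⟨ ∑-cong₂ (λ w u → ones (liveBad (t w) (t′ u))) ⟩
        count (λ w u → true ∧ (liveBad (t w) (t′ u) ∧ (true ∧ true)))
          ≡⟨ count-by-cells t t′ (λ _ _ → true) liveBad (λ _ _ _ → true) (λ _ _ _ → true) ⟩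
        ∑ (λ p → ∑ λ q → ⟦ liveBad p q ⟧ * edges (λ _ _ → true) (fibre t p) (fibre t′ q))
          ≤⟨ ∑-mono₂ (λ p q → ≤-trans (⟦⟧*-mono (liveBad p q) (perCell p q)) (≤-reflexive (pull ⟦ liveBad p q ⟧ (r * r) _))) ⟩
        ∑ (λ p → ∑ λ q → r * r * (⟦ liveBad p q ⟧ * edges (λ _ _ → true) (X p q ∩ fibre t p) (Y p q ∩ fibre t′ q)))
          ≡⟨ sym (trans (*-∑ (r * r) _) (∑-cong λ p → *-∑ (r * r) _)) ⟩
        r * r * ∑ (λ p → ∑ λ q → ⟦ liveBad p q ⟧ * edges (λ _ _ → true) (X p q ∩ fibre t p) (Y p q ∩ fibre t′ q))
          ≡⟨ cong (r * r *_) (sym (count-by-cells t t′ (λ _ _ → true) liveBad X Y)) ⟩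
        r * r * count hole ∎
        where
        open ≤-Reasoning
        ones : ∀ b → ⟦ b ⟧ ≡ ⟦ true ∧ (b ∧ (true ∧ true)) ⟧
        ones true  = refl
        ones false = refl
        pull : ∀ a b c → a * (b * c) ≡ b * (a * c)
        pull = solve-∀
        ring : ∀ r a b → (r * a) * (r * b) ≡ r * r * (a * b)
        ring = solve-∀
        perCell : ∀ p q → liveBad p q ≡ true → edges (λ _ _ → true) (fibre t p) (fibre t′ q) ≤
                  r * r * edges (λ _ _ → true) (X p q ∩ fibre t p) (Y p q ∩ fibre t′ q)
        perCell p q eq = let (a , b , _) = bad⇒ p q (proj₂ (∧-true {live p q} eq)) in begin
          edges (λ _ _ → true) (fibre t p) (fibre t′ q)       ≡⟨ edges-full _ _ ⟩
          size (fibre t p) * size (fibre t′ q)                ≤⟨ *-mono-≤ a b ⟩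
          (r * size (X p q ∩ fibre t p)) * (r * size (Y p q ∩ fibre t′ q)) ≡⟨ ring r _ _ ⟩
          r * r * (size (X p q ∩ fibre t p) * size (Y p q ∩ fibre t′ q))   ≡⟨ cong (r * r *_) (edges-full _ _) ⟨
          r * r * edges (λ _ _ → true) (X p q ∩ fibre t p) (Y p q ∩ fibre t′ q) ∎

      hole-sparse : c * count (B ⊓ᵣ hole) ≤ m * (m * (n * n))
      hole-sparse = begin
        c * count (B ⊓ᵣ hole)
          ≡⟨ cong (c *_) (count-by-cells t t′ B liveBad X Y) ⟩
        c * ∑ (λ p → ∑ λ q → ⟦ liveBad p q ⟧ * edges B (X p q ∩ fibre t p) (Y p q ∩ fibre t′ q))
          ≡⟨ trans (*-∑ c _) (∑-cong λ p → *-∑ c _) ⟩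
        ∑ (λ p → ∑ λ q → c * (⟦ liveBad p q ⟧ * edges B (X p q ∩ fibre t p) (Y p q ∩ fibre t′ q)))
          ≤⟨ ∑-bound _ (λ p → ∑-bound _ λ q → perCell p q) ⟩
        m * (m * (n * n)) ∎
        where
        open ≤-Reasoning
        pull : ∀ a b c → a * (b * c) ≡ b * (a * c)
        pull = solve-∀
        perCell : ∀ p q → c * (⟦ liveBad p q ⟧ * edges B (X p q ∩ fibre t p) (Y p q ∩ fibre t′ q)) ≤ n * n
        perCell p q = ≤-trans (≤-reflexive (pull c ⟦ liveBad p q ⟧ _)) (⟦⟧*-≤ (liveBad p q) λ eq →
          <⇒≤ (proj₂ (proj₂ (bad⇒ p q (proj₂ (∧-true {live p q} eq))))))

    refine : ∀ j {m} (t t′ : Fin n → Fin m) (live : Fin m → Fin m → Bool) → partBound j m ≤ M →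
             r * (r * r) * count (zone t t′ live) ≤ j * (n * n) →
             RegularPartition B r c M (c * count (B ∖ zone t t′ live) + j * (M * M * (n * n)))
    refine j {m} t t′ live fits small with r * count (Step.badZone t t′ live) ≤? n * n
    ... | yes few = record
      { parts = m ; parts≤ = ≤-trans (m≤partBound j m) fits ; t = t ; t′ = t′
      ; live = λ p q → live p q ∧ not (bad p q)
      ; regular = λ p q eq X Y a b → ≮⇒≥ λ d →
          good⇒ p q (not-true (proj₂ (∧-true {live p q} eq))) X Y (a , b , d)
      ; dead = begin
          r * (c * count (B ∖ zone t t′ live′))
            ≤⟨ *-monoʳ-≤ r (*-monoʳ-≤ c (count-+ λ w u → cases (B w u) (live (t w) (t′ u)) (bad (t w) (t′ u)))) ⟩
          r * (c * (count (B ∖ zone t t′ live) + count badZone))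
            ≡⟨ ring r c _ _ ⟩
          r * (c * count (B ∖ zone t t′ live)) + c * (r * count badZone)
            ≤⟨ +-mono-≤ (*-monoʳ-≤ r (m≤m+n _ _)) (*-monoʳ-≤ c few) ⟩
          r * (c * count (B ∖ zone t t′ live) + j * (M * M * (n * n))) + c * (n * n) ∎ }
      where
      open Step t t′ live
      open ≤-Reasoning
      live′ : Fin m → Fin m → Bool
      live′ p q = live p q ∧ not (bad p q)
      ring : ∀ r c a b → r * (c * (a + b)) ≡ r * (c * a) + c * (r * b)
      ring = solve-∀
      cases : ∀ b l d → ⟦ b ∧ not (l ∧ not d) ⟧ ≤ ⟦ b ∧ not l ⟧ + ⟦ l ∧ d ⟧
      cases false l     d     = z≤n
      cases true  false d     = s≤s z≤n
      cases true  true  true  = s≤s z≤n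
      cases true  true  false = z≤n
    refine zero {m} t t′ live fits small | no many = contradiction (begin
        r * count badZone                       ≤⟨ *-monoʳ-≤ r (count-mono λ w u eq → proj₁ (∧-true eq)) ⟩
        r * count (zone t t′ live)              ≤⟨ *-monoˡ-≤ (count (zone t t′ live)) (m≤m*n r (r * r) {{>-nonZero (*-mono-≤ 0<r 0<r)}}) ⟩
        r * (r * r) * count (zone t t′ live)    ≤⟨ small ⟩
        0                                       ≤⟨ z≤n ⟩
        n * n                                   ∎) many
      where
      open Step t t′ live
      open ≤-Reasoning
    refine (suc j) {m} t t′ live fits small | no many = record
      { parts = parts rest ; parts≤ = parts≤ rest ; t = RegularPartition.t rest ; t′ = RegularPartition.t′ rest
      ; live = RegularPartition.live rest ; regular = regular rest
      ; dead = ≤-trans (dead rest) (+-monoˡ-≤ (c * (n * n)) (*-monoʳ-≤ r (begin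
          c * count (B ∖ zone t₊ t′₊ live₊) + j * (M * M * (n * n))
            ≤⟨ +-monoˡ-≤ (j * (M * M * (n * n))) (*-monoʳ-≤ c (count-+ λ w u →
                 subst (λ z → ⟦ B w u ∧ not z ⟧ ≤ ⟦ (B ∖ zone t t′ live) w u ⟧ + ⟦ (B ⊓ᵣ hole) w u ⟧) (sym (zone₊ w u)) (cases (B w u) (live (t w) (t′ u)) (hole w u)))) ⟩
          c * (count (B ∖ zone t t′ live) + count (B ⊓ᵣ hole)) + j * (M * M * (n * n))
            ≡⟨ cong (_+ j * (M * M * (n * n))) (*-distribˡ-+ c (count (B ∖ zone t t′ live)) (count (B ⊓ᵣ hole))) ⟩
          c * count (B ∖ zone t t′ live) + c * count (B ⊓ᵣ hole) + j * (M * M * (n * n))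
            ≤⟨ +-monoˡ-≤ (j * (M * M * (n * n))) (+-monoʳ-≤ (c * count (B ∖ zone t t′ live)) (≤-trans hole-sparse m²≤M²)) ⟩
          c * count (B ∖ zone t t′ live) + M * M * (n * n) + j * (M * M * (n * n))
            ≡⟨ +-assoc (c * count (B ∖ zone t t′ live)) (M * M * (n * n)) _ ⟩
          c * count (B ∖ zone t t′ live) + suc j * (M * M * (n * n)) ∎))) }
      where
      open Step t t′ live
      open ≤-Reasoning
      cases : ∀ b l h → ⟦ b ∧ not (l ∧ not h) ⟧ ≤ ⟦ b ∧ not l ⟧ + ⟦ b ∧ h ⟧
      cases false l     h     = z≤n
      cases true  false h     = s≤s z≤n
      cases true  true  true  = s≤s z≤n
      cases true  true  false = z≤n
      m≤M : m ≤ M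
      m≤M = ≤-trans (m≤partBound (suc j) m) fits
      m²≤M² : m * (m * (n * n)) ≤ M * M * (n * n)
      m²≤M² = ≤-trans (≤-reflexive (sym (*-assoc m m (n * n)))) (*-monoˡ-≤ (n * n) (*-mono-≤ m≤M m≤M))
      hole⊆zone : ∀ w u → ⟦ (zone t t′ live ⊓ᵣ hole) w u ⟧ ≡ ⟦ hole w u ⟧
      hole⊆zone w u = absorb (live (t w) (t′ u)) (bad (t w) (t′ u)) (X (t w) (t′ u) w ∧ Y (t w) (t′ u) u)
        where
        absorb : ∀ a b c → ⟦ a ∧ ((a ∧ b) ∧ c) ⟧ ≡ ⟦ (a ∧ b) ∧ c ⟧
        absorb true  b c = refl
        absorb false b c = refl
      r³ : ∀ r h → r * (r * r * h) ≡ r * (r * r) * h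
      r³ = solve-∀
      small₊ : r * (r * r) * count (zone t₊ t′₊ live₊) ≤ j * (n * n)
      small₊ = +-cancelˡ-≤ (n * n) _ _ (begin
        n * n + r * (r * r) * count (zone t₊ t′₊ live₊)
          ≤⟨ +-monoˡ-≤ _ (<⇒≤ (≰⇒> many)) ⟩
        r * count badZone + r * (r * r) * count (zone t₊ t′₊ live₊)
          ≤⟨ +-monoˡ-≤ _ (*-monoʳ-≤ r badZone≤hole) ⟩
        r * (r * r * count hole) + r * (r * r) * count (zone t₊ t′₊ live₊)
          ≡⟨ cong₂ _+_ (r³ r (count hole)) (cong (r * (r * r) *_) (∑-cong₂ λ w u → cong ⟦_⟧ (zone₊ w u))) ⟩
        r * (r * r) * count hole + r * (r * r) * count (zone t t′ live ∖ hole)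
          ≡⟨ trans (+-comm (r * (r * r) * count hole) _) (sym (*-distribˡ-+ (r * (r * r)) (count (zone t t′ live ∖ hole)) (count hole))) ⟩
        r * (r * r) * (count (zone t t′ live ∖ hole) + count hole)
          ≡⟨ cong (r * (r * r) *_) (trans (cong (count (zone t t′ live ∖ hole) +_) (sym (∑-cong₂ hole⊆zone))) (sym (count-split (zone t t′ live) hole))) ⟩
        r * (r * r) * count (zone t t′ live)
          ≤⟨ small ⟩
        n * n + j * (n * n) ∎)
      rest : RegularPartition B r c M (c * count (B ∖ zone t₊ t′₊ live₊) + j * (M * M * (n * n)))
      rest = refine j t₊ t′₊ live₊ fits small₊

  -- Removal in the dense graphs

  some : (Fin m → Bool) → Bool
  some f = does (1 ≤? size f)

  ⟦some⟧≤ : (f : Fin m → Bool) → ⟦ some f ⟧ ≤ size f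
  ⟦some⟧≤ f = go (1 ≤? size f)
    where
    go : (d : Dec (1 ≤ size f)) → ⟦ does d ⟧ ≤ size f
    go (yes p) = p
    go (no _)  = z≤n

  some-intro : (f : Fin m → Bool) (p : Fin m) → f p ≡ true → some f ≡ true
  some-intro f p eq = ⇒does (1 ≤? size f) (≤-trans (≤-reflexive (sym (cong ⟦_⟧ eq))) (term≤∑ (λ q → ⟦ f q ⟧) p))

  some-none : (f : Fin m → Bool) → some f ≡ false → ∀ p → f p ≡ false
  some-none f eq p with f p in fp
  ... | false = refl
  ... | true  with () ← trans (sym (some-intro f p fp)) eq

  ⟦∨⟧≤ : ∀ a b → ⟦ a ∨ b ⟧ ≤ ⟦ a ⟧ + ⟦ b ⟧
  ⟦∨⟧≤ true  b = s≤s z≤n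
  ⟦∨⟧≤ false b = ≤-refl

  module Arm {n m : ℕ} (Γ₁ Γ₂ : Rel n) (t : Fin n → Fin m) (r b : ℕ) where
    good : Fin n → Fin m → Bool
    good x p = does (size (fibre t p) ≤? r * deg Γ₂ (fibre t p) x)

    ok : Fin n → Fin m → Bool
    ok v p = does (n ≤? b * deg Γ₁ (λ x → good x p) v)

    thin : Rel n
    thin x w = not (good x (t w))

    blocked : Sub n → Rel n
    blocked del v x = some (λ p → good x p ∧ not (ok v p)) ∨ del v

    thin-columns : ColumnTypes m thin
    thin-columns .type = t
    thin-columns .column p x = not (good x p)
    thin-columns .column-eq x w = refl

    blocked-columns : (del : Sub n) → ColumnTypes (2 ^ m) (blocked del)
    blocked-columns del .type x = funToFin λ p → bit (good x p)
    blocked-columns del .column i v = some (λ p → isOne (finToFun {2} {m} i p) ∧ not (ok v p)) ∨ del v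
    blocked-columns del .column-eq v x = cong (λ k → does (1 ≤? k) ∨ del v) (size-cong λ p →
      cong (_∧ not (ok v p)) (sym (trans (cong isOne (finToFun-funToFin (λ p → bit (good x p)) p)) (isOne-bit (good x p)))))

    thin-sparse : r * count (Γ₂ ⊓ᵣ thin) ≤ n * n
    thin-sparse = begin
      r * count (Γ₂ ⊓ᵣ thin)
        ≡⟨ cong (r *_) (⊓-by-columns thin-columns Γ₂) ⟩
      r * ∑ (λ p → ∑ λ x → ⟦ not (good x p) ⟧ * deg Γ₂ (fibre t p) x)
        ≡⟨ trans (*-∑ r _) (∑-cong λ p → *-∑ r _) ⟩
      ∑ (λ p → ∑ λ x → r * (⟦ not (good x p) ⟧ * deg Γ₂ (fibre t p) x))
        ≤⟨ ∑-mono (λ p → ∑-bound (size (fibre t p)) λ x → pointwise p x) ⟩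
      ∑ (λ p → n * size (fibre t p))
        ≡⟨ *-∑ n _ ⟨
      n * ∑ (λ p → size (fibre t p))
        ≡⟨ cong (n *_) (∑-fibre-size t) ⟩
      n * n ∎
      where
      open ≤-Reasoning
      pull : ∀ a b c → a * (b * c) ≡ b * (a * c)
      pull = solve-∀
      pointwise : ∀ p x → r * (⟦ not (good x p) ⟧ * deg Γ₂ (fibre t p) x) ≤ size (fibre t p)
      pointwise p x = ≤-trans (≤-reflexive (pull r ⟦ not (good x p) ⟧ _)) (⟦⟧*-≤ (not (good x p)) λ eq →
        <⇒≤ (≰⇒> (does-false⇒ (size (fibre t p) ≤? r * deg Γ₂ (fibre t p) x) (not-true eq))))

    blocked-sparse : (del : Sub n) → b * count (Γ₁ ⊓ᵣ blocked del) ≤ m * (n * n) + b * size del * n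
    blocked-sparse del = begin
      b * count (Γ₁ ⊓ᵣ blocked del)
        ≤⟨ *-monoʳ-≤ b (∑-mono₂ pointwise) ⟩
      b * ∑ (λ v → ∑ λ x → ∑ (λ p → ⟦ not (ok v p) ⟧ * (⟦ good x p ⟧ * ⟦ Γ₁ v x ⟧)) + ⟦ del v ⟧)
        ≡⟨ cong (b *_) (∑∑-+ _ _) ⟩
      b * (∑ (λ v → ∑ λ x → ∑ λ p → ⟦ not (ok v p) ⟧ * (⟦ good x p ⟧ * ⟦ Γ₁ v x ⟧)) + ∑ (λ v → ∑ {n} λ x → ⟦ del v ⟧))
        ≡⟨ cong (b *_) (cong₂ _+_ (∑-cong λ v → trans (∑-comm _) (∑-cong λ p → sym (*-∑ ⟦ not (ok v p) ⟧ _)))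
                                  (trans (∑-cong λ v → ∑-const n ⟦ del v ⟧) (sym (*-∑ n _)))) ⟩
      b * (∑ (λ v → ∑ λ p → ⟦ not (ok v p) ⟧ * deg Γ₁ (λ x → good x p) v) + n * size del)
        ≡⟨ *-distribˡ-+ b _ (n * size del) ⟩
      b * ∑ (λ v → ∑ λ p → ⟦ not (ok v p) ⟧ * deg Γ₁ (λ x → good x p) v) + b * (n * size del)
        ≡⟨ cong₂ _+_ (trans (*-∑ b _) (∑-cong λ v → *-∑ b _)) (rot b n (size del)) ⟩
      ∑ (λ v → ∑ λ p → b * (⟦ not (ok v p) ⟧ * deg Γ₁ (λ x → good x p) v)) + b * size del * n
        ≤⟨ +-monoˡ-≤ (b * size del * n) (∑-bound (m * n) λ v → ∑-bound n λ p → few v p) ⟩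
      n * (m * n) + b * size del * n
        ≡⟨ cong (_+ b * size del * n) (pull n m n) ⟩
      m * (n * n) + b * size del * n ∎
      where
      open ≤-Reasoning
      pull : ∀ a b c → a * (b * c) ≡ b * (a * c)
      pull = solve-∀
      rot : ∀ b n d → b * (n * d) ≡ b * d * n
      rot = solve-∀
      few : ∀ v p → b * (⟦ not (ok v p) ⟧ * deg Γ₁ (λ x → good x p) v) ≤ n
      few v p = ≤-trans (≤-reflexive (pull b ⟦ not (ok v p) ⟧ _)) (⟦⟧*-≤ (not (ok v p)) λ eq →
        <⇒≤ (≰⇒> (does-false⇒ (n ≤? b * deg Γ₁ (λ x → good x p) v) (not-true eq))))
      product : ∀ a b c → c ≡ true → ⟦ a ∧ not b ⟧ ≡ ⟦ not b ⟧ * (⟦ a ⟧ * ⟦ c ⟧)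
      product true  true  c eq   = refl
      product true  false _ refl = refl
      product false true  c eq   = refl
      product false false c eq   = refl
      pointwise : ∀ v x → ⟦ Γ₁ v x ∧ blocked del v x ⟧ ≤
                  ∑ (λ p → ⟦ not (ok v p) ⟧ * (⟦ good x p ⟧ * ⟦ Γ₁ v x ⟧)) + ⟦ del v ⟧
      pointwise v x = go (Γ₁ v x) refl
        where
        go : ∀ g → Γ₁ v x ≡ g → ⟦ g ∧ blocked del v x ⟧ ≤
             ∑ (λ p → ⟦ not (ok v p) ⟧ * (⟦ good x p ⟧ * ⟦ Γ₁ v x ⟧)) + ⟦ del v ⟧
        go false eq = z≤n
        go true  eq = begin
          ⟦ blocked del v x ⟧                                    ≤⟨ ⟦∨⟧≤ (some λ p → good x p ∧ not (ok v p)) (del v) ⟩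
          ⟦ some (λ p → good x p ∧ not (ok v p)) ⟧ + ⟦ del v ⟧    ≤⟨ +-monoˡ-≤ ⟦ del v ⟧ (⟦some⟧≤ _) ⟩
          size (λ p → good x p ∧ not (ok v p)) + ⟦ del v ⟧
            ≡⟨ cong (_+ ⟦ del v ⟧) (∑-cong λ p → product (good x p) (ok v p) (Γ₁ v x) eq) ⟩
          ∑ (λ p → ⟦ not (ok v p) ⟧ * (⟦ good x p ⟧ * ⟦ Γ₁ v x ⟧)) + ⟦ del v ⟧ ∎

    kept-good : ∀ x w → thin x w ≡ false → good x (t w) ≡ true
    kept-good x w = not-false

    kept-ok : ∀ del v x p → blocked del v x ≡ false → good x p ≡ true → ok v p ≡ true
    kept-ok del v x p kept g = not-false (∧-falseʳ g (some-none (λ p → good x p ∧ not (ok v p)) (proj₁ (∨-false kept)) p))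

    kept-undeleted : ∀ del v x → blocked del v x ≡ false → del v ≡ false
    kept-undeleted del v x kept = proj₂ (∨-false {some (λ p → good x p ∧ not (ok v p))} kept)

  ∑-swap-pairs : {k l : ℕ} (F : Fin k → Fin n → Fin l → Fin m → ℕ) →
    ∑ (λ w → ∑ λ u → ∑ λ x → ∑ λ y → F w u x y) ≡ ∑ (λ x → ∑ λ y → ∑ λ w → ∑ λ u → F w u x y)
  ∑-swap-pairs F = begin
    ∑ (λ w → ∑ λ u → ∑ λ x → ∑ λ y → F w u x y) ≡⟨ ∑-cong (λ w → trans (∑-comm _) (∑-cong λ x → ∑-comm _)) ⟩
    ∑ (λ w → ∑ λ x → ∑ λ y → ∑ λ u → F w u x y) ≡⟨ trans (∑-comm _) (∑-cong λ x → ∑-comm _) ⟩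
    ∑ (λ x → ∑ λ y → ∑ λ w → ∑ λ u → F w u x y) ∎
    where open ≡-Reasoning

  pentagons-from-v : (Γ₁ Γ₂ E Λ₁ Λ₂ : Rel n) → pentagons Γ₁ Γ₂ E Λ₁ Λ₂ ≡
    ∑ λ v → ∑ λ x → ∑ λ y → ⟦ Γ₁ v x ⟧ * ⟦ Λ₁ v y ⟧ * edges E (Γ₂ x) (Λ₂ y)
  pentagons-from-v Γ₁ Γ₂ E Λ₁ Λ₂ = ∑-cong λ v → begin
    ∑ (λ w → ∑ λ u → walks Γ₁ Γ₂ v w * (⟦ E w u ⟧ * walks Λ₁ Λ₂ v u))
      ≡⟨ ∑-cong₂ (λ w u → trans (cong (walks Γ₁ Γ₂ v w *_) (*-∑ ⟦ E w u ⟧ _)) (∑*∑ _ _)) ⟩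
    ∑ (λ w → ∑ λ u → ∑ λ x → ∑ λ y → ⟦ Γ₁ v x ⟧ * ⟦ Γ₂ x w ⟧ * (⟦ E w u ⟧ * (⟦ Λ₁ v y ⟧ * ⟦ Λ₂ y u ⟧)))
      ≡⟨ ∑-swap-pairs _ ⟩
    ∑ (λ x → ∑ λ y → ∑ λ w → ∑ λ u → ⟦ Γ₁ v x ⟧ * ⟦ Γ₂ x w ⟧ * (⟦ E w u ⟧ * (⟦ Λ₁ v y ⟧ * ⟦ Λ₂ y u ⟧)))
      ≡⟨ ∑-cong₂ (λ x y → trans (∑-cong₂ λ w u → ring ⟦ Γ₁ v x ⟧ ⟦ Γ₂ x w ⟧ ⟦ E w u ⟧ ⟦ Λ₁ v y ⟧ ⟦ Λ₂ y u ⟧)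
           (sym (trans (cong (⟦ Γ₁ v x ⟧ * ⟦ Λ₁ v y ⟧ *_) (edges≡∑∑ E (Γ₂ x) (Λ₂ y)))
                       (trans (*-∑ (⟦ Γ₁ v x ⟧ * ⟦ Λ₁ v y ⟧) _) (∑-cong λ w → *-∑ (⟦ Γ₁ v x ⟧ * ⟦ Λ₁ v y ⟧) _))))) ⟩
    ∑ (λ x → ∑ λ y → ⟦ Γ₁ v x ⟧ * ⟦ Λ₁ v y ⟧ * edges E (Γ₂ x) (Λ₂ y)) ∎
    where
    open ≡-Reasoning
    ring : ∀ a b c d e → a * b * (c * (d * e)) ≡ a * d * (b * (e * c))
    ring = solve-∀

  edges-mono : (E : Rel n) {X X′ Y Y′ : Sub n} → (∀ x → X x ≡ true → X′ x ≡ true) → (∀ y → Y y ≡ true → Y′ y ≡ true) →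
               edges E X Y ≤ edges E X′ Y′
  edges-mono E X⊆ Y⊆ = ∑-mono λ x → *-mono-≤ (⟦⟧-mono (X⊆ x)) (∑-mono λ y → *-monoˡ-≤ ⟦ E x y ⟧ (⟦⟧-mono (Y⊆ y)))

  deg≡size : (B : Rel n) (Y : Sub n) (x : Fin n) → deg B Y x ≡ size (B x ∩ Y)
  deg≡size B Y x = ∑-cong λ y → trans (*-comm ⟦ Y y ⟧ ⟦ B x y ⟧) (sym (⟦∧⟧ (B x y) (Y y)))

  record Cleaning (Γ₁ Γ₂ E Λ₁ Λ₂ : Rel n) (r M : ℕ) : Set where
    field
      D₁ D₂ D₃ D₄ D₅ : Rel n
      k₁ k₂ k₃ k₄ k₅ : ℕ
      columns₁ : ColumnTypes k₁ D₁
      columns₂ : ColumnTypes k₂ D₂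
      columns₃ : ColumnTypes k₃ D₃
      columns₄ : ColumnTypes k₄ D₄
      columns₅ : ColumnTypes k₅ D₅
      k₁≤ : k₁ ≤ 2 ^ M
      k₂≤ : k₂ ≤ 2 ^ M
      k₃≤ : k₃ ≤ 2 ^ M
      k₄≤ : k₄ ≤ 2 ^ M
      k₅≤ : k₅ ≤ 2 ^ M
      sparse₁ : r * count (Γ₁ ⊓ᵣ D₁) ≤ 2 * (n * n)
      sparse₂ : r * count (Γ₂ ⊓ᵣ D₂) ≤ 2 * (n * n)
      sparse₃ : r * count (E ⊓ᵣ D₃) ≤ 2 * (n * n)
      sparse₄ : r * count (Λ₁ ⊓ᵣ D₄) ≤ 2 * (n * n)
      sparse₅ : r * count (Λ₂ ⊓ᵣ D₅) ≤ 2 * (n * n)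
      pentagon-free : ∀ v x w u y → D₁ v x ≡ false → D₂ x w ≡ false → D₃ w u ≡ false →
                      D₄ v y ≡ false → D₅ y u ≡ false → ⊥

  module Clean {n : ℕ} (Γ₁ Γ₂ E Λ₁ Λ₂ : Rel n) (r c M j : ℕ) (0<n : 0 < n) (0<c : 0 < c) (0<M : 0 < M)
    (c≡ : c ≡ r * (j * (M * M))) (R : RegularPartition E r c M (j * (M * M * (n * n))))
    (b κ : ℕ) (b≡ : b ≡ r * (M * M)) (κ≡ : κ ≡ c * (b * (b * b)))
    (few : ¬ (n * (n * (n * (n * n))) ≤ κ * pentagons Γ₁ Γ₂ E Λ₁ Λ₂)) where
    open RegularPartition R
    module A = Arm Γ₁ Γ₂ t r b
    module B = Arm Λ₁ Λ₂ t′ r b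

    both : Fin parts → Fin parts → Sub n
    both p q v = A.ok v p ∧ B.ok v q

    many-pentagons : ∀ p q → live p q ≡ true → n ≤ b * size (both p q) →
                     n * (n * (n * (n * n))) ≤ c * (b * (b * b)) * pentagons Γ₁ Γ₂ E Λ₁ Λ₂
    many-pentagons p q alive large = begin
      n * (n * (n * (n * n)))
        ≤⟨ *-monoˡ-≤ (n * (n * (n * n))) large ⟩
      b * size (both p q) * (n * (n * (n * n)))
        ≡⟨ trans (*-assoc b _ _) (cong (b *_) (∑-* _ (n * (n * (n * n))))) ⟩
      b * ∑ (λ v → ⟦ both p q v ⟧ * (n * (n * (n * n))))
        ≤⟨ *-monoʳ-≤ b (∑-mono λ v → ⟦⟧*-≤ (both p q v) (perVertex v)) ⟩
      b * ∑ (λ v → c * (b * b) * ∑ λ x → ∑ λ y → T v x y)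
        ≡⟨ cong (b *_) (sym (*-∑ (c * (b * b)) _)) ⟩
      b * (c * (b * b) * ∑ (λ v → ∑ λ x → ∑ λ y → T v x y))
        ≡⟨ ring₁ b c _ ⟩
      c * (b * (b * b)) * ∑ (λ v → ∑ λ x → ∑ λ y → T v x y)
        ≡⟨ cong (c * (b * (b * b)) *_) (sym (pentagons-from-v Γ₁ Γ₂ E Λ₁ Λ₂)) ⟩
      c * (b * (b * b)) * pentagons Γ₁ Γ₂ E Λ₁ Λ₂ ∎
      where
      open ≤-Reasoning
      T : Fin n → Fin n → Fin n → ℕ
      T v x y = ⟦ Γ₁ v x ⟧ * ⟦ Λ₁ v y ⟧ * edges E (Γ₂ x) (Λ₂ y)
      ring₁ : ∀ b c z → b * (c * (b * b) * z) ≡ c * (b * (b * b)) * z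
      ring₁ = solve-∀
      ring₂ : ∀ b a a′ n → b * a * (b * a′ * (n * n)) ≡ b * b * (n * n * (a * a′))
      ring₂ = solve-∀
      ring₃ : ∀ N g h g′ h′ → N * ((g * h) * (g′ * h′)) ≡ g * (g′ * (h * h′ * N))
      ring₃ = solve-∀
      ring₄ : ∀ h c e → h * (c * e) ≡ c * (h * e)
      ring₄ = solve-∀
      many-edges : ∀ x y → A.good x p ≡ true → B.good y q ≡ true → n * n ≤ c * edges E (Γ₂ x) (Λ₂ y)
      many-edges x y gx gy = ≤-trans
        (regular p q alive (Γ₂ x) (Λ₂ y)
          (subst (λ z → size (fibre t p) ≤ r * z) (deg≡size Γ₂ (fibre t p) x) (does⇒ (size (fibre t p) ≤? r * deg Γ₂ (fibre t p) x) gx))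
          (subst (λ z → size (fibre t′ q) ≤ r * z) (deg≡size Λ₂ (fibre t′ q) y) (does⇒ (size (fibre t′ q) ≤? r * deg Λ₂ (fibre t′ q) y) gy)))
        (*-monoʳ-≤ c (edges-mono E {Γ₂ x ∩ fibre t p} {Γ₂ x} {Λ₂ y ∩ fibre t′ q} {Λ₂ y} (λ w eq → proj₁ (∧-true eq)) (λ u eq → proj₁ (∧-true eq))))
      perVertex : ∀ v → both p q v ≡ true → n * (n * (n * n)) ≤ c * (b * b) * ∑ λ x → ∑ λ y → T v x y
      perVertex v eq = begin
        n * (n * (n * n))
          ≤⟨ *-mono-≤ (does⇒ (n ≤? b * deg Γ₁ (λ x → A.good x p) v) (proj₁ (∧-true eq)))
                      (*-monoˡ-≤ (n * n) (does⇒ (n ≤? b * deg Λ₁ (λ y → B.good y q) v) (proj₂ (∧-true {A.ok v p} eq)))) ⟩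
        b * deg Γ₁ (λ x → A.good x p) v * (b * deg Λ₁ (λ y → B.good y q) v * (n * n))
          ≡⟨ ring₂ b _ _ n ⟩
        b * b * (n * n * (deg Γ₁ (λ x → A.good x p) v * deg Λ₁ (λ y → B.good y q) v))
          ≡⟨ cong (λ z → b * b * (n * n * z)) (∑*∑ _ _) ⟩
        b * b * (n * n * ∑ (λ x → ∑ λ y → (⟦ A.good x p ⟧ * ⟦ Γ₁ v x ⟧) * (⟦ B.good y q ⟧ * ⟦ Λ₁ v y ⟧)))
          ≡⟨ cong (b * b *_) (trans (*-∑ (n * n) _) (∑-cong λ x → *-∑ (n * n) _)) ⟩
        b * b * ∑ (λ x → ∑ λ y → n * n * ((⟦ A.good x p ⟧ * ⟦ Γ₁ v x ⟧) * (⟦ B.good y q ⟧ * ⟦ Λ₁ v y ⟧)))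
          ≤⟨ *-monoʳ-≤ (b * b) (∑-mono₂ λ x y → ≤-trans
               (≤-reflexive (ring₃ (n * n) ⟦ A.good x p ⟧ ⟦ Γ₁ v x ⟧ ⟦ B.good y q ⟧ ⟦ Λ₁ v y ⟧))
               (⟦⟧*-≤ (A.good x p) λ gx → ⟦⟧*-≤ (B.good y q) λ gy →
                 ≤-trans (*-monoʳ-≤ (⟦ Γ₁ v x ⟧ * ⟦ Λ₁ v y ⟧) (many-edges x y gx gy))
                         (≤-reflexive (ring₄ (⟦ Γ₁ v x ⟧ * ⟦ Λ₁ v y ⟧) c _)))) ⟩
        b * b * ∑ (λ x → ∑ λ y → c * T v x y)
          ≡⟨ cong (b * b *_) (sym (trans (*-∑ c _) (∑-cong λ x → *-∑ c _))) ⟩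
        b * b * (c * ∑ (λ x → ∑ λ y → T v x y))
          ≡⟨ trans (sym (*-assoc (b * b) c _)) (cong (_* ∑ (λ x → ∑ λ y → T v x y)) (*-comm (b * b) c)) ⟩
        c * (b * b) * ∑ (λ x → ∑ λ y → T v x y) ∎

    del : Sub n
    del v = some λ p → some λ q → live p q ∧ both p q v

    del-small : b * size del ≤ M * M * n
    del-small = begin
      b * size del
        ≤⟨ *-monoʳ-≤ b (∑-mono λ v → ≤-trans (⟦some⟧≤ _) (∑-mono λ p → ≤-trans (⟦some⟧≤ _) (∑-mono λ q → ≤-reflexive (⟦∧⟧ (live p q) _)))) ⟩
      b * ∑ (λ v → ∑ λ p → ∑ λ q → ⟦ live p q ⟧ * ⟦ both p q v ⟧)
        ≡⟨ cong (b *_) (trans (∑-comm _) (∑-cong λ p → trans (∑-comm _) (∑-cong λ q → sym (*-∑ ⟦ live p q ⟧ _)))) ⟩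
      b * ∑ (λ p → ∑ λ q → ⟦ live p q ⟧ * size (both p q))
        ≡⟨ trans (*-∑ b _) (∑-cong λ p → *-∑ b _) ⟩
      ∑ (λ p → ∑ λ q → b * (⟦ live p q ⟧ * size (both p q)))
        ≤⟨ ∑-bound (parts * n) (λ p → ∑-bound n λ q → perPair p q) ⟩
      parts * (parts * n)
        ≡⟨ *-assoc parts parts n ⟨
      parts * parts * n
        ≤⟨ *-monoˡ-≤ n (*-mono-≤ parts≤ parts≤) ⟩
      M * M * n ∎
      where
      open ≤-Reasoning
      pull : ∀ a b c → a * (b * c) ≡ b * (a * c)
      pull = solve-∀
      perPair : ∀ p q → b * (⟦ live p q ⟧ * size (both p q)) ≤ n
      perPair p q = ≤-trans (≤-reflexive (pull b ⟦ live p q ⟧ _)) (⟦⟧*-≤ (live p q) λ alive →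
        <⇒≤ (≰⇒> λ large → few (subst (λ z → n * (n * (n * (n * n))) ≤ z * pentagons Γ₁ Γ₂ E Λ₁ Λ₂) (sym κ≡) (many-pentagons p q alive large))))

    cancel-M² : ∀ z → b * z ≤ 2 * (M * M * (n * n)) → r * z ≤ 2 * (n * n)
    cancel-M² z h = *-cancelˡ-≤ (M * M) {{>-nonZero (*-mono-≤ 0<M 0<M)}} (begin
      M * M * (r * z)             ≡⟨ trans (ring₁ (M * M) r z) (cong (_* z) (sym b≡)) ⟩
      b * z                       ≤⟨ h ⟩
      2 * (M * M * (n * n))       ≡⟨ ring₂ (M * M) (n * n) ⟩
      M * M * (2 * (n * n))       ∎)
      where
      open ≤-Reasoning
      ring₁ : ∀ a r z → a * (r * z) ≡ r * a * z
      ring₁ = solve-∀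
      ring₂ : ∀ a z → 2 * (a * z) ≡ a * (2 * z)
      ring₂ = solve-∀

    parts≤M² : parts ≤ M * M
    parts≤M² = ≤-trans parts≤ (m≤m*n M M {{>-nonZero 0<M}})

    blocked-bound : ∀ {z d} → b * z ≤ parts * (n * n) + b * d * n → b * d ≤ M * M * n → r * z ≤ 2 * (n * n)
    blocked-bound {z} {d} h small = cancel-M² z (begin
      b * z                                  ≤⟨ h ⟩
      parts * (n * n) + b * d * n            ≤⟨ +-mono-≤ (*-monoˡ-≤ (n * n) parts≤M²) (*-monoˡ-≤ n small) ⟩
      M * M * (n * n) + M * M * n * n        ≡⟨ ring (M * M) n ⟩
      2 * (M * M * (n * n))                  ∎)
      where
      open ≤-Reasoning
      ring : ∀ a n → a * (n * n) + a * n * n ≡ 2 * (a * (n * n))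
      ring = solve-∀

    dead-zone : Rel n
    dead-zone w u = not (live (t w) (t′ u))

    dead-columns : ColumnTypes parts dead-zone
    dead-columns .type = t′
    dead-columns .column q w = not (live (t w) q)
    dead-columns .column-eq w u = refl

    dead-sparse : r * count (E ⊓ᵣ dead-zone) ≤ 2 * (n * n)
    dead-sparse = *-cancelˡ-≤ c {{>-nonZero 0<c}} (begin
      c * (r * count (E ∖ zone t t′ live))           ≡⟨ ring₁ c r _ ⟩
      r * (c * count (E ∖ zone t t′ live))           ≤⟨ dead ⟩
      r * (j * (M * M * (n * n))) + c * (n * n)      ≡⟨ cong (_+ c * (n * n)) (ring₂ r j (M * M) (n * n)) ⟩
      r * (j * (M * M)) * (n * n) + c * (n * n)      ≡⟨ cong (λ z → z * (n * n) + c * (n * n)) (sym c≡) ⟩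
      c * (n * n) + c * (n * n)                      ≡⟨ ring₃ c (n * n) ⟩
      c * (2 * (n * n))                              ∎)
      where
      open ≤-Reasoning
      ring₁ : ∀ c r z → c * (r * z) ≡ r * (c * z)
      ring₁ = solve-∀
      ring₂ : ∀ r j a z → r * (j * (a * z)) ≡ r * (j * a) * z
      ring₂ = solve-∀
      ring₃ : ∀ c z → c * z + c * z ≡ c * (2 * z)
      ring₃ = solve-∀

    parts≤2^M : parts ≤ 2 ^ M
    parts≤2^M = ≤-trans parts≤ (<⇒≤ (n<2^n M))
      where
      n<2^n : ∀ k → k < 2 ^ k
      n<2^n zero    = s≤s z≤n
      n<2^n (suc k) = ≤-trans (+-mono-≤ (s≤s (z≤n {k})) (n<2^n k))
        (≤-trans (+-monoˡ-≤ (2 ^ k) (n<2^n k)) (≤-reflexive (cong (2 ^ k +_) (sym (+-identityʳ (2 ^ k))))))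

    2^parts≤2^M : 2 ^ parts ≤ 2 ^ M
    2^parts≤2^M = ^-monoʳ-≤ 2 parts≤

    size-none : size {n} (const false) ≡ 0
    size-none = trans (∑-const n 0) (*-zeroʳ n)

    free : ∀ v x w u y → A.blocked del v x ≡ false → A.thin x w ≡ false → dead-zone w u ≡ false →
           B.blocked (const false) v y ≡ false → B.thin y u ≡ false → ⊥
    free v x w u y b₁ b₂ b₃ b₄ b₅ = absurd (trans (sym hit) (A.kept-undeleted del v x b₁))
      where
      absurd : true ≡ false → ⊥
      absurd ()
      p q : Fin parts
      p = t w
      q = t′ u
      hit : del v ≡ true
      hit = some-intro _ p (some-intro _ q (∧-intro (not-false b₃)
        (∧-intro (A.kept-ok del v x p b₁ (A.kept-good x w b₂))
                 (B.kept-ok (const false) v y q b₄ (B.kept-good y u b₅)))))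

    cleaning : Cleaning Γ₁ Γ₂ E Λ₁ Λ₂ r M
    cleaning = record
      { D₁ = A.blocked del ; D₂ = A.thin ; D₃ = dead-zone ; D₄ = B.blocked (const false) ; D₅ = B.thin
      ; columns₁ = A.blocked-columns del ; columns₂ = A.thin-columns ; columns₃ = dead-columns
      ; columns₄ = B.blocked-columns (const false) ; columns₅ = B.thin-columns
      ; k₁≤ = 2^parts≤2^M ; k₂≤ = parts≤2^M ; k₃≤ = parts≤2^M ; k₄≤ = 2^parts≤2^M ; k₅≤ = parts≤2^M
      ; sparse₁ = blocked-bound (A.blocked-sparse del) del-small
      ; sparse₂ = ≤-trans A.thin-sparse (m≤m+n (n * n) _)
      ; sparse₃ = dead-sparse
      ; sparse₄ = blocked-bound (B.blocked-sparse (const false))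
          (≤-trans (≤-reflexive (trans (cong (b *_) size-none) (*-zeroʳ b))) z≤n)
      ; sparse₅ = ≤-trans B.thin-sparse (m≤m+n (n * n) _)
      ; pentagon-free = free }

  -- Choice of constants and the removal in the sparse graph

  integerSqrt : ∀ n → ∃ λ s → s * s ≤ n × n < suc s * suc s
  integerSqrt zero = 0 , z≤n , s≤s z≤n
  integerSqrt (suc n) with integerSqrt n
  ... | s , s²≤n , n<s₊² with suc s * suc s ≤? suc n
  ...   | yes s₊²≤ = suc s , s₊²≤ , ≤-<-trans n<s₊² (*-mono-< (n<1+n (suc s)) (n<1+n (suc s)))
  ...   | no s₊²≰  = s , m≤n⇒m≤1+n s²≤n , ≰⇒> s₊²≰

  sqrt-bounds : ∀ n → 0 < n → ∃ λ s → 0 < s × s * s ≤ n × n ≤ 4 * (s * s)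
  sqrt-bounds n 0<n with integerSqrt n
  ... | zero  , _    , n<1  = contradiction n<1 (≤⇒≯ 0<n)
  ... | suc s , s²≤n , n<s₊² = suc s , s≤s z≤n , s²≤n , (begin
    n                              ≤⟨ <⇒≤ n<s₊² ⟩
    suc (suc s) * suc (suc s)      ≤⟨ *-mono-≤ double double ⟩
    2 * suc s * (2 * suc s)        ≡⟨ ring (suc s) ⟩
    4 * (suc s * suc s)            ∎)
    where
    open ≤-Reasoning
    double : suc (suc s) ≤ 2 * suc s
    double = ≤-trans (+-monoʳ-≤ 1 (m≤n+m (suc s) s)) (≤-reflexive (cong (λ z → suc (s + z)) (sym (+-identityʳ (suc s)))))
    ring : ∀ s → 2 * s * (2 * s) ≡ 4 * (s * s)
    ring = solve-∀

  square-cancel-≤ : ∀ {a b} → a * a ≤ b * b → a ≤ b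
  square-cancel-≤ {a} {b} h = ≮⇒≥ λ b<a → <⇒≱ (*-mono-< b<a b<a) h

  kept-sparse : {f D : Rel n} {a c k r s : ℕ} (ρ A M : ℕ) (C : Container f a c (n * s) 1 a 0) (cols : ColumnTypes k D) →
    c ≡ a * ρ → r ≡ 2 * (ρ * ρ) → 0 < a → 0 < n → 0 < s → 0 < ρ → n ≤ 4 * (s * s) → k ≤ 2 ^ M → 2 ^ a * 2 ^ M * (ρ * ρ) ≤ A →
    r * count (Γ C ⊓ᵣ D) ≤ 2 * (n * n) →
    A * A * count f ≤ n * n → A * A * fourCycles f ≤ n * n →
    ρ * count (f ∖ (Γ C ∖ D)) ≤ 8 * (n * s)
  kept-sparse {n} {f} {D} {a} {_} {k} {_} {s} ρ A M C cols refl refl 0<a 0<n 0<s 0<ρ n≤4s² k≤ ≤A thin few-e few-Q = begin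
    ρ * count (f ∖ (Γ C ∖ D))
      ≤⟨ *-monoʳ-≤ ρ (count-+ λ x y → cases (f x y) (Γ C x y) (D x y)) ⟩
    ρ * (count (f ∖ Γ C) + count (f ⊓ᵣ (Γ C ⊓ᵣ D)))
      ≡⟨ *-distribˡ-+ ρ (count (f ∖ Γ C)) _ ⟩
    ρ * count (f ∖ Γ C) + ρ * count (f ⊓ᵣ (Γ C ⊓ᵣ D))
      ≤⟨ +-mono-≤ few-lost (sparse-on ρ both 0<n 0<s 0<ρ n≤4s² thin′ (below few-e) (below few-Q)) ⟩
    n * s + 7 * (n * s) ∎
    where
    open ≤-Reasoning
    cases : ∀ f g d → ⟦ f ∧ not (g ∧ not d) ⟧ ≤ ⟦ f ∧ not g ⟧ + ⟦ f ∧ (g ∧ d) ⟧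
    cases false g     d     = z≤n
    cases true  false d     = s≤s z≤n
    cases true  true  true  = s≤s z≤n
    cases true  true  false = z≤n
    both : ColumnTypes (types C * k) (Γ C ⊓ᵣ D)
    both = combineColumns _∧_ (columns C) cols
    few-lost : ρ * count (f ∖ Γ C) ≤ n * s
    few-lost = *-cancelˡ-≤ a {{>-nonZero 0<a}} (≤-trans (≤-reflexive (sym (*-assoc a ρ _))) (lost C))
    thin′ : ρ * ρ * count (Γ C ⊓ᵣ D) ≤ n * n
    thin′ = *-cancelˡ-≤ 2 (≤-trans (≤-reflexive (sym (*-assoc 2 (ρ * ρ) _))) thin)
    A′≤A : types C * k * (ρ * ρ) ≤ A
    A′≤A = ≤-trans (*-monoˡ-≤ (ρ * ρ) (*-mono-≤ (≤-trans (types≤ C) (≤-reflexive (*-identityˡ (2 ^ a)))) k≤)) ≤A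
    below : ∀ {z} → A * A * z ≤ n * n → types C * k * (ρ * ρ) * (types C * k * (ρ * ρ)) * z ≤ n * n
    below {z} h = ≤-trans (*-monoˡ-≤ z (*-mono-≤ A′≤A A′≤A)) h

  -- The constants are chosen one after the other: Λ₁, Λ₂ have to be approximated more finely than Γ₁, Γ₂,
  -- and E more finely than all of them.  Their values are huge, so they are kept opaque.
  record Constants (k : ℕ) : Set where
    field
      ρ r J M c b κ κ₁ κ₂ κ₃ a₁ a₂ aΓ aΛ a₃ cΓ cΛ c₁ c₂ c₃ K′ A n₀ K : ℕ
      ρ≡  : ρ ≡ 40 * k
      r≡  : r ≡ 2 * (ρ * ρ)
      J≡  : J ≡ r * (r * r)
      M≡  : M ≡ partBound J 1
      c≡  : c ≡ r * (J * (M * M))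
      b≡  : b ≡ r * (M * M)
      κ≡  : κ ≡ c * (b * (b * b))
      κ₁≡ : κ₁ ≡ 2 * κ
      a₁≡ : a₁ ≡ 2 * κ₁
      aΓ≡ : aΓ ≡ suc (8 * ((a₁ * κ₁) * (a₁ * κ₁)))
      cΓ≡ : cΓ ≡ aΓ * ρ
      c₁≡ : c₁ ≡ 48 * (cΓ * cΓ) * (48 * (cΓ * cΓ))
      κ₂≡ : κ₂ ≡ 2 * κ₁ * c₁
      a₂≡ : a₂ ≡ 2 * κ₂
      aΛ≡ : aΛ ≡ suc (8 * ((a₂ * κ₁) * (a₂ * κ₁)))
      cΛ≡ : cΛ ≡ aΛ * ρ
      c₂≡ : c₂ ≡ 48 * (cΛ * cΛ) * (48 * (cΛ * cΛ))
      κ₃≡ : κ₃ ≡ 2 * κ₂ * c₂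
      a₃≡ : a₃ ≡ suc (2 * κ₃)
      c₃≡ : c₃ ≡ a₃ * ρ
      K′≡ : K′ ≡ 2 * κ₃ * c₃
      A≡  : A ≡ 2 ^ (aΓ + (aΛ + a₃)) * 2 ^ M * (ρ * ρ)
      n₀≡ : n₀ ≡ 3 * (A * A) * (3 * (A * A)) + (14 * (A * A) + 18 * K′)
      K≡  : K ≡ suc (n₀ * (n₀ * (n₀ * (n₀ * n₀))) + (16 * (A * A) + 40 * K′))

  opaque
    constants : ∀ k → Constants k
    constants k = record
      { ρ≡ = refl ; r≡ = refl ; J≡ = refl ; M≡ = refl ; c≡ = refl ; b≡ = refl ; κ≡ = refl ; κ₁≡ = refl ; a₁≡ = refl
      ; aΓ≡ = refl ; cΓ≡ = refl ; c₁≡ = refl ; κ₂≡ = refl ; a₂≡ = refl ; aΛ≡ = refl ; cΛ≡ = refl ; c₂≡ = refl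
      ; κ₃≡ = refl ; a₃≡ = refl ; c₃≡ = refl ; K′≡ = refl ; A≡ = refl ; n₀≡ = refl ; K≡ = refl }

  record PentagonCut (k n : ℕ) (f₁ f₂ e g₁ g₂ : Rel n) : Set where
    field
      s    : ℕ
      s²≤n : s * s ≤ n
      K₁ K₂ K₃ K₄ K₅ : Rel n
      kept-free    : ∀ v x w u y → K₁ v x ≡ true → K₂ x w ≡ true → K₃ w u ≡ true → K₄ v y ≡ true → K₅ y u ≡ true → ⊥
      total-sparse : k * (count (f₁ ∖ K₁) + (count (f₂ ∖ K₂) + (count (e ∖ K₃) + (count (g₁ ∖ K₄) + count (g₂ ∖ K₅))))) ≤ n * s

  module Core (k n : ℕ) (C : Constants k) (f₁ f₂ e g₁ g₂ : Rel n) (q₄ q₅ : ℕ) (0<k : 0 < k)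
    (few₁ : FewFourCycles f₁ (8 * q₄ + 7)) (few₂ : FewFourCycles f₂ (8 * q₄ + 7)) (few₃ : FewFourCycles e (8 * q₄ + 7))
    (few₄ : FewFourCycles g₁ (8 * q₄ + 7)) (few₅ : FewFourCycles g₂ (8 * q₄ + 7))
    (few-pentagons : pentagons f₁ f₂ e g₁ g₂ ≤ 10 * q₅ + 9)
    (q₄-small : Constants.K C * q₄ ≤ n * n)
    (q₅-small : Constants.K C * Constants.K C * (q₅ * q₅) ≤ n * (n * (n * (n * n)))) where

    open Constants C

    open ≤-Reasoning

    0<K : 0 < K
    0<K = subst (0 <_) (sym K≡) (s≤s z≤n)

    no-pentagons : n ≤ n₀ → q₅ ≡ 0
    no-pentagons n≤n₀ = go q₅ q₅-small
      where
      n⁵<K : n * (n * (n * (n * n))) < K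
      n⁵<K = subst (_ <_) (sym K≡) (s≤s (≤-trans (*-mono-≤ n≤n₀ (*-mono-≤ n≤n₀ (*-mono-≤ n≤n₀ (*-mono-≤ n≤n₀ n≤n₀)))) (m≤m+n _ _)))
      go : ∀ q → K * K * (q * q) ≤ n * (n * (n * (n * n))) → q ≡ 0
      go zero    h = refl
      go (suc q) h = contradiction
        (≤-trans (≤-trans (m≤m*n K K {{>-nonZero 0<K}}) (m≤m*n (K * K) (suc q * suc q))) h) (<⇒≱ n⁵<K)

    module Large (n₀<n : n₀ < n) (s : ℕ) (0<s : 0 < s) (n≤4s² : n ≤ 4 * (s * s)) where
      0<n : 0 < n
      0<n = ≤-<-trans z≤n n₀<n
      0<ρ : 0 < ρ
      0<ρ = subst (0 <_) (sym ρ≡) (*-mono-≤ (s≤s (z≤n {39})) 0<k)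
      0<r : 0 < r
      0<r = subst (0 <_) (sym r≡) (*-mono-≤ (s≤s (z≤n {1})) (*-mono-≤ 0<ρ 0<ρ))
      0<M : 0 < M
      0<M = subst (0 <_) (sym M≡) (m≤partBound J 1)
      0<c : 0 < c
      0<c = subst (0 <_) (sym c≡) (*-mono-≤ 0<r (*-mono-≤ (subst (0 <_) (sym J≡) (*-mono-≤ 0<r (*-mono-≤ 0<r 0<r))) (*-mono-≤ 0<M 0<M)))
      0<A : 0 < A
      0<A = subst (0 <_) (sym A≡) (*-mono-≤ (*-mono-≤ (m^n>0 2 (aΓ + (aΛ + a₃))) (m^n>0 2 M)) (*-mono-≤ 0<ρ 0<ρ))
      n≤n² : n ≤ n * n
      n≤n² = m≤m*n n n {{>-nonZero 0<n}}

      T : ℕ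
      T = 3 * (A * A)
      parts-of-n₀ : ∀ x y z → x + (y + z) < n → x ≤ n × y ≤ n × z < n
      parts-of-n₀ x y z h = ≤-trans (m≤m+n x (y + z)) (<⇒≤ h) ,
        ≤-trans (≤-trans (m≤m+n y z) (m≤n+m (y + z) x)) (<⇒≤ h) ,
        ≤-<-trans (≤-trans (m≤n+m z y) (m≤n+m (y + z) x)) h
      n-large : T * T ≤ n × 14 * (A * A) ≤ n × 18 * K′ < n
      n-large = parts-of-n₀ (T * T) (14 * (A * A)) (18 * K′) (subst (_< n) n₀≡ n₀<n)
      parts-of-K : ∀ {L} x y z → L ≡ suc (x + (y + z)) → y ≤ L × z ≤ L
      parts-of-K x y z refl = m≤n⇒m≤1+n (≤-trans (m≤m+n y z) (m≤n+m (y + z) x)) ,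
                              m≤n⇒m≤1+n (≤-trans (m≤n+m z y) (m≤n+m (y + z) x))
      K-large : 16 * (A * A) ≤ K × 40 * K′ ≤ K
      K-large = parts-of-K (n₀ * (n₀ * (n₀ * (n₀ * n₀)))) (16 * (A * A)) (40 * K′) K≡

      few : ∀ {Q} → Q ≤ 8 * q₄ + 7 → A * A * Q ≤ n * n
      few {Q} h = *-cancelˡ-≤ 2 (begin
        2 * (A * A * Q)                          ≤⟨ *-monoʳ-≤ 2 (*-monoʳ-≤ (A * A) h) ⟩
        2 * (A * A * (8 * q₄ + 7))               ≡⟨ ring (A * A) q₄ ⟩
        16 * (A * A) * q₄ + 14 * (A * A)         ≤⟨ +-mono-≤ (≤-trans (*-monoˡ-≤ q₄ (proj₁ K-large)) q₄-small) (≤-trans (proj₁ (proj₂ n-large)) n≤n²) ⟩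
        n * n + n * n                            ≡⟨ cong (n * n +_) (+-identityʳ (n * n)) ⟨
        2 * (n * n)                              ∎)
        where
        ring : ∀ a q → 2 * (a * (8 * q + 7)) ≡ 16 * a * q + 14 * a
        ring = solve-∀

      plain : ∀ {Q} → A * A * Q ≤ n * n → Q ≤ n * n
      plain {Q} = ≤-trans (m≤n*m Q (A * A) {{>-nonZero (*-mono-≤ 0<A 0<A)}})

      weak : {f : Rel n} → FewFourCycles f (8 * q₄ + 7) → FewFourCycles f (n * n)
      weak F = record { rows = plain (few (rows F)) ; cols = plain (few (cols F)) }

      weak-flip : {f : Rel n} → FewFourCycles f (8 * q₄ + 7) → FewFourCycles (flip f) (n * n)
      weak-flip F = record { rows = plain (few (cols F)) ; cols = plain (few (rows F)) }

      few-e : ∀ f → FewFourCycles f (8 * q₄ + 7) → A * A * count f ≤ n * n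
      few-e f F = *-cancelˡ-≤ 3 (≤-trans (≤-reflexive (sym (*-assoc 3 (A * A) (count f))))
        (few-edges f T (*-mono-≤ (s≤s (z≤n {2})) (*-mono-≤ 0<A 0<A)) (proj₁ n-large) (plain (few (rows F)))))

      C₁ : Container f₁ aΓ cΓ (n * s) 1 aΓ 0
      C₁ = container f₁ aΓ cΓ (n * s) 0<n
      C₂ : Container f₂ aΓ cΓ (n * s) 1 aΓ 0
      C₂ = container f₂ aΓ cΓ (n * s) 0<n
      C₃ : Container e a₃ c₃ (n * s) 1 a₃ 0
      C₃ = container e a₃ c₃ (n * s) 0<n
      C₄ : Container g₁ aΛ cΛ (n * s) 1 aΛ 0
      C₄ = container g₁ aΛ cΛ (n * s) 0<n
      C₅ : Container g₂ aΛ cΛ (n * s) 1 aΛ 0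
      C₅ = container g₂ aΛ cΛ (n * s) 0<n

      Kq₅≤ : K * q₅ ≤ 2 * (n * (n * s))
      Kq₅≤ = square-cancel-≤ (begin
        K * q₅ * (K * q₅)                     ≡⟨ ring₁ K q₅ ⟩
        K * K * (q₅ * q₅)                     ≤⟨ q₅-small ⟩
        n * (n * (n * (n * n)))               ≤⟨ *-monoʳ-≤ n (*-monoʳ-≤ n (*-monoʳ-≤ n (*-monoʳ-≤ n n≤4s²))) ⟩
        n * (n * (n * (n * (4 * (s * s)))))   ≡⟨ ring₂ n s ⟩
        2 * (n * (n * s)) * (2 * (n * (n * s))) ∎)
        where
        ring₁ : ∀ K q → K * q * (K * q) ≡ K * K * (q * q)
        ring₁ = solve-∀
        ring₂ : ∀ n s → n * (n * (n * (n * (4 * (s * s))))) ≡ 2 * (n * (n * s)) * (2 * (n * (n * s)))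
        ring₂ = solve-∀

      few-Γ-pentagons : ¬ (n * (n * (n * (n * n))) ≤ κ * pentagons (Γ C₁) (Γ C₂) (Γ C₃) (Γ C₄) (Γ C₅))
      few-Γ-pentagons many = <⇒≱ (proj₂ (proj₂ n-large)) (≤-trans n≤n²s (+-cancelˡ-≤ (n * (n * s)) _ _ (begin
        n * (n * s) + n * (n * s)               ≤⟨ +-mono-≤ transferred transferred ⟩
        K′ * P + K′ * P                         ≤⟨ +-mono-≤ (*-monoʳ-≤ K′ few-pentagons) (*-monoʳ-≤ K′ few-pentagons) ⟩
        K′ * (10 * q₅ + 9) + K′ * (10 * q₅ + 9) ≡⟨ ring₁ K′ q₅ ⟩
        20 * K′ * q₅ + 18 * K′                  ≤⟨ +-monoˡ-≤ (18 * K′) half ⟩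
        n * (n * s) + 18 * K′                   ∎)))
        where
        P : ℕ
        P = pentagons f₁ f₂ e g₁ g₂
        ring₁ : ∀ K q → K * (10 * q + 9) + K * (10 * q + 9) ≡ 20 * K * q + 18 * K
        ring₁ = solve-∀
        ring₂ : ∀ K q → 2 * (20 * K * q) ≡ 40 * K * q
        ring₂ = solve-∀
        half : 20 * K′ * q₅ ≤ n * (n * s)
        half = *-cancelˡ-≤ 2 (≤-trans (≤-reflexive (ring₂ K′ q₅)) (≤-trans (*-monoˡ-≤ q₅ (proj₂ K-large)) Kq₅≤))
        n≤n²s : n ≤ n * (n * s)
        n≤n²s = m≤m*n n (n * s) {{>-nonZero (*-mono-≤ 0<n 0<s)}}
        transferred : n * (n * s) ≤ K′ * P
        transferred = subst (λ z → n * (n * s) ≤ z * P) (sym K′≡) (pentagon-transfer {Γ₁ = Γ C₁} {Γ C₂} {Γ C₃} {Γ C₄} {Γ C₅} {f₁} {f₂} {e} {g₁} {g₂} {κ} 0<n κ₁≡ κ₂≡ κ₃≡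
          (arm-dominates {Γ₁ = Γ C₁} {Γ C₂} {f₁} {f₂} κ₁ a₁ c₁≡ 0<n 0<s n≤4s² (weak few₁) (weak-flip few₂) (dominates C₁) (dominates C₂) (≤-trans (n≤1+n _) (≤-reflexive (sym aΓ≡)))) (≤-reflexive (sym a₁≡))
          (arm-dominates {Γ₁ = Γ C₄} {Γ C₅} {g₁} {g₂} κ₁ a₂ c₂≡ 0<n 0<s n≤4s² (weak few₄) (weak-flip few₅) (dominates C₄) (dominates C₅) (≤-trans (n≤1+n _) (≤-reflexive (sym aΛ≡)))) (≤-reflexive (sym a₂≡))
          (dominates C₃) (≤-trans (n≤1+n _) (≤-reflexive (sym a₃≡))) many)

      partition : RegularPartition (Γ C₃) r c M (J * (M * M * (n * n)))
      partition = subst (RegularPartition (Γ C₃) r c M) (cong (_+ J * (M * M * (n * n))) start-empty)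
        (Refinement.refine (Γ C₃) r c M 0<n 0<r J whole whole (λ _ _ → true) (≤-reflexive (sym M≡))
          (*-mono-≤ (≤-reflexive (sym J≡)) (count-≤ {n} (λ _ _ → true))))
        where
        whole : Fin n → Fin 1
        whole _ = zero
        start-empty : c * count (Γ C₃ ∖ zone whole whole (λ _ _ → true)) ≡ 0
        start-empty = trans (cong (c *_) (trans (∑-cong₂ λ w u → none (Γ C₃ w u))
                        (trans (∑-const n _) (trans (cong (n *_) (trans (∑-const n 0) (*-zeroʳ n))) (*-zeroʳ n))))) (*-zeroʳ c)
          where
          none : ∀ b → ⟦ b ∧ false ⟧ ≡ 0
          none true  = refl
          none false = refl

      open Cleaning (Clean.cleaning (Γ C₁) (Γ C₂) (Γ C₃) (Γ C₄) (Γ C₅) r c M J 0<n 0<c 0<M c≡ partition b κ b≡ κ≡ few-Γ-pentagons)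

      K₁ K₂ K₃ K₄ K₅ : Rel n
      K₁ = Γ C₁ ∖ D₁
      K₂ = Γ C₂ ∖ D₂
      K₃ = Γ C₃ ∖ D₃
      K₄ = Γ C₄ ∖ D₄
      K₅ = Γ C₅ ∖ D₅

      kept-free : ∀ v x w u y → K₁ v x ≡ true → K₂ x w ≡ true → K₃ w u ≡ true → K₄ v y ≡ true → K₅ y u ≡ true → ⊥
      kept-free v x w u y h₁ h₂ h₃ h₄ h₅ = pentagon-free v x w u y
        (unkept {Γ C₁ v x} h₁) (unkept {Γ C₂ x w} h₂) (unkept {Γ C₃ w u} h₃) (unkept {Γ C₄ v y} h₄) (unkept {Γ C₅ y u} h₅)
        where
        unkept : ∀ {a b} → a ∧ not b ≡ true → b ≡ false
        unkept {a} eq = not-true (proj₂ (∧-true {a} eq))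

      0<aΓ : 0 < aΓ
      0<aΓ = subst (0 <_) (sym aΓ≡) (s≤s z≤n)
      0<aΛ : 0 < aΛ
      0<aΛ = subst (0 <_) (sym aΛ≡) (s≤s z≤n)
      0<a₃ : 0 < a₃
      0<a₃ = subst (0 <_) (sym a₃≡) (s≤s z≤n)

      A≥ : ∀ {a} → a ≤ aΓ + (aΛ + a₃) → 2 ^ a * 2 ^ M * (ρ * ρ) ≤ A
      A≥ le = ≤-trans (*-monoˡ-≤ (ρ * ρ) (*-monoˡ-≤ (2 ^ M) (^-monoʳ-≤ 2 le))) (≤-reflexive (sym A≡))

      total-sparse : k * (count (f₁ ∖ K₁) + (count (f₂ ∖ K₂) + (count (e ∖ K₃) + (count (g₁ ∖ K₄) + count (g₂ ∖ K₅))))) ≤ n * s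
      total-sparse = *-cancelˡ-≤ 40 (begin
        40 * (k * (x₁ + (x₂ + (x₃ + (x₄ + x₅)))))                   ≡⟨ trans (ring₁ k x₁ x₂ x₃ x₄ x₅) (cong (λ ρ → ρ * x₁ + (ρ * x₂ + (ρ * x₃ + (ρ * x₄ + ρ * x₅)))) (sym ρ≡)) ⟩
        ρ * x₁ + (ρ * x₂ + (ρ * x₃ + (ρ * x₄ + ρ * x₅)))
          ≤⟨ +-mono-≤ (kept-sparse ρ A M C₁ columns₁ cΓ≡ r≡ 0<aΓ 0<n 0<s 0<ρ n≤4s² k₁≤ (A≥ Γ≤) sparse₁ (few-e f₁ few₁) (few (rows few₁)))
            (+-mono-≤ (kept-sparse ρ A M C₂ columns₂ cΓ≡ r≡ 0<aΓ 0<n 0<s 0<ρ n≤4s² k₂≤ (A≥ Γ≤) sparse₂ (few-e f₂ few₂) (few (rows few₂)))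
            (+-mono-≤ (kept-sparse ρ A M C₃ columns₃ c₃≡ r≡ 0<a₃ 0<n 0<s 0<ρ n≤4s² k₃≤ (A≥ E≤) sparse₃ (few-e e few₃) (few (rows few₃)))
            (+-mono-≤ (kept-sparse ρ A M C₄ columns₄ cΛ≡ r≡ 0<aΛ 0<n 0<s 0<ρ n≤4s² k₄≤ (A≥ Λ≤) sparse₄ (few-e g₁ few₄) (few (rows few₄)))
                      (kept-sparse ρ A M C₅ columns₅ cΛ≡ r≡ 0<aΛ 0<n 0<s 0<ρ n≤4s² k₅≤ (A≥ Λ≤) sparse₅ (few-e g₂ few₅) (few (rows few₅)))))) ⟩
        8 * (n * s) + (8 * (n * s) + (8 * (n * s) + (8 * (n * s) + 8 * (n * s)))) ≡⟨ ring₂ (n * s) ⟩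
        40 * (n * s)                                                ∎)
        where
        x₁ x₂ x₃ x₄ x₅ : ℕ
        x₁ = count (f₁ ∖ K₁)
        x₂ = count (f₂ ∖ K₂)
        x₃ = count (e ∖ K₃)
        x₄ = count (g₁ ∖ K₄)
        x₅ = count (g₂ ∖ K₅)
        Γ≤ : aΓ ≤ aΓ + (aΛ + a₃)
        Γ≤ = m≤m+n aΓ (aΛ + a₃)
        Λ≤ : aΛ ≤ aΓ + (aΛ + a₃)
        Λ≤ = ≤-trans (m≤m+n aΛ a₃) (m≤n+m (aΛ + a₃) aΓ)
        E≤ : a₃ ≤ aΓ + (aΛ + a₃)
        E≤ = ≤-trans (m≤n+m a₃ aΛ) (m≤n+m (aΛ + a₃) aΓ)
        ring₁ : ∀ k x₁ x₂ x₃ x₄ x₅ → 40 * (k * (x₁ + (x₂ + (x₃ + (x₄ + x₅))))) ≡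
                40 * k * x₁ + (40 * k * x₂ + (40 * k * x₃ + (40 * k * x₄ + 40 * k * x₅)))
        ring₁ = solve-∀
        ring₂ : ∀ z → 8 * z + (8 * z + (8 * z + (8 * z + 8 * z))) ≡ 40 * z
        ring₂ = solve-∀

    cut : q₅ ≡ 0 ⊎ PentagonCut k n f₁ f₂ e g₁ g₂
    cut with ≤-<-connex n n₀
    ... | inj₁ n≤n₀ = inj₁ (no-pentagons n≤n₀)
    ... | inj₂ n₀<n with sqrt-bounds n (≤-<-trans z≤n n₀<n)
    ...   | s , 0<s , s²≤n , n≤4s² = inj₂ (record { s = s ; s²≤n = s²≤n ; kept-free = kept-free ; total-sparse = total-sparse })
      where open Large n₀<n s 0<s n≤4s²

  -- Counting copies

  variable
    𝔸 𝔹 : Set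

  ∑ᴸ : (𝔸 → ℕ) → List 𝔸 → ℕ
  ∑ᴸ f []       = 0
  ∑ᴸ f (x ∷ xs) = f x + ∑ᴸ f xs

  ∑ᴸ-++ : (f : 𝔸 → ℕ) (xs ys : List 𝔸) → ∑ᴸ f (xs ++ ys) ≡ ∑ᴸ f xs + ∑ᴸ f ys
  ∑ᴸ-++ f []       ys = refl
  ∑ᴸ-++ f (x ∷ xs) ys = trans (cong (f x +_) (∑ᴸ-++ f xs ys)) (sym (+-assoc (f x) _ _))

  ∑ᴸ-map : (f : 𝔹 → ℕ) (g : 𝔸 → 𝔹) (xs : List 𝔸) → ∑ᴸ f (map g xs) ≡ ∑ᴸ (f ∘ g) xs
  ∑ᴸ-map f g []       = refl
  ∑ᴸ-map f g (x ∷ xs) = cong (f (g x) +_) (∑ᴸ-map f g xs)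

  ∑ᴸ-concatMap : (f : 𝔹 → ℕ) (g : 𝔸 → List 𝔹) (xs : List 𝔸) →
                 ∑ᴸ f (concatMap g xs) ≡ ∑ᴸ (λ x → ∑ᴸ f (g x)) xs
  ∑ᴸ-concatMap f g []       = refl
  ∑ᴸ-concatMap f g (x ∷ xs) = trans (∑ᴸ-++ f (g x) _) (cong (∑ᴸ f (g x) +_) (∑ᴸ-concatMap f g xs))

  ∑ᴸ-cong : {f g : 𝔸 → ℕ} → (∀ x → f x ≡ g x) → (xs : List 𝔸) → ∑ᴸ f xs ≡ ∑ᴸ g xs
  ∑ᴸ-cong f≗g []       = refl
  ∑ᴸ-cong f≗g (x ∷ xs) = cong₂ _+_ (f≗g x) (∑ᴸ-cong f≗g xs)

  ∑ᴸ-tabulate : (f : 𝔸 → ℕ) (g : Fin n → 𝔸) → ∑ᴸ f (tabulateᴸ g) ≡ ∑ (f ∘ g)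
  ∑ᴸ-tabulate {n = zero}  f g = sym (∑-empty _)
  ∑ᴸ-tabulate {n = suc n} f g = trans (cong (f (g zero) +_) (∑ᴸ-tabulate f (g ∘ suc))) (sym (∑-suc _))

  ∑ᴸ-product : (f : 𝔸 × 𝔹 → ℕ) (xs : List 𝔸) (ys : List 𝔹) →
               ∑ᴸ f (cartesianProduct xs ys) ≡ ∑ᴸ (λ x → ∑ᴸ (λ y → f (x , y)) ys) xs
  ∑ᴸ-product f []       ys = refl
  ∑ᴸ-product f (x ∷ xs) ys = trans (∑ᴸ-++ f (map (x ,_) ys) _) (cong₂ _+_ (∑ᴸ-map f (x ,_) ys) (∑ᴸ-product f xs ys))

  length-filterᵇ : (p : 𝔸 → Bool) (xs : List 𝔸) → length (filterᵇ p xs) ≡ ∑ᴸ (λ x → ⟦ p x ⟧) xs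
  length-filterᵇ p []       = refl
  length-filterᵇ p (x ∷ xs) with p x
  ... | true  = cong suc (length-filterᵇ p xs)
  ... | false = length-filterᵇ p xs

  ∑ᵛ : (Vtx n → ℕ) → ℕ
  ∑ᵛ f = ∑ λ i → ∑ λ a → f (i , a)

  ∑ᴸ-verts : (f : Vtx n → ℕ) → ∑ᴸ f (verts n) ≡ ∑ᵛ f
  ∑ᴸ-verts {n} f = trans (∑ᴸ-product f (allFin 5) (allFin n))
    (trans (∑ᴸ-tabulate _ (λ i → i)) (∑-cong λ i → ∑ᴸ-tabulate _ (λ a → a)))

  ∑ᵛ-mono : {f g : Vtx n → ℕ} → (∀ x → f x ≤ g x) → ∑ᵛ f ≤ ∑ᵛ g
  ∑ᵛ-mono f≤g = ∑-mono₂ λ i a → f≤g (i , a)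

  ∑ᵛ-part : (i : Fin 5) (f : Vtx n → ℕ) → ∑ (λ a → f (i , a)) ≤ ∑ᵛ f
  ∑ᵛ-part i f = term≤∑ (λ j → ∑ λ a → f (j , a)) i

  tupleCount : (k : ℕ) → (List (Vtx n) → ℕ) → ℕ
  tupleCount zero    f = f []
  tupleCount (suc k) f = ∑ᵛ λ x → tupleCount k (λ xs → f (x ∷ xs))

  ∑ᴸ-tuples : (k : ℕ) (f : List (Vtx n) → ℕ) → ∑ᴸ f (tuples k (verts n)) ≡ tupleCount k f
  ∑ᴸ-tuples zero    f = +-identityʳ (f [])
  ∑ᴸ-tuples {n} (suc k) f = trans (∑ᴸ-concatMap f _ (verts n))
    (trans (∑ᴸ-verts {n} _) (∑-cong₂ λ i a → trans (∑ᴸ-map f ((i , a) ∷_) (tuples k (verts n))) (∑ᴸ-tuples k _)))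

  cycleCount : (k : ℕ) → (List (Vtx n) → Bool) → ℕ
  cycleCount {n} k p = length (filterᵇ p (tuples k (verts n)))

  cycleCount≡ : (k : ℕ) (p : List (Vtx n) → Bool) → cycleCount k p ≡ tupleCount k (λ xs → ⟦ p xs ⟧)
  cycleCount≡ {n} k p = trans (length-filterᵇ p (tuples k (verts n))) (∑ᴸ-tuples k _)

  ==V-false : {x y : Vtx n} → x ≢ y → not (x ==V y) ≡ true
  ==V-false {x = x} {y} x≢y with ≡-dec _≟F_ _≟F_ x y
  ... | yes x≡y = contradiction x≡y x≢y
  ... | no _    = refl

  any-allFin : (p : Fin m → Bool) (i : Fin m) → p i ≡ true → any p (allFin m) ≡ true
  any-allFin {m} p i pi = go (λ j → j) i pi
    where
    go : ∀ {k} (g : Fin k → Fin m) (i : Fin k) → p (g i) ≡ true → any p (tabulateᴸ g) ≡ true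
    go g zero    eq rewrite eq = refl
    go g (suc i) eq with p (g zero)
    ... | true  = refl
    ... | false = go (g ∘ suc) i eq

  part₀ part₁ part₂ part₃ part₄ : Fin 5
  part₀ = zero
  part₁ = suc zero
  part₂ = suc (suc zero)
  part₃ = suc (suc (suc zero))
  part₄ = suc (suc (suc (suc zero)))

  module _ (G : CycGraph n) where
    between : Fin 5 → Fin 5 → Rel n
    between i j a b = adj G (i , a) (j , b)

    fourCycles≤ : (i j : Fin 5) → i ≢ j →
                  fourCycles (between i j) ≤ cycleCount 4 (λ vs → isCycle (adj G) vs ∧ inTwoParts vs)
    fourCycles≤ i j i≢j = begin
      ∑ (λ x → ∑ λ x′ → ∑ λ v → ∑ λ v′ → ⟦ isFourCycle B x x′ v v′ ⟧)
        ≡⟨ ∑-cong (λ x → ∑-comm _) ⟩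
      ∑ (λ x → ∑ λ v → ∑ λ x′ → ∑ λ v′ → ⟦ isFourCycle B x x′ v v′ ⟧)
        ≤⟨ ∑-mono₂ (λ x v → ∑-mono₂ λ x′ v′ → ⟦⟧-mono (copy x x′ v v′)) ⟩
      ∑ (λ x → ∑ λ v → ∑ λ x′ → ∑ λ v′ → f ((j , x) ∷ (i , v) ∷ (j , x′) ∷ (i , v′) ∷ []))
        ≤⟨ ∑-mono₂ (λ x v → ∑-mono λ x′ → ∑ᵛ-part i _) ⟩
      ∑ (λ x → ∑ λ v → ∑ λ x′ → ∑ᵛ λ v′ → f ((j , x) ∷ (i , v) ∷ (j , x′) ∷ v′ ∷ []))
        ≤⟨ ∑-mono₂ (λ x v → ∑ᵛ-part j _) ⟩
      ∑ (λ x → ∑ λ v → ∑ᵛ λ x′ → ∑ᵛ λ v′ → f ((j , x) ∷ (i , v) ∷ x′ ∷ v′ ∷ []))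
        ≤⟨ ∑-mono (λ x → ∑ᵛ-part i _) ⟩
      ∑ (λ x → ∑ᵛ λ v → ∑ᵛ λ x′ → ∑ᵛ λ v′ → f ((j , x) ∷ v ∷ x′ ∷ v′ ∷ []))
        ≤⟨ ∑ᵛ-part j _ ⟩
      tupleCount 4 f
        ≡⟨ cycleCount≡ 4 p ⟨
      cycleCount 4 p ∎
      where
      open ≤-Reasoning
      B : Rel n
      B = between i j
      p : List (Vtx n) → Bool
      p vs = isCycle (adj G) vs ∧ inTwoParts vs
      f : List (Vtx n) → ℕ
      f vs = ⟦ p vs ⟧
      flipped : ∀ v x → B v x ≡ true → adj G (j , x) (i , v) ≡ true
      flipped v x eq = trans (Defs.sym G _ _) eq
      ji : ∀ x v → not (_==V_ {n} (j , x) (i , v)) ≡ true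
      ji x v = ==V-false λ eq → i≢j (sym (cong proj₁ eq))
      ij : ∀ v x → not (_==V_ {n} (i , v) (j , x)) ≡ true
      ij v x = ==V-false λ eq → i≢j (cong proj₁ eq)
      same : ∀ k a b → not (a == b) ≡ true → not (_==V_ {n} (k , a) (k , b)) ≡ true
      same k a b ne = ==V-false λ eq → true≢false (trans (sym (cong not (trans (cong (a ==_) (sym (cong proj₂ eq))) (==-refl a)))) ne)
        where
        true≢false : false ≡ true → ⊥
        true≢false ()
      inParts : (x x′ v v′ : Fin n) → inTwoParts {n} ((j , x) ∷ (i , v) ∷ (j , x′) ∷ (i , v′) ∷ []) ≡ true
      inParts x x′ v v′ = any-allFin (λ i → any (covers i) (allFin 5)) i (any-allFin (covers i) j (∧-intro i≠j
        (∧-intro j∈ (∧-intro i∈ (∧-intro j∈ (∧-intro i∈ refl))))))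
        where
        covers : Fin 5 → Fin 5 → Bool
        covers i′ j′ = not (i′ ==F j′) ∧ all (λ z → (part z ==F i′) ∨ (part z ==F j′))
                         ((j , x) ∷ (i , v) ∷ (j , x′) ∷ (i , v′) ∷ [])
        i≠j : not (i ==F j) ≡ true
        i≠j with i ≟F j
        ... | yes i≡j = contradiction i≡j i≢j
        ... | no _    = refl
        i∈ : (i ==F i) ∨ (i ==F j) ≡ true
        i∈ with i ≟F i
        ... | yes _  = refl
        ... | no i≢i = contradiction refl i≢i
        j∈ : (j ==F i) ∨ (j ==F j) ≡ true
        j∈ with j ≟F i | j ≟F j
        ... | yes _ | _      = refl
        ... | no _  | yes _  = refl
        ... | no _  | no j≢j = contradiction refl j≢j
      copy : ∀ x x′ v v′ → isFourCycle B x x′ v v′ ≡ true →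
             p ((j , x) ∷ (i , v) ∷ (j , x′) ∷ (i , v′) ∷ []) ≡ true
      copy x x′ v v′ eq =
        let (distinct , edges) = ∧-true {not (x == x′) ∧ not (v == v′)} eq
            (x≠x′ , v≠v′)      = ∧-true {not (x == x′)} distinct
            (e₁₂ , e₃₄)        = ∧-true {B v x ∧ B v x′} edges
            (e₁ , e₂)          = ∧-true {B v x} e₁₂
            (e₃ , e₄)          = ∧-true {B v′ x} e₃₄
        in ∧-intro (∧-intro
             (∧-intro (∧-intro (ji x v) (∧-intro (same j x x′ x≠x′) (∧-intro (ji x v′) refl)))
             (∧-intro (∧-intro (ij v x′) (∧-intro (same i v v′ v≠v′) refl))
             (∧-intro (∧-intro (ji x′ v′) refl) refl)))
             (∧-intro (flipped v x e₁) (∧-intro e₂ (∧-intro (flipped v′ x′ e₄) e₃))))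
             (inParts x x′ v v′)

    between-flip : (i j : Fin 5) → fourCycles (flip (between i j)) ≡ fourCycles (between j i)
    between-flip i j = ∑-cong₂ λ x x′ → ∑-cong₂ λ v v′ → cong ⟦_⟧ (cong ((not (x == x′) ∧ not (v == v′)) ∧_)
      (cong₂ _∧_ (cong₂ _∧_ (Defs.sym G _ _) (Defs.sym G _ _)) (cong₂ _∧_ (Defs.sym G _ _) (Defs.sym G _ _))))

    few-between : (i j : Fin 5) → i ≢ j → FewFourCycles (between i j) (8 * copiesC4in2parts (adj G) + 7)
    few-between i j i≢j = record
      { rows = ≤-trans (fourCycles≤ i j i≢j) rounding
      ; cols = ≤-trans (≤-reflexive (between-flip i j)) (≤-trans (fourCycles≤ j i (i≢j ∘ sym)) rounding) }
      where
      L : ℕ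
      L = cycleCount 4 (λ vs → isCycle (adj G) vs ∧ inTwoParts vs)
      rounding : L ≤ 8 * (L / 8) + 7
      rounding = begin
        L                                       ≡⟨ m≡m%n+[m/n]*n L 8 ⟩
        L % 8 + L / 8 * 8     ≤⟨ +-monoˡ-≤ _ (s≤s⁻¹ (m%n<n L 8)) ⟩
        7 + L / 8 * 8                  ≡⟨ trans (+-comm 7 _) (cong (_+ 7) (*-comm (L / 8) 8)) ⟩
        8 * (L / 8) + 7                ∎
        where open ≤-Reasoning

    pentagons≤ : pentagons (between part₀ part₁) (between part₁ part₂) (between part₂ part₃)
                           (between part₀ part₄) (between part₄ part₃) ≤ 10 * copiesC5 (adj G) + 9
    pentagons≤ = begin
      ∑ (λ v → ∑ λ w → ∑ λ u → walks f₁ f₂ v w * (⟦ e w u ⟧ * walks g₁ g₂ v u))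
        ≡⟨ ∑-cong (λ v → ∑-cong₂ λ w u → trans (cong (walks f₁ f₂ v w *_) (*-∑ ⟦ e w u ⟧ _)) (∑*∑ _ _)) ⟩
      ∑ (λ v → ∑ λ w → ∑ λ u → ∑ λ x → ∑ λ y → term v w u x y)
        ≡⟨ ∑-cong (λ v → trans (∑-cong λ w → ∑-comm _) (∑-comm _)) ⟩
      ∑ (λ v → ∑ λ x → ∑ λ w → ∑ λ u → ∑ λ y → term v w u x y)
        ≤⟨ ∑-mono₂ (λ v x → ∑-mono₂ λ w u → ∑-mono λ y → copy v x w u y) ⟩
      ∑ (λ v → ∑ λ x → ∑ λ w → ∑ λ u → ∑ λ y → f ((part₀ , v) ∷ (part₁ , x) ∷ (part₂ , w) ∷ (part₃ , u) ∷ (part₄ , y) ∷ []))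
        ≤⟨ ∑-mono₂ (λ v x → ∑-mono₂ λ w u → ∑ᵛ-part part₄ _) ⟩
      ∑ (λ v → ∑ λ x → ∑ λ w → ∑ λ u → ∑ᵛ λ y → f ((part₀ , v) ∷ (part₁ , x) ∷ (part₂ , w) ∷ (part₃ , u) ∷ y ∷ []))
        ≤⟨ ∑-mono₂ (λ v x → ∑-mono λ w → ∑ᵛ-part part₃ _) ⟩
      ∑ (λ v → ∑ λ x → ∑ λ w → ∑ᵛ λ u → ∑ᵛ λ y → f ((part₀ , v) ∷ (part₁ , x) ∷ (part₂ , w) ∷ u ∷ y ∷ []))
        ≤⟨ ∑-mono₂ (λ v x → ∑ᵛ-part part₂ _) ⟩
      ∑ (λ v → ∑ λ x → ∑ᵛ λ w → ∑ᵛ λ u → ∑ᵛ λ y → f ((part₀ , v) ∷ (part₁ , x) ∷ w ∷ u ∷ y ∷ []))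
        ≤⟨ ∑-mono (λ v → ∑ᵛ-part part₁ _) ⟩
      ∑ (λ v → ∑ᵛ λ x → ∑ᵛ λ w → ∑ᵛ λ u → ∑ᵛ λ y → f ((part₀ , v) ∷ x ∷ w ∷ u ∷ y ∷ []))
        ≤⟨ ∑ᵛ-part part₀ _ ⟩
      tupleCount 5 f
        ≡⟨ cycleCount≡ 5 (isCycle (adj G)) ⟨
      L
        ≡⟨ m≡m%n+[m/n]*n L 10 ⟩
      L % 10 + L / 10 * 10
        ≤⟨ +-monoˡ-≤ _ (s≤s⁻¹ (m%n<n L 10)) ⟩
      9 + L / 10 * 10
        ≡⟨ trans (+-comm 9 _) (cong (_+ 9) (*-comm (L / 10) 10)) ⟩
      10 * (L / 10) + 9 ∎
      where
      open ≤-Reasoning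
      f₁ f₂ e g₁ g₂ : Rel n
      f₁ = between part₀ part₁
      f₂ = between part₁ part₂
      e  = between part₂ part₃
      g₁ = between part₀ part₄
      g₂ = between part₄ part₃
      f : List (Vtx n) → ℕ
      f vs = ⟦ isCycle (adj G) vs ⟧
      L : ℕ
      L = cycleCount {n} 5 (isCycle (adj G))
      term : (v w u x y : Fin n) → ℕ
      term v w u x y = ⟦ f₁ v x ⟧ * ⟦ f₂ x w ⟧ * (⟦ e w u ⟧ * (⟦ g₁ v y ⟧ * ⟦ g₂ y u ⟧))
      reflect : ∀ a b c d e → ⟦ a ⟧ * ⟦ b ⟧ * (⟦ c ⟧ * (⟦ d ⟧ * ⟦ e ⟧)) ≤ ⟦ a ∧ (b ∧ (c ∧ (e ∧ d))) ⟧
      reflect false b     c     d     e     = z≤n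
      reflect true  false c     d     e     = z≤n
      reflect true  true  false d     e     = z≤n
      reflect true  true  true  false e     = z≤n
      reflect true  true  true  true  true  = s≤s z≤n
      reflect true  true  true  true  false = z≤n
      copy : ∀ v x w u y → term v w u x y ≤ f ((part₀ , v) ∷ (part₁ , x) ∷ (part₂ , w) ∷ (part₃ , u) ∷ (part₄ , y) ∷ [])
      copy v x w u y rewrite Defs.sym G (part₀ , v) (part₄ , y) | Defs.sym G (part₄ , y) (part₃ , u) =
        reflect (f₁ v x) (f₂ x w) (e w u) (between part₄ part₀ y v) (between part₃ part₄ u y)

  -- The subgraph

  suc5⁵ : ∀ p → suc5 (suc5 (suc5 (suc5 (suc5 p)))) ≡ p
  suc5⁵ = toWitness {a? = all? λ p → suc5 (suc5 (suc5 (suc5 (suc5 p)))) ≟F p} tt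

  turn : Fin 2 → Fin 5 → Fin 5
  turn zero    p = suc5 p
  turn (suc _) p = suc5 (suc5 (suc5 (suc5 p)))

  -- A closed walk of length 5 on the 5-cycle goes around it: the number of forward steps minus the number
  -- of backward steps is odd and divisible by 5.
  around : ∀ p d₁ d₂ d₃ d₄ d₅ → turn d₅ (turn d₄ (turn d₃ (turn d₂ (turn d₁ p)))) ≡ p →
           (d₁ ≡ zero × d₂ ≡ zero × d₃ ≡ zero × d₄ ≡ zero × d₅ ≡ zero) ⊎
           (d₁ ≢ zero × d₂ ≢ zero × d₃ ≢ zero × d₄ ≢ zero × d₅ ≢ zero)
  around = toWitness {a? = all? λ p → all? λ d₁ → all? λ d₂ → all? λ d₃ → all? λ d₄ → all? λ d₅ →
    (turn d₅ (turn d₄ (turn d₃ (turn d₂ (turn d₁ p)))) ≟F p) →-dec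
    (((d₁ ≟F zero) ×-dec (d₂ ≟F zero) ×-dec (d₃ ≟F zero) ×-dec (d₄ ≟F zero) ×-dec (d₅ ≟F zero)) ⊎-dec
     (¬? (d₁ ≟F zero) ×-dec ¬? (d₂ ≟F zero) ×-dec ¬? (d₃ ≟F zero) ×-dec ¬? (d₄ ≟F zero) ×-dec ¬? (d₅ ≟F zero)))} tt

  ∑ᵛ-zero : {f : Vtx n → ℕ} → (∀ x → f x ≡ 0) → ∑ᵛ f ≡ 0
  ∑ᵛ-zero {n} f≡0 = trans (∑-cong₂ λ i a → f≡0 (i , a)) (trans (∑-cong {5} λ i → trans (∑-const n 0) (*-zeroʳ n)) (∑-const 5 0))

  module Assemble {n : ℕ} (G : CycGraph n) (K : Fin 5 → Rel n)
    (free : ∀ v x w u y → K part₀ v x ≡ true → K part₁ x w ≡ true → K part₂ w u ≡ true →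
            K part₃ u y ≡ true → K part₄ y v ≡ true → ⊥) where

    forward : Vtx n → Vtx n → Bool
    forward (i , a) (j , b) = (suc5 i == j) ∧ (K i a b ∧ adj G (i , a) (j , b))

    H : Adj n
    H x y = forward x y ∨ forward y x

    forward-adj : ∀ x y → forward x y ≡ true → adj G x y ≡ true
    forward-adj (i , a) (j , b) eq = proj₂ (∧-true {K i a b} (proj₂ (∧-true {suc5 i == j} eq)))

    forward-part : ∀ x y → forward x y ≡ true → part y ≡ suc5 (part x)
    forward-part (i , a) (j , b) eq = sym (==⇒≡ (suc5 i) j (proj₁ (∧-true {suc5 i == j} eq)))

    forward-K : ∀ i a j b → forward (i , a) (j , b) ≡ true → K i a b ≡ true
    forward-K i a j b eq = proj₁ (∧-true {K i a b} (proj₂ (∧-true {suc5 i == j} eq)))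

    ∨-true : ∀ a b → a ∨ b ≡ true → a ≡ true ⊎ b ≡ true
    ∨-true true  b eq = inj₁ refl
    ∨-true false b eq = inj₂ eq

    H-subgraph : Subgraph H G
    H-subgraph = record
      { sub-sym = λ x y → ∨-comm (forward x y) (forward y x)
      ; sub-edge = λ x y eq → sub-edge x y (∨-true (forward x y) (forward y x) eq) }
      where
      sub-edge : ∀ x y → forward x y ≡ true ⊎ forward y x ≡ true → adj G x y ≡ true
      sub-edge x y (inj₁ eq) = forward-adj x y eq
      sub-edge x y (inj₂ eq) = trans (Defs.sym G x y) (forward-adj y x eq)

    no-forward-cycle : ∀ x₁ x₂ x₃ x₄ x₅ → forward x₁ x₂ ≡ true → forward x₂ x₃ ≡ true → forward x₃ x₄ ≡ true →
                       forward x₄ x₅ ≡ true → forward x₅ x₁ ≡ true → ⊥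
    no-forward-cycle (p₁ , a₁) (p₂ , a₂) (p₃ , a₃) (p₄ , a₄) (p₅ , a₅) h₁ h₂ h₃ h₄ h₅
      with forward-part (p₁ , a₁) (p₂ , a₂) h₁ | forward-part (p₂ , a₂) (p₃ , a₃) h₂
         | forward-part (p₃ , a₃) (p₄ , a₄) h₃ | forward-part (p₄ , a₄) (p₅ , a₅) h₄
         | forward-K p₁ a₁ p₂ a₂ h₁ | forward-K p₂ a₂ p₃ a₃ h₂ | forward-K p₃ a₃ p₄ a₄ h₃
         | forward-K p₄ a₄ p₅ a₅ h₄ | forward-K p₅ a₅ p₁ a₁ h₅
    ... | refl | refl | refl | refl | k₁ | k₂ | k₃ | k₄ | k₅ = go p₁ k₁ k₂ k₃ k₄ k₅
      where
      go : ∀ p → K p a₁ a₂ ≡ true → K (suc5 p) a₂ a₃ ≡ true → K (suc5 (suc5 p)) a₃ a₄ ≡ true →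
           K (suc5 (suc5 (suc5 p))) a₄ a₅ ≡ true → K (suc5 (suc5 (suc5 (suc5 p)))) a₅ a₁ ≡ true → ⊥
      go zero                         k₁ k₂ k₃ k₄ k₅ = free a₁ a₂ a₃ a₄ a₅ k₁ k₂ k₃ k₄ k₅
      go (suc zero)                   k₁ k₂ k₃ k₄ k₅ = free a₅ a₁ a₂ a₃ a₄ k₅ k₁ k₂ k₃ k₄
      go (suc (suc zero))             k₁ k₂ k₃ k₄ k₅ = free a₄ a₅ a₁ a₂ a₃ k₄ k₅ k₁ k₂ k₃
      go (suc (suc (suc zero)))       k₁ k₂ k₃ k₄ k₅ = free a₃ a₄ a₅ a₁ a₂ k₃ k₄ k₅ k₁ k₂
      go (suc (suc (suc (suc zero)))) k₁ k₂ k₃ k₄ k₅ = free a₂ a₃ a₄ a₅ a₁ k₂ k₃ k₄ k₅ k₁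

    record Step (x y : Vtx n) : Set where
      field
        d         : Fin 2
        turned    : part y ≡ turn d (part x)
        forwards  : d ≡ zero → forward x y ≡ true
        backwards : d ≢ zero → forward y x ≡ true

    step : ∀ x y → H x y ≡ true → Step x y
    step x y eq with ∨-true (forward x y) (forward y x) eq
    ... | inj₁ xy = record { d = zero ; turned = forward-part x y xy ; forwards = λ _ → xy ; backwards = λ 0≢0 → contradiction refl 0≢0 }
    ... | inj₂ yx = record { d = suc zero ; turned = turned ; forwards = λ () ; backwards = λ _ → yx }
      where
      turned : part y ≡ suc5 (suc5 (suc5 (suc5 (part x))))
      turned rewrite forward-part y x yx = sym (suc5⁵ (part y))

    open Step

    no-cycle : ∀ x₁ x₂ x₃ x₄ x₅ → Step x₁ x₂ → Step x₂ x₃ → Step x₃ x₄ → Step x₄ x₅ → Step x₅ x₁ → ⊥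
    no-cycle x₁ x₂ x₃ x₄ x₅ s₁ s₂ s₃ s₄ s₅ = conclude (around (part x₁) (d s₁) (d s₂) (d s₃) (d s₄) (d s₅) closed)
      where
      closed : turn (d s₅) (turn (d s₄) (turn (d s₃) (turn (d s₂) (turn (d s₁) (part x₁))))) ≡ part x₁
      closed = sym (trans (turned s₅) (cong (turn (d s₅)) (trans (turned s₄) (cong (turn (d s₄))
        (trans (turned s₃) (cong (turn (d s₃)) (trans (turned s₂) (cong (turn (d s₂)) (turned s₁)))))))))
      conclude : (d s₁ ≡ zero × d s₂ ≡ zero × d s₃ ≡ zero × d s₄ ≡ zero × d s₅ ≡ zero) ⊎
                 (d s₁ ≢ zero × d s₂ ≢ zero × d s₃ ≢ zero × d s₄ ≢ zero × d s₅ ≢ zero) → ⊥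
      conclude (inj₁ (e₁ , e₂ , e₃ , e₄ , e₅)) = no-forward-cycle x₁ x₂ x₃ x₄ x₅
        (forwards s₁ e₁) (forwards s₂ e₂) (forwards s₃ e₃) (forwards s₄ e₄) (forwards s₅ e₅)
      conclude (inj₂ (e₁ , e₂ , e₃ , e₄ , e₅)) = no-forward-cycle x₁ x₅ x₄ x₃ x₂
        (backwards s₅ e₅) (backwards s₄ e₄) (backwards s₃ e₃) (backwards s₂ e₂) (backwards s₁ e₁)

    C5-free : copiesC5 H ≡ 0
    C5-free = cong (_/ 10) (trans (cycleCount≡ {n} 5 (isCycle H))
      (∑ᵛ-zero λ x₁ → ∑ᵛ-zero λ x₂ → ∑ᵛ-zero λ x₃ → ∑ᵛ-zero λ x₄ → ∑ᵛ-zero λ x₅ → none x₁ x₂ x₃ x₄ x₅))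
      where
      none : ∀ x₁ x₂ x₃ x₄ x₅ → ⟦ isCycle H (x₁ ∷ x₂ ∷ x₃ ∷ x₄ ∷ x₅ ∷ []) ⟧ ≡ 0
      none x₁ x₂ x₃ x₄ x₅ with isCycle H (x₁ ∷ x₂ ∷ x₃ ∷ x₄ ∷ x₅ ∷ []) in eq
      ... | false = refl
      ... | true  =
        let closed     = proj₂ (∧-true {allDistinct (x₁ ∷ x₂ ∷ x₃ ∷ x₄ ∷ x₅ ∷ [])} eq)
            (h₁ , r₁)  = ∧-true {H x₁ x₂} closed
            (h₂ , r₂)  = ∧-true {H x₂ x₃} r₁
            (h₃ , r₃)  = ∧-true {H x₃ x₄} r₂
            (h₄ , h₅)  = ∧-true {H x₄ x₅} r₃
        in ⊥-elim (no-cycle x₁ x₂ x₃ x₄ x₅ (step x₁ x₂ h₁) (step x₂ x₃ h₂) (step x₃ x₄ h₃) (step x₄ x₅ h₄) (step x₅ x₁ h₅))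

    dropped : Vtx n → Vtx n → ℕ
    dropped (i , a) (j , b) = ⟦ suc5 i == j ⟧ * ⟦ adj G (i , a) (j , b) ∧ not (K i a b) ⟧

    removed-pair : ∀ x y → ⟦ adj G x y ∧ not (H x y) ⟧ ≤ dropped x y + dropped y x
    removed-pair (i , a) (j , b) with adj G (i , a) (j , b) in eq
    ... | false = z≤n
    ... | true with cyc G (i , a) (j , b) eq
    ...   | inj₁ refl rewrite ==-refl (suc5 i) = first (K i a b) _ _
      where
      first : ∀ k z w → ⟦ not ((k ∧ true) ∨ z) ⟧ ≤ 1 * ⟦ not k ⟧ + w
      first true  z     w = z≤n
      first false true  w = z≤n
      first false false w = s≤s z≤n
    ...   | inj₂ refl rewrite ==-refl (suc5 j) | trans (sym (Defs.sym G (suc5 j , a) (j , b))) eq =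
      second _ (K j b a) (⟦ suc5 (suc5 j) == j ⟧ * ⟦ true ∧ not (K (suc5 j) a b) ⟧)
      where
      second : ∀ z k w → ⟦ not (z ∨ (k ∧ true)) ⟧ ≤ w + 1 * ⟦ not k ⟧
      second true  k     w = z≤n
      second false true  w = z≤n
      second false false w = m≤n+m 1 w

    ∑dropped : ∑ᵛ (λ x → ∑ᵛ λ y → dropped x y) ≡ ∑ λ i → count (between G i (suc5 i) ∖ K i)
    ∑dropped = ∑-cong₂ λ i a → begin
      ∑ (λ j → ∑ λ b → ⟦ suc5 i == j ⟧ * ⟦ adj G (i , a) (j , b) ∧ not (K i a b) ⟧)
        ≡⟨ ∑-cong (λ j → sym (*-∑ ⟦ suc5 i == j ⟧ _)) ⟩
      ∑ (λ j → ⟦ suc5 i == j ⟧ * ∑ λ b → ⟦ adj G (i , a) (j , b) ∧ not (K i a b) ⟧)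
        ≡⟨ ∑-point (suc5 i) _ ⟩
      ∑ (λ b → ⟦ adj G (i , a) (suc5 i , b) ∧ not (K i a b) ⟧) ∎
      where open ≡-Reasoning

    ∑ᵛ-+ : (f g : Vtx n → ℕ) → ∑ᵛ (λ x → f x + g x) ≡ ∑ᵛ f + ∑ᵛ g
    ∑ᵛ-+ f g = ∑∑-+ _ _

    ∑ᵛ-comm : (f : Vtx n → Vtx n → ℕ) → ∑ᵛ (λ x → ∑ᵛ λ y → f x y) ≡ ∑ᵛ (λ y → ∑ᵛ λ x → f x y)
    ∑ᵛ-comm f = ∑-swap-pairs λ i a j b → f (i , a) (j , b)

    removed≤ : removedEdges G H ≤ ∑ λ i → count (between G i (suc5 i) ∖ K i)
    removed≤ = *-cancelʳ-≤ (removedEdges G H) _ 2 (begin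
      L / 2 * 2
        ≤⟨ m/n*n≤m L 2 ⟩
      L
        ≡⟨ trans (length-filterᵇ gone (cartesianProduct (verts n) (verts n)))
             (trans (∑ᴸ-product _ (verts n) (verts n)) (trans (∑ᴸ-verts {n} _) (∑-cong₂ λ i a → ∑ᴸ-verts {n} _))) ⟩
      ∑ᵛ (λ x → ∑ᵛ λ y → ⟦ adj G x y ∧ not (H x y) ⟧)
        ≤⟨ ∑ᵛ-mono (λ x → ∑ᵛ-mono λ y → removed-pair x y) ⟩
      ∑ᵛ (λ x → ∑ᵛ λ y → dropped x y + dropped y x)
        ≡⟨ trans (∑-cong₂ λ i a → ∑ᵛ-+ _ _) (∑ᵛ-+ _ _) ⟩
      ∑ᵛ (λ x → ∑ᵛ λ y → dropped x y) + ∑ᵛ (λ x → ∑ᵛ λ y → dropped y x)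
        ≡⟨ cong₂ _+_ ∑dropped (trans (∑ᵛ-comm (λ x y → dropped y x)) ∑dropped) ⟩
      R + R
        ≡⟨ trans (cong (R +_) (sym (+-identityʳ R))) (*-comm 2 R) ⟩
      R * 2 ∎)
      where
      open ≤-Reasoning
      gone : Vtx n × Vtx n → Bool
      gone p = adj G (proj₁ p) (proj₂ p) ∧ not (H (proj₁ p) (proj₂ p))
      L R : ℕ
      L = length (filterᵇ gone (cartesianProduct (verts n) (verts n)))
      R = ∑ λ i → count (between G i (suc5 i) ∖ K i)

  -- Rational thresholds

  removed-nothing : (G : CycGraph n) → removedEdges G (adj G) ≡ 0
  removed-nothing {n} G = cong (_/ 2) (trans (length-filterᵇ gone (cartesianProduct (verts n) (verts n)))
    (trans (∑ᴸ-cong {g = λ _ → 0} (λ p → none (adj G (proj₁ p) (proj₂ p))) (cartesianProduct (verts n) (verts n)))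
           (∑ᴸ-zero (cartesianProduct (verts n) (verts n)))))
    where
    gone : Vtx n × Vtx n → Bool
    gone p = adj G (proj₁ p) (proj₂ p) ∧ not (adj G (proj₁ p) (proj₂ p))
    none : ∀ b → ⟦ b ∧ not b ⟧ ≡ 0
    none true  = refl
    none false = refl
    ∑ᴸ-zero : (xs : List (Vtx n × Vtx n)) → ∑ᴸ (λ _ → 0) xs ≡ 0
    ∑ᴸ-zero []       = refl
    ∑ᴸ-zero (x ∷ xs) = ∑ᴸ-zero xs

  ∑₅ : (F : Fin 5 → ℕ) → ∑ F ≡ F part₀ + (F part₁ + (F part₂ + (F part₃ + (F part₄ + 0))))
  ∑₅ F = trans (∑-suc F) (cong (F part₀ +_) (trans (∑-suc _) (cong (F part₁ +_) (trans (∑-suc _) (cong (F part₂ +_)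
    (trans (∑-suc _) (cong (F part₃ +_) (trans (∑-suc _) (cong (F part₄ +_) (∑-empty _))))))))))

  RemovalOf : ℕ → CycGraph n → Set
  RemovalOf {n} k G = Σ (Adj n) λ H → Subgraph H G × copiesC5 H ≡ 0 × k * removedEdges G H * (k * removedEdges G H) ≤ n * (n * n)

  module _ (k : ℕ) (G : CycGraph n) where
    fromCut : PentagonCut k n (between G part₀ part₁) (between G part₁ part₂) (between G part₂ part₃)
                (between G part₀ part₄) (between G part₄ part₃) → RemovalOf k G
    fromCut C = A.H , A.H-subgraph , A.C5-free , (begin
      k * removedEdges G A.H * (k * removedEdges G A.H)   ≤⟨ *-mono-≤ few-removed few-removed ⟩
      n * s * (n * s)                                     ≡⟨ ring₁ n s ⟩
      n * (n * (s * s))                                   ≤⟨ *-monoʳ-≤ n (*-monoʳ-≤ n s²≤n) ⟩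
      n * (n * n)                                         ∎)
      where
      open ≤-Reasoning
      open PentagonCut C
      kept : Fin 5 → Rel n
      kept zero                         = K₁
      kept (suc zero)                   = K₂
      kept (suc (suc zero))             = K₃
      kept (suc (suc (suc zero)))       = flip K₅
      kept (suc (suc (suc (suc zero)))) = flip K₄
      module A = Assemble G kept (λ v x w u y h₁ h₂ h₃ h₅ h₄ → kept-free v x w u y h₁ h₂ h₃ h₄ h₅)
      ring₁ : ∀ n s → n * s * (n * s) ≡ n * (n * (s * s))
      ring₁ = solve-∀
      ring₂ : ∀ a b c d e → a + (b + (c + (e + (d + 0)))) ≡ a + (b + (c + (d + e)))
      ring₂ = solve-∀
      missing : Fin 5 → ℕ
      missing i = count (between G i (suc5 i) ∖ kept i)
      reversed : ∀ i j (B : Rel n) → count (between G i j ∖ flip B) ≡ count (between G j i ∖ B)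
      reversed i j B = trans (∑-cong₂ λ a b → cong (λ z → ⟦ z ∧ not (B b a) ⟧) (Defs.sym G (i , a) (j , b))) (∑-comm _)
      few-removed : k * removedEdges G A.H ≤ n * s
      few-removed = begin
        k * removedEdges G A.H                                     ≤⟨ *-monoʳ-≤ k A.removed≤ ⟩
        k * ∑ missing                                                 ≡⟨ cong (k *_) (∑₅ missing) ⟩
        k * (missing part₀ + (missing part₁ + (missing part₂ + (missing part₃ + (missing part₄ + 0)))))
          ≡⟨ cong (k *_) (trans (cong₂ (λ y z → missing part₀ + (missing part₁ + (missing part₂ + (y + (z + 0)))))
               (reversed part₃ part₄ K₅) (reversed part₄ part₀ K₄)) (ring₂ (missing part₀) (missing part₁) (missing part₂)
               (count (between G part₀ part₄ ∖ K₄)) (count (between G part₄ part₃ ∖ K₅)))) ⟩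
        k * (count (between G part₀ part₁ ∖ K₁) + (count (between G part₁ part₂ ∖ K₂) + (count (between G part₂ part₃ ∖ K₃) +
          (count (between G part₀ part₄ ∖ K₄) + count (between G part₄ part₃ ∖ K₅))))) ≤⟨ total-sparse ⟩
        n * s                                                      ∎

    unchanged : copiesC5 (adj G) ≡ 0 → RemovalOf k G
    unchanged none = adj G , record { sub-sym = Defs.sym G ; sub-edge = λ x y eq → eq } , none ,
      ≤-trans (≤-reflexive (trans (cong (λ z → k * z * (k * z)) (removed-nothing G))
                                  (cong (λ z → z * z) (*-zeroʳ k)))) z≤n

    removal : 0 < k → (C : Constants k) → (let open Constants C using (K)) →
              K * copiesC4in2parts (adj G) ≤ n * n →
              K * K * (copiesC5 (adj G) * copiesC5 (adj G)) ≤ n * (n * (n * (n * n))) →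
              RemovalOf k G
    removal 0<k C few₄ few₅ = [ unchanged , fromCut ]′
      (Core.cut k n C _ _ _ _ _ (copiesC4in2parts (adj G)) (copiesC5 (adj G)) 0<k
        (few-between G part₀ part₁ (λ ())) (few-between G part₁ part₂ (λ ())) (few-between G part₂ part₃ (λ ()))
        (few-between G part₀ part₄ (λ ())) (few-between G part₄ part₃ (λ ())) (pentagons≤ G) few₄ few₅)

  ℕ→ℚ≡mkℚ : ∀ m → ℕ→ℚ m ≡ mkℚ (ℤ.+ m) 0 (coprime-sym (1-coprimeTo m))
  ℕ→ℚ≡mkℚ m = ℚₚ.normalize-coprime (coprime-sym (1-coprimeTo m))

  ℕ→ℚ-mono : ∀ {a b} → a ≤ b → ℕ→ℚ a ℚ.≤ ℕ→ℚ b
  ℕ→ℚ-mono {a} {b} a≤b rewrite ℕ→ℚ≡mkℚ a | ℕ→ℚ≡mkℚ b =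
    ℚ.*≤* (ℤₚ.*-monoʳ-≤-nonNeg (ℤ.+ 1) (ℤ.+≤+ a≤b))

  ℕ→ℚ-cancel : ∀ {a b} → ℕ→ℚ a ℚ.≤ ℕ→ℚ b → a ≤ b
  ℕ→ℚ-cancel {a} {b} h rewrite ℕ→ℚ≡mkℚ a | ℕ→ℚ≡mkℚ b =
    ℤₚ.drop‿+≤+ (ℤₚ.*-cancelʳ-≤-pos (ℤ.+ a) (ℤ.+ b) (ℤ.+ 1) (ℚₚ.drop-*≤* h))

  ℕ→ℚ-* : ∀ a b → ℕ→ℚ (a * b) ≡ ℕ→ℚ a ℚ.* ℕ→ℚ b
  ℕ→ℚ-* a b rewrite ℕ→ℚ≡mkℚ a | ℕ→ℚ≡mkℚ b = cong (ℚ._/ 1) (ℤₚ.pos-* a b)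

  ℕ→ℚ-nonNeg : ∀ m → ℚ.NonNegative (ℕ→ℚ m)
  ℕ→ℚ-nonNeg m = ℚₚ.normalize-nonNeg m 1

  ℕ→ℚ-pos : ∀ {m} → 0 < m → Positive (ℕ→ℚ m)
  ℕ→ℚ-pos {m} 0<m = ℚₚ.normalize-pos m 1 {{_}} {{>-nonZero 0<m}}

  scale-hypothesis : (K : ℕ) (δ : ℚ) → ℕ→ℚ K ℚ.* δ ≡ ℚ.1ℚ → ∀ {a b} → ℕ→ℚ a ℚ.≤ δ ℚ.* ℕ→ℚ b → K * a ≤ b
  scale-hypothesis K δ Kδ≡1 {a} {b} h = ℕ→ℚ-cancel (begin
    ℕ→ℚ (K * a)                      ≡⟨ ℕ→ℚ-* K a ⟩
    ℕ→ℚ K ℚ.* ℕ→ℚ a                  ≤⟨ ℚₚ.*-monoˡ-≤-nonNeg (ℕ→ℚ K) {{ℕ→ℚ-nonNeg K}} h ⟩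
    ℕ→ℚ K ℚ.* (δ ℚ.* ℕ→ℚ b)          ≡⟨ ℚₚ.*-assoc (ℕ→ℚ K) δ (ℕ→ℚ b) ⟨
    ℕ→ℚ K ℚ.* δ ℚ.* ℕ→ℚ b            ≡⟨ cong (ℚ._* ℕ→ℚ b) Kδ≡1 ⟩
    ℚ.1ℚ ℚ.* ℕ→ℚ b                   ≡⟨ ℚₚ.*-identityˡ (ℕ→ℚ b) ⟩
    ℕ→ℚ b                            ∎)
    where open ℚₚ.≤-Reasoning

  scale-conclusion : (k : ℕ) (ε : ℚ) → ℚ.1ℚ ℚ.≤ ℕ→ℚ k ℚ.* ε → Positive ε → ∀ {a b} → k * a ≤ b → ℕ→ℚ a ℚ.≤ ε ℚ.* ℕ→ℚ b
  scale-conclusion k ε 1≤kε ε>0 {a} {b} h = begin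
    ℕ→ℚ a                            ≡⟨ ℚₚ.*-identityˡ (ℕ→ℚ a) ⟨
    ℚ.1ℚ ℚ.* ℕ→ℚ a                   ≤⟨ ℚₚ.*-monoʳ-≤-nonNeg (ℕ→ℚ a) {{ℕ→ℚ-nonNeg a}} 1≤kε ⟩
    ℕ→ℚ k ℚ.* ε ℚ.* ℕ→ℚ a            ≡⟨ cong (ℚ._* ℕ→ℚ a) (ℚₚ.*-comm (ℕ→ℚ k) ε) ⟩
    ε ℚ.* ℕ→ℚ k ℚ.* ℕ→ℚ a            ≡⟨ ℚₚ.*-assoc ε (ℕ→ℚ k) (ℕ→ℚ a) ⟩
    ε ℚ.* (ℕ→ℚ k ℚ.* ℕ→ℚ a)          ≡⟨ cong (ε ℚ.*_) (ℕ→ℚ-* k a) ⟨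
    ε ℚ.* ℕ→ℚ (k * a)                ≤⟨ ℚₚ.*-monoˡ-≤-nonNeg ε {{ℚₚ.pos⇒nonNeg ε {{ε>0}}}} (ℕ→ℚ-mono h) ⟩
    ε ℚ.* ℕ→ℚ b                      ∎
    where open ℚₚ.≤-Reasoning

  positive-above-1/k : (ε : ℚ) → Positive ε → Σ ℕ λ k → 0 < k × ℚ.1ℚ ℚ.≤ ℕ→ℚ k ℚ.* ε
  positive-above-1/k ε@(mkℚ (ℤ.+ suc a) d c) ε>0 = suc d , s≤s z≤n , 1≤
    where
    1≤ : ℚ.1ℚ ℚ.≤ ℕ→ℚ (suc d) ℚ.* ε
    1≤ rewrite ℕ→ℚ≡mkℚ (suc d) = ℚₚ.toℚᵘ-cancel-≤ (ℚᵘₚ.≤-respʳ-≃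
      (ℚᵘₚ.≃-sym (ℚₚ.toℚᵘ-homo-* (mkℚ (ℤ.+ suc d) 0 (coprime-sym (1-coprimeTo (suc d)))) ε))
      (ℚᵘ.*≤* (ℤ.+≤+ (≤-trans (≤-reflexive (trans (*-identityˡ (1 * suc d)) (*-identityˡ (suc d))))
                       (≤-trans (m≤m*n (suc d) (suc a)) (≤-reflexive (sym (*-identityʳ (suc d * suc a)))))))))

  square-scale : (δ : ℚ) {K : ℕ} → ℕ→ℚ K ℚ.* δ ≡ ℚ.1ℚ → ℕ→ℚ (K * K) ℚ.* (δ ℚ.* δ) ≡ ℚ.1ℚ
  square-scale δ {K} Kδ≡1 = begin
    ℕ→ℚ (K * K) ℚ.* (δ ℚ.* δ)              ≡⟨ cong (ℚ._* (δ ℚ.* δ)) (ℕ→ℚ-* K K) ⟩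
    ℕ→ℚ K ℚ.* ℕ→ℚ K ℚ.* (δ ℚ.* δ)          ≡⟨ interchange (ℕ→ℚ K) (ℕ→ℚ K) δ δ ⟩
    ℕ→ℚ K ℚ.* δ ℚ.* (ℕ→ℚ K ℚ.* δ)          ≡⟨ cong₂ ℚ._*_ Kδ≡1 Kδ≡1 ⟩
    ℚ.1ℚ                                   ∎
    where open ≡-Reasoning

  square-above : (ε : ℚ) {k : ℕ} → Positive ε → ℚ.1ℚ ℚ.≤ ℕ→ℚ k ℚ.* ε → ℚ.1ℚ ℚ.≤ ℕ→ℚ (k * k) ℚ.* (ε ℚ.* ε)
  square-above ε {k} ε>0 1≤kε = begin
    ℚ.1ℚ                                   ≤⟨ 1≤kε ⟩
    ℕ→ℚ k ℚ.* ε                            ≡⟨ ℚₚ.*-identityˡ (ℕ→ℚ k ℚ.* ε) ⟨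
    ℚ.1ℚ ℚ.* (ℕ→ℚ k ℚ.* ε)                 ≤⟨ ℚₚ.*-monoʳ-≤-nonNeg (ℕ→ℚ k ℚ.* ε) {{kε≥0}} 1≤kε ⟩
    ℕ→ℚ k ℚ.* ε ℚ.* (ℕ→ℚ k ℚ.* ε)          ≡⟨ interchange (ℕ→ℚ k) ε (ℕ→ℚ k) ε ⟩
    ℕ→ℚ k ℚ.* ℕ→ℚ k ℚ.* (ε ℚ.* ε)          ≡⟨ cong (ℚ._* (ε ℚ.* ε)) (ℕ→ℚ-* k k) ⟨
    ℕ→ℚ (k * k) ℚ.* (ε ℚ.* ε)              ∎
    where
    open ℚₚ.≤-Reasoning
    kε≥0 : ℚ.NonNegative (ℕ→ℚ k ℚ.* ε)
    kε≥0 = ℚₚ.nonNeg*nonNeg⇒nonNeg (ℕ→ℚ k) {{ℕ→ℚ-nonNeg k}} ε {{ℚₚ.pos⇒nonNeg ε {{ε>0}}}}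

  a^2≡ : ∀ a → a ^ 2 ≡ a * a
  a^2≡ a = cong (a *_) (*-identityʳ a)

  a^3≡ : ∀ a → a ^ 3 ≡ a * (a * a)
  a^3≡ a = cong (a *_) (a^2≡ a)

  a^5≡ : ∀ a → a ^ 5 ≡ a * (a * (a * (a * a)))
  a^5≡ a = cong (λ z → a * (a * z)) (a^3≡ a)

  module _ (K : ℕ) (δ : ℚ) (Kδ≡1 : ℕ→ℚ K ℚ.* δ ≡ ℚ.1ℚ) where
    few-C4⇒ : ∀ q n → ℕ→ℚ q ℚ.≤ δ ℚ.* ℕ→ℚ (n ^ 2) → K * q ≤ n * n
    few-C4⇒ q n h = subst (K * q ≤_) (a^2≡ n) (scale-hypothesis K δ Kδ≡1 {q} {n ^ 2} h)

    few-C5⇒ : ∀ q n → ℕ→ℚ (q ^ 2) ℚ.≤ (δ ℚ.* δ) ℚ.* ℕ→ℚ (n ^ 5) → K * K * (q * q) ≤ n * (n * (n * (n * n)))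
    few-C5⇒ q n h = subst₂ (λ x y → K * K * x ≤ y) (a^2≡ q) (a^5≡ n)
      (scale-hypothesis (K * K) (δ ℚ.* δ) (square-scale δ {K} Kδ≡1) {q ^ 2} {n ^ 5} h)

  few-removed⇒ : (k : ℕ) (ε : ℚ) → Positive ε → ℚ.1ℚ ℚ.≤ ℕ→ℚ k ℚ.* ε → ∀ r n →
                 k * r * (k * r) ≤ n * (n * n) → ℕ→ℚ (r ^ 2) ℚ.≤ (ε ℚ.* ε) ℚ.* ℕ→ℚ (n ^ 3)
  few-removed⇒ k ε ε>0 1≤kε r n h = scale-conclusion (k * k) (ε ℚ.* ε) (square-above ε {k} ε>0 1≤kε)
    (ℚₚ.pos*pos⇒pos ε {{ε>0}} ε {{ε>0}}) {r ^ 2} {n ^ 3}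
    (subst₂ (λ x y → k * k * x ≤ y) (sym (a^2≡ r)) (sym (a^3≡ n)) (≤-trans (≤-reflexive (ring k r)) h))
    where
    ring : ∀ k r → k * k * (r * r) ≡ k * r * (k * r)
    ring = solve-∀

  reciprocal : (K : ℕ) → 0 < K → Σ ℚ λ δ → Positive δ × ℕ→ℚ K ℚ.* δ ≡ ℚ.1ℚ
  reciprocal K 0<K = (ℚ.1/ ℕ→ℚ K) {{K≢0}} , ℚₚ.1/pos⇒pos (ℕ→ℚ K) {{K>0}} , ℚₚ.*-inverseʳ (ℕ→ℚ K) {{K≢0}}
    where
    K>0 : Positive (ℕ→ℚ K)
    K>0 = ℕ→ℚ-pos 0<K
    K≢0 : ℚ.NonZero (ℕ→ℚ K)
    K≢0 = ℚₚ.pos⇒nonZero (ℕ→ℚ K) {{K>0}}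

  PentagonRemoval : ℚ → ℚ → Set
  PentagonRemoval ε δ = (n : ℕ) (G : CycGraph n) →
    ℕ→ℚ (copiesC4in2parts (adj G)) ℚ.≤ δ ℚ.* ℕ→ℚ (n ^ 2) →
    ℕ→ℚ (copiesC5 (adj G) ^ 2) ℚ.≤ (δ ℚ.* δ) ℚ.* ℕ→ℚ (n ^ 5) →
    Σ (Adj n) λ H → Subgraph H G × copiesC5 H ≡ 0 ×
      ℕ→ℚ (removedEdges G H ^ 2) ℚ.≤ (ε ℚ.* ε) ℚ.* ℕ→ℚ (n ^ 3)

  removal-for : (ε : ℚ) → Positive ε → (k : ℕ) → 0 < k → ℚ.1ℚ ℚ.≤ ℕ→ℚ k ℚ.* ε →
                (C : Constants k) (δ : ℚ) → ℕ→ℚ (Constants.K C) ℚ.* δ ≡ ℚ.1ℚ → PentagonRemoval ε δ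
  removal-for ε ε>0 k 0<k 1≤kε C δ Kδ≡1 n G few₄ few₅ = conclude (removal k G 0<k C
    (few-C4⇒ (Constants.K C) δ Kδ≡1 (copiesC4in2parts (adj G)) n few₄)
    (few-C5⇒ (Constants.K C) δ Kδ≡1 (copiesC5 (adj G)) n few₅))
    where
    conclude : RemovalOf k G → Σ (Adj n) λ H → Subgraph H G × copiesC5 H ≡ 0 ×
               ℕ→ℚ (removedEdges G H ^ 2) ℚ.≤ (ε ℚ.* ε) ℚ.* ℕ→ℚ (n ^ 3)
    conclude (H , sub , free , few) = H , sub , free , few-removed⇒ k ε ε>0 1≤kε (removedEdges G H) n few

  pentagon-removal : (ε : ℚ) → Positive ε → Σ ℚ λ δ → Positive δ × PentagonRemoval ε δ
  pentagon-removal ε ε>0 =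
    let (k , 0<k , 1≤kε)    = positive-above-1/k ε ε>0
        C                   = constants k
        (δ , δ>0 , Kδ≡1)    = reciprocal (Constants.K C) (subst (0 <_) (sym (Constants.K≡ C)) (s≤s z≤n))
    in δ , δ>0 , removal-for ε ε>0 k 0<k 1≤kε C δ Kδ≡1

open import Defs
open import Data.Nat using (ℕ; _^_)
open import Data.Product using (Σ; _×_)
open import Data.Rational using (ℚ; Positive; _≤_; _*_)
open import Relation.Binary.PropositionalEquality using (_≡_)

theorem1p7 : (ε : ℚ) → Positive ε →
    Σ ℚ (λ δ → Positive δ ×
    ((n : ℕ) (G : CycGraph n) →
    ℕ→ℚ (copiesC4in2parts (adj G)) ≤ δ * ℕ→ℚ (n ^ 2) →
    ℕ→ℚ (copiesC5 (adj G) ^ 2) ≤ (δ * δ) * ℕ→ℚ (n ^ 5) →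
    Σ (Adj n) (λ H → Subgraph H G × copiesC5 H ≡ 0 ×
    ℕ→ℚ (removedEdges G H ^ 2) ≤ (ε * ε) * ℕ→ℚ (n ^ 3))))
theorem1p7 = PentagonRemoval.pentagon-removal
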